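{- Let $k \ge 11$ and let $R$ be a rainbow clique on $k$ vertices. Then $R$ is a fractalizer, and \[ \operatorname{ind}(R) = \frac{k!}{k^k-k}. \]
   Context: An edge-coloring of a complete graph $G$ is a function $\chi: E(G) \to T$ for a set $T$ of colors; $G$ is then $T$-colored. A colored complete graph is rainbow if its coloring is injective. Two colored complete graphs $G, H$ are isomorphic if there is a bijection $V(G)\to V(H)$ preserving the colors of all edges. For a $T$-colored complete graph $F$ on $k$ vertices and a $T$-colored complete graph $G$ on $n>k$ vertices, let $I(F,G)$ be the number of $k$-subsets $S\subseteq V(G)$ with $G[S]\cong F$ (as colored graphs), and $\varrho(F,G) = I(F,G)/\binom{n}{k}$. Let $I(F,n)$ be the maximum of $I(F,G)$ over all $T$-colored complete graphs $G$ on $n$ vertices, $\operatorname{ind}(F,n) = I(F,n)/\binom nk$ (a non-increasing sequence in $n$), and the inducibility $\operatorname{ind}(F) = \lim_{n\to\infty}\operatorname{ind}(F,n)$. Iterated balanced blow-up: label $V(F)=[k]$. Define families $\mathcal{G}_F(n)$ of $T$-colored complete graphs on $n$ vertices inductively: for $n<k$, $\mathcal{G}_F(n)$ consists of a $T$-colored complete graph on $n$ vertices (it contains no $k$-subsets, so its coloring is irrelevant); for $n \ge k$, $G \in \mathcal{G}_F(n)$ if there is a partition $V(G) = V_1\cup\cdots\cup V_k$ with $||V_i|-|V_j||\le 1$ for all $i,j$, $G[V_i]\in\mathcal{G}_F(|V_i|)$ for all $i$, and for $v\in V_i$, $w\in V_j$, $i\ne j$, the color of $vw$ in $G$ equals the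 color of $ij$ in $F$. $F$ is a fractalizer if $\operatorname{ind}(F) = \lim_{n\to\infty}\max_{G\in\mathcal{G}_F(n)}\varrho(F,G)$. -}

module Defs where

open import Level using (0ℓ)
open import Data.Nat as ℕ using (ℕ; zero; suc; _∸_; _^_; _!)
open import Data.Nat.Combinatorics using (_C_)
open import Data.Integer using (+_)
open import Data.Rational using (ℚ; 0ℚ; _/_; _-_; ∣_∣) renaming (_≤_ to _≤ℚ_; _<_ to _<ℚ_)
open import Data.Fin using (Fin)
open import Data.Fin.Subset using (Subset) renaming (_∈_ to _∈ₛ_)
open import Data.List using (List; length)
open import Data.List.Membership.Propositional using (_∈_)
open import Data.List.Relation.Unary.Unique.Propositional using (Unique)
open import Data.Product using (Σ; ∃; _×_; _,_)
open import Data.Sum using (_⊎_)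
open import Data.Unit using (⊤)
open import Relation.Binary.PropositionalEquality using (_≡_; _≢_)
open import Function.Bundles using (_⇔_)
open import Function.Definitions using (Injective)

-- A T-colored complete graph on vertex set Fin n: a symmetric colouring of
-- pairs of distinct vertices (values on the diagonal are irrelevant).
record ColGraph (T : Set) (n : ℕ) : Set where
  constructor mkColGraph
  field
    col : Fin n → Fin n → T
    sym : ∀ i j → col i j ≡ col j i
open ColGraph public

Rainbow : {T : Set} {k : ℕ} → ColGraph T k → Set
Rainbow {k = k} F = ∀ (i j i' j' : Fin k) → i ≢ j → i' ≢ j' →
  col F i j ≡ col F i' j' → (i ≡ i' × j ≡ j') ⊎ (i ≡ j' × j ≡ i')

InducedCopy : {T : Set} {k n : ℕ} → ColGraph T k → ColGraph T n → Subset n → Set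
InducedCopy {k = k} {n = n} F G S =
  Σ (Fin k → Fin n) λ φ →
    Injective _≡_ _≡_ φ ×
    (∀ (v : Fin n) → (v ∈ₛ S) ⇔ (∃ λ i → φ i ≡ v)) ×
    (∀ (i j : Fin k) → i ≢ j → col G (φ i) (φ j) ≡ col F i j)

CountIs : {n : ℕ} → (Subset n → Set) → ℕ → Set
CountIs {n} P m = Σ (List (Subset n)) λ L →
  Unique L × (∀ S → (S ∈ L) ⇔ P S) × length L ≡ m

ICount : {T : Set} {k n : ℕ} → ColGraph T k → ColGraph T n → ℕ → Set
ICount F G m = CountIs (InducedCopy F G) m

-- a / b as a rational (b = 0 gives 0; only used with b > 0).
divℕ : ℕ → ℕ → ℚ
divℕ a zero = 0ℚ
divℕ a (suc b) = (+ a) / suc b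

-- ϱ(F,G) = I(F,G) / binom(n,k), with I(F,G) = m
density : (k n m : ℕ) → ℚ
density k n m = divℕ m (n C k)

IsMaxDensity : {T : Set} {k : ℕ} → ColGraph T k → (n : ℕ) →
               (ColGraph T n → Set) → ℚ → Set
IsMaxDensity {T} {k} F n Fam x =
  (Σ (ColGraph T n) λ G → Fam G × ∃ λ m → ICount F G m × density k n m ≡ x) ×
  (∀ (G : ColGraph T n) → Fam G → ∀ m → ICount F G m → density k n m ≤ℚ x)

IndIs : {T : Set} {k : ℕ} → ColGraph T k → ℕ → ℚ → Set
IndIs F n x = IsMaxDensity F n (λ _ → ⊤) x

restrict : {T : Set} {m n : ℕ} → ColGraph T n → (Fin m → Fin n) → ColGraph T m
restrict G e = mkColGraph (λ a b → col G (e a) (e b)) (λ a b → sym G (e a) (e b))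

data Blowup {T : Set} {k : ℕ} (F : ColGraph T k) : (n : ℕ) → ColGraph T n → Set where
  small : ∀ {n} (G : ColGraph T n) → n ℕ.< k → Blowup F n G
  big   : ∀ {n} (G : ColGraph T n) → k ℕ.≤ n →
          (part : Fin n → Fin k) →
          (size : Fin k → ℕ) →
          (emb : (i : Fin k) → Fin (size i) → Fin n) →
          (∀ i → Injective _≡_ _≡_ (emb i)) →
          (∀ i a → part (emb i a) ≡ i) →
          (∀ v → ∃ λ a → emb (part v) a ≡ v) →
          (∀ i j → size i ℕ.≤ suc (size j)) →
          (∀ i → Blowup F (size i) (restrict G (emb i))) →
          (∀ v w → part v ≢ part w → col G v w ≡ col F (part v) (part w)) →
          Blowup F n G

BlowupMaxIs : {T : Set} {k : ℕ} → ColGraph T k → ℕ → ℚ → Set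
BlowupMaxIs F n x = IsMaxDensity F n (Blowup F n) x

-- The sequence whose n-th value is (the unique x with) P n x tends to q.
LimitIs : (ℕ → ℚ → Set) → ℚ → Set
LimitIs P q = ∀ (ε : ℚ) → 0ℚ <ℚ ε → ∃ λ N → ∀ n → N ℕ.≤ n → ∀ x → P n x → ∣ x - q ∣ <ℚ ε

InducibilityIs : {T : Set} {k : ℕ} → ColGraph T k → ℚ → Set
InducibilityIs F q = LimitIs (IndIs F) q

FractalizerWith : {T : Set} {k : ℕ} → ColGraph T k → ℚ → Set
FractalizerWith F q = InducibilityIs F q × LimitIs (BlowupMaxIs F) q

{-# OPTIONS --safe #-}

-- A vertex v in role i of a copy sees the other vertices of the copy through the
-- k - 1 colours at i, so it lies in at most ∏_j d_ij(v) such copies, where d_ij(v) counts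
-- the neighbours of v in the colour ij.  The upper bound K N < (n + 1)^k, with
-- K = k^k - k, is proved for the number N of copies in every set of n vertices, by
-- induction on n.  A vertex in few copies is deleted.  If there is none, AM-GM shows
-- that almost all colours at each v belong to one dominant role ρ v, so that copies using
-- v in another role are extremely rare.  For the partition by ρ, an edge between two
-- parts with a wrong colour destroys many more transversals than the number of copies
-- it can belong to; hence N ≤ ∏ n_a + ∑ N(V_a), and AM-GM over the non-constant words
-- in the expansion of (∑ n_a)^k closes the induction.
-- For the lower bound, colour the edge vw by the lowest base-k digits in which v and w
-- differ.  This is an iterated balanced blow-up, and it has at least (n - k)^k / K copies.
module Submission where

open import Defs renaming (sym to col-sym)
open import Data.Bool using (true; false; if_then_else_)
open import Data.Empty using (⊥; ⊥-elim)
open import Data.Fin using (Fin; zero; suc; toℕ; fromℕ<)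
import Data.Fin as Fin
import Data.Fin.Properties as Fin
open import Data.Fin.Subset using (Subset) renaming (_∈_ to _∈ₛ_)
import Data.Fin.Subset.Properties as Subset
open import Data.Integer as ℤ using () renaming (+_ to pos)
import Data.Integer.Properties as ℤ
open import Data.List using (List; []; _∷_; _++_; map; length; concat; filter; allFin; cartesianProduct; cartesianProductWith)
open import Data.List.Extrema.Nat using (argmax; f[xs]≤f[argmax])
open import Data.List.Membership.Propositional using (_∈_; find; lose)
open import Data.List.Membership.Propositional.Properties
open import Data.List.Properties using (map-cong; map-∘; map-++; length-map; length-++; length-tabulate; map-tabulate)
open import Data.List.Relation.Binary.Disjoint.Propositional using (Disjoint)
open import Data.List.Relation.Binary.Permutation.Propositional using (_↭_; ↭-refl; ↭-sym; ↭-trans; prep; swap; ↭⇒↭ₛ)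
open import Data.List.Relation.Binary.Permutation.Propositional.Properties using (shift; ∈-resp-↭; ↭-length; drop-∷) renaming (map⁺ to ↭-map⁺)
import Data.List.Relation.Binary.Permutation.Setoid.Properties as Permutationₛ
open import Data.List.Relation.Unary.All using (All; []; _∷_)
import Data.List.Relation.Unary.All as All
import Data.List.Relation.Unary.All.Properties as All
open import Data.List.Relation.Unary.AllPairs using (AllPairs; []; _∷_)
import Data.List.Relation.Unary.AllPairs as AllPairs
import Data.List.Relation.Unary.AllPairs.Properties as AllPairs
open import Data.List.Relation.Unary.Any using (Any; here; there)
import Data.List.Relation.Unary.Any as Any
open import Data.List.Relation.Unary.Any.Properties using () renaming (map⁻ to Any-map⁻)
open import Data.List.Relation.Unary.Unique.Propositional using (Unique)
import Data.List.Relation.Unary.Unique.Propositional.Properties as Unique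
open import Data.Nat
open import Data.Nat.Combinatorics using (_C_; nCk≡nC[n∸k]; nCn≡1; k>n⇒nCk≡0; nCk+nC[k+1]≡[n+1]C[k+1])
open import Data.Nat.Coprimality using (Coprime)
open import Data.Nat.DivMod
open import Data.Nat.Induction using (Acc; acc; <-wellFounded)
open import Data.Nat.ListAction using (sum; product)
open import Data.Nat.ListAction.Properties using (sum-++; product-++; sum-↭; product-↭)
open import Data.Nat.Properties
open import Data.Nat.Tactic.RingSolver using (solve-∀)
open import Data.Product using (∃; ∃₂; _×_; _,_; proj₁; proj₂; uncurry)
open import Data.Rational using (ℚ; mkℚ; ∣_∣; toℚᵘ) renaming (_+_ to _+ℚ_; _-_ to _-ℚ_; -_ to -ℚ_; _<_ to _<ℚ_; _≤_ to _≤ℚ_)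
import Data.Rational as ℚ
import Data.Rational.Properties as ℚ
open import Data.Rational.Unnormalised as ℚᵘ using (mkℚᵘ)
import Data.Rational.Unnormalised.Properties as ℚᵘ
open import Data.Sum using (_⊎_; inj₁; inj₂)
import Data.Sum as Sum
open import Data.Unit using (⊤; tt)
open import Data.Vec using (Vec; []; _∷_; lookup; replicate)
import Data.Vec as Vec
import Data.Vec.Properties as Vec
open import Function using (_∘_; id)
open import Function.Bundles using (_⇔_; mk⇔; Equivalence)
open import Relation.Binary.PropositionalEquality
open import Relation.Nullary using (Dec; does; yes; no; ¬_; contradiction)
open import Relation.Nullary.Decidable using (_×-dec_; _→-dec_; _⊎-dec_; ¬?; map′; isYes)

open import Algebra.Properties.AbelianGroup ℚ.+-0-abelianGroup using (xyx⁻¹≈y; ⁻¹-anti-homo‿-)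

-- The bound is on (n + 1)^k and strict for two reasons. Deleting a vertex leaves room for (n + 1)^k
-- - n^k ≥ k n^(k-1), so every vertex that cannot be deleted lies in more than (n/k)^(k-1) copies,
-- with no lower-order error. And (n + 1)^k - 1 is n^k plus a superadditive function vanishing at 0,
-- so the errors of the parts sum to at most the error of the whole; an asymptotic bound would not
-- survive a recursion of unbounded depth.
--
-- The obstacle is to weigh a wrongly coloured edge against the transversals it destroys, which
-- needs a lower bound on the product of the part sizes before anything is known about them. A
-- first, crude count provides it: copies with a vertex outside its dominant role are at most half
-- of those guaranteed by the degrees, so the product is at least n^k / (2 k^k). Only then can wrong
-- edges be charged one by one. That the parts are nearly equal is never shown; AM-GM absorbs any
-- imbalance.

private
  variable
    A A′ : Set
    P Q : Set

-- Inequalities for powers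

^-distribʳ-* : ∀ m n o → (m * n) ^ o ≡ m ^ o * n ^ o
^-distribʳ-* m n zero    = refl
^-distribʳ-* m n (suc o) rewrite ^-distribʳ-* m n o = interchange m n (m ^ o) (n ^ o)
  where
  interchange : ∀ a b c d → a * b * (c * d) ≡ a * c * (b * d)
  interchange = solve-∀

^-cancelˡ-≤ : ∀ {m n} o .{{_ : NonZero o}} → m ^ o ≤ n ^ o → m ≤ n
^-cancelˡ-≤ {m} {n} o mᵒ≤nᵒ with m ≤? n
... | yes m≤n = m≤n
... | no  m≰n = contradiction mᵒ≤nᵒ (<⇒≱ (^-monoˡ-< o (≰⇒> m≰n)))

2xy≤x²+y² : ∀ x y → 2 * (x * y) ≤ x * x + y * y
2xy≤x²+y² x y with ≤-total x y
... | inj₁ x≤y = help (m≤n⇒∃[o]m+o≡n x≤y)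
  where
  help : ∀ {x y} → ∃ (λ o → x + o ≡ y) → 2 * (x * y) ≤ x * x + y * y
  help {x} (o , refl) = subst (2 * (x * (x + o)) ≤_) (eq x o) (m≤m+n _ (o * o))
    where
    eq : ∀ x o → 2 * (x * (x + o)) + o * o ≡ x * x + (x + o) * (x + o)
    eq = solve-∀
... | inj₂ y≤x = help (m≤n⇒∃[o]m+o≡n y≤x)
  where
  help : ∀ {x y} → ∃ (λ o → y + o ≡ x) → 2 * (x * y) ≤ x * x + y * y
  help {_} {y} (o , refl) = subst (2 * ((y + o) * y) ≤_) (eq y o) (m≤m+n _ (o * o))
    where
    eq : ∀ y o → 2 * ((y + o) * y) + o * o ≡ (y + o) * (y + o) + y * y
    eq = solve-∀

-- The graph of the power lies above its tangent at `y`. The same multiple of `x * y ^ suc m` is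
-- added to both sides of the induction step to avoid a subtraction.
tangent : ∀ x y m → suc m * (x * y ^ m) ≤ x ^ suc m + m * y ^ suc m
tangent x y zero    = ≤-reflexive (eq x)
  where
  eq : ∀ x → 1 * (x * 1) ≡ x * 1 + 0
  eq = solve-∀
tangent x y (suc m) = +-cancelʳ-≤ (m * (x * (y * Y))) _ _ (begin
  suc (suc m) * (x * (y * Y)) + m * (x * (y * Y))             ≡⟨ eq₁ x y Y m ⟩
  suc m * Y * (2 * (x * y))                                   ≤⟨ *-monoʳ-≤ (suc m * Y) (2xy≤x²+y² x y) ⟩
  suc m * Y * (x * x + y * y)                                 ≡⟨ eq₂ x y Y m ⟩
  x * (suc m * (x * Y)) + suc m * (y * (y * Y))               ≤⟨ +-monoˡ-≤ _ (*-monoʳ-≤ x (tangent x y m)) ⟩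
  x * (x ^ suc m + m * y ^ suc m) + suc m * (y * (y * Y))     ≡⟨ eq₃ x y Y m (x ^ suc m) ⟩
  x * x ^ suc m + suc m * (y * (y * Y)) + m * (x * (y * Y))   ∎)
  where
  open ≤-Reasoning
  Y = y ^ m
  eq₁ : ∀ x y Y m → suc (suc m) * (x * (y * Y)) + m * (x * (y * Y)) ≡ suc m * Y * (2 * (x * y))
  eq₁ = solve-∀
  eq₂ : ∀ x y Y m → suc m * Y * (x * x + y * y) ≡ x * (suc m * (x * Y)) + suc m * (y * (y * Y))
  eq₂ = solve-∀
  eq₃ : ∀ x y Y m X → x * (X + m * (y * Y)) + suc m * (y * (y * Y))
                    ≡ x * X + suc m * (y * (y * Y)) + m * (x * (y * Y))
  eq₃ = solve-∀

-- The tangent inequality at x = m (S + b), y = (m + 1) S.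
am-gm-step : ∀ b S m → b * S ^ m * suc m ^ suc m ≤ (b + S) ^ suc m * m ^ m
am-gm-step b S zero      = ≤-trans (≤-reflexive (eq₁ b)) (≤-trans (m≤m+n b S) (≤-reflexive (eq₂ b S)))
  where
  eq₁ : ∀ b → b * 1 * 1 ≡ b
  eq₁ = solve-∀
  eq₂ : ∀ b S → b + S ≡ (b + S) * 1 * 1
  eq₂ = solve-∀
am-gm-step b S (suc m′) = *-cancelˡ-≤ m (+-cancelʳ-≤ (m * (suc m * S * Y)) _ _ (begin
  m * (b * S ^ m * (suc m * suc m ^ m)) + m * (suc m * S * Y)   ≡⟨ cong (λ z → z + m * (suc m * S * Y)) e₁ ⟩
  m * (b * suc m * Y) + m * (suc m * S * Y)                     ≡⟨ eq₁ m b S Y ⟩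
  suc m * (m * (b + S) * Y)                                     ≤⟨ tangent (m * (b + S)) (suc m * S) m ⟩
  (m * (b + S)) ^ suc m + m * (suc m * S * Y)                   ≡⟨ cong (_+ m * (suc m * S * Y)) e₂ ⟩
  m * ((b + S) ^ suc m * m ^ m) + m * (suc m * S * Y)           ∎))
  where
  open ≤-Reasoning
  m = suc m′
  Y = (suc m * S) ^ m
  e₁ : m * (b * S ^ m * (suc m * suc m ^ m)) ≡ m * (b * suc m * Y)
  e₁ = cong (m *_) (trans (a b (S ^ m) (suc m) (suc m ^ m)) (cong (b * suc m *_) (sym (^-distribʳ-* (suc m) S m))))
    where
    a : ∀ b s t u → b * s * (t * u) ≡ b * t * (u * s)
    a = solve-∀
  e₂ : (m * (b + S)) ^ suc m ≡ m * ((b + S) ^ suc m * m ^ m)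
  e₂ = trans (^-distribʳ-* m (b + S) (suc m)) (a m (m ^ m) ((b + S) ^ suc m))
    where
    a : ∀ x y z → x * y * z ≡ x * (z * y)
    a = solve-∀
  eq₁ : ∀ m b S Y → m * (b * suc m * Y) + m * (suc m * S * Y) ≡ suc m * (m * (b + S) * Y)
  eq₁ = solve-∀

bernoulli : ∀ x m → x ^ suc m + suc m * x ^ m ≤ suc x ^ suc m
bernoulli x zero    = ≤-reflexive (eq x)
  where
  eq : ∀ x → x * 1 + 1 ≡ suc x * 1
  eq = solve-∀
bernoulli x (suc m) = begin
  x * (x * X) + suc (suc m) * (x * X)            ≤⟨ m≤m+n _ (suc m * X) ⟩
  x * (x * X) + suc (suc m) * (x * X) + suc m * X ≡⟨ eq x X m ⟩
  suc x * (x * X + suc m * X)                    ≤⟨ *-monoʳ-≤ (suc x) (bernoulli x m) ⟩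
  suc x * suc x ^ suc m                          ∎
  where
  open ≤-Reasoning
  X = x ^ m
  eq : ∀ x X m → x * (x * X) + suc (suc m) * (x * X) + suc m * X ≡ suc x * (x * X + suc m * X)
  eq = solve-∀

-- A discrete mean value estimate. The case `x ≤ y` is split off because the induction replaces
-- `y ^ suc m` by `x ^ suc m`.
^-growth : ∀ {x y} h → x ≤ y + h → ∀ m → x ^ suc m ≤ y ^ suc m + suc m * h * x ^ m
^-growth {x} {y} h x≤y+h m with ≤-total x y
... | inj₁ x≤y = ≤-trans (^-monoˡ-≤ (suc m) x≤y) (m≤m+n _ _)
... | inj₂ y≤x = go m
  where
  open ≤-Reasoning
  go : ∀ m → x ^ suc m ≤ y ^ suc m + suc m * h * x ^ m
  go zero    = ≤-trans (*-monoˡ-≤ 1 x≤y+h) (≤-reflexive (eq y h))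
    where
    eq : ∀ y h → (y + h) * 1 ≡ y * 1 + 1 * h * 1
    eq = solve-∀
  go (suc m) = begin
    x * x ^ suc m                                       ≤⟨ *-monoʳ-≤ x (go m) ⟩
    x * (y ^ suc m + suc m * h * x ^ m)                 ≡⟨ *-distribˡ-+ x _ _ ⟩
    x * y ^ suc m + x * (suc m * h * x ^ m)             ≤⟨ +-monoˡ-≤ _ (*-monoˡ-≤ (y ^ suc m) x≤y+h) ⟩
    (y + h) * y ^ suc m + x * (suc m * h * x ^ m)       ≡⟨ cong (_+ x * (suc m * h * x ^ m)) (*-distribʳ-+ (y ^ suc m) y h) ⟩
    y * y ^ suc m + h * y ^ suc m + x * (suc m * h * x ^ m)
      ≤⟨ +-monoˡ-≤ _ (+-monoʳ-≤ (y * y ^ suc m) (*-monoʳ-≤ h (^-monoˡ-≤ (suc m) y≤x))) ⟩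
    y * y ^ suc m + h * (x * x ^ m) + x * (suc m * h * x ^ m)
      ≡⟨ eq (y * y ^ suc m) h x (x ^ m) m ⟩
    y * y ^ suc m + suc (suc m) * h * (x * x ^ m)       ∎
    where
    eq : ∀ a h x X m → a + h * (x * X) + x * (suc m * h * X) ≡ a + suc (suc m) * h * (x * X)
    eq = solve-∀

Superadditive : (ℕ → ℕ) → Set
Superadditive g = ∀ x y → g x + g y ≤ g (x + y)

-- (x + 1) ^ (j + 1) - 1, and its part of degree at most j.
shift-power lower-terms : ℕ → ℕ → ℕ
shift-power zero    x = x
shift-power (suc j) x = suc x * shift-power j x + x
lower-terms zero    x = 0
lower-terms (suc j) x = x * lower-terms j x + shift-power j x + x

shift-power-spec : ∀ j x → suc (shift-power j x) ≡ suc x ^ suc j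
shift-power-spec zero    x = sym (*-identityʳ (suc x))
shift-power-spec (suc j) x = trans (eq x (shift-power j x)) (cong (suc x *_) (shift-power-spec j x))
  where
  eq : ∀ x s → suc (suc x * s + x) ≡ suc x * suc s
  eq = solve-∀

shift-power-split : ∀ j x → shift-power j x ≡ x ^ suc j + lower-terms j x
shift-power-split zero    x = eq x
  where
  eq : ∀ x → x ≡ x * 1 + 0
  eq = solve-∀
shift-power-split (suc j) x rewrite shift-power-split j x = eq x (x ^ suc j) (lower-terms j x)
  where
  eq : ∀ x a b → suc x * (a + b) + x ≡ x * a + (x * b + (a + b) + x)
  eq = solve-∀

superadditive-+ : ∀ g h → Superadditive g → Superadditive h → Superadditive (λ x → g x + h x)
superadditive-+ g h sg sh x y = ≤-trans (≤-reflexive (eq (g x) (h x) (g y) (h y))) (+-mono-≤ (sg x y) (sh x y))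
  where
  eq : ∀ a b c d → a + b + (c + d) ≡ a + c + (b + d)
  eq = solve-∀

superadditive-* : ∀ g → Superadditive g → Superadditive (λ x → x * g x)
superadditive-* g sg x y = begin
  x * g x + y * g y                ≤⟨ m≤m+n _ (x * g y + y * g x) ⟩
  x * g x + y * g y + (x * g y + y * g x) ≡⟨ eq x y (g x) (g y) ⟩
  (x + y) * (g x + g y)            ≤⟨ *-monoʳ-≤ (x + y) (sg x y) ⟩
  (x + y) * g (x + y)              ∎
  where
  open ≤-Reasoning
  eq : ∀ x y a b → x * a + y * b + (x * b + y * a) ≡ (x + y) * (a + b)
  eq = solve-∀

shift-power-superadditive : ∀ j → Superadditive (shift-power j)
shift-power-superadditive zero    x y = ≤-refl
shift-power-superadditive (suc j) =
  superadditive-+ (λ x → suc x * s x) (λ x → x)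
    (superadditive-+ s (λ x → x * s x) sj (superadditive-* s sj)) (λ x y → ≤-refl)
  where
  s  = shift-power j
  sj = shift-power-superadditive j

-- The recursion uses only sums and multiplication by the argument, and both keep superadditivity.
-- This is what lets the errors of the parts be added up in `copies-bound`.
lower-terms-superadditive : ∀ j → Superadditive (lower-terms j)
lower-terms-superadditive zero    x y = z≤n
lower-terms-superadditive (suc j) =
  superadditive-+ (λ x → x * t x + s x) (λ x → x)
    (superadditive-+ (λ x → x * t x) s (superadditive-* t (lower-terms-superadditive j)) (shift-power-superadditive j))
    (λ x y → ≤-refl)
  where
  s = shift-power j
  t = lower-terms j

lower-terms-0 : ∀ j → lower-terms j 0 ≡ 0
lower-terms-0 zero          = refl
lower-terms-0 (suc zero)    = refl
lower-terms-0 (suc (suc j)) = trans (+-identityʳ _) (s0 (suc j))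
  where
  s0 : ∀ j → shift-power j 0 ≡ 0
  s0 zero    = refl
  s0 (suc j) = trans (+-identityʳ _) (trans (+-identityʳ _) (s0 j))

-- Here 3 + 4 * m′ = 4 * m - 1.
dominant-gap : ∀ m′ → let m = suc m′ in 5 * (3 + 4 * m′) ^ m ≤ 4 * (4 * m) ^ m
dominant-gap m′ = *-cancelˡ-≤ y (begin
  y * (5 * y ^ m)                ≡⟨ eq₁ m′ (y ^ m′) ⟩
  5 * y * (y * y ^ m′)           ≤⟨ *-monoˡ-≤ (y ^ m) 5y≤4[y+m] ⟩
  4 * (y + m) * (y * y ^ m′)     ≡⟨ eq₂ y m (y ^ m′) ⟩
  4 * y * (y ^ m + m * y ^ m′)   ≤⟨ *-monoʳ-≤ (4 * y) (bernoulli y m′) ⟩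
  4 * y * suc y ^ m              ≡⟨ cong (λ z → 4 * y * z ^ m) (eq₃ m′) ⟩
  4 * y * (4 * m) ^ m            ≡⟨ eq₄ y ((4 * m) ^ m) ⟩
  y * (4 * (4 * m) ^ m)          ∎)
  where
  open ≤-Reasoning
  m = suc m′
  y = 3 + 4 * m′
  -- Bernoulli gives the growth factor `1 + m / y`, which exceeds `5 / 4` because `y = 4 * m - 1`.
  5y≤4[y+m] : 5 * y ≤ 4 * (y + m)
  5y≤4[y+m] = ≤-trans (m≤m+n _ 1) (≤-reflexive (e m′))
    where
    e : ∀ m′ → 5 * (3 + 4 * m′) + 1 ≡ 4 * (3 + 4 * m′ + suc m′)
    e = solve-∀
  eq₁ : ∀ m′ Y → let y = 3 + 4 * m′ in y * (5 * (y * Y)) ≡ 5 * y * (y * Y)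
  eq₁ = solve-∀
  eq₂ : ∀ y m Y → 4 * (y + m) * (y * Y) ≡ 4 * y * (y * Y + m * Y)
  eq₂ = solve-∀
  eq₃ : ∀ m′ → suc (3 + 4 * m′) ≡ 4 * suc m′
  eq₃ = solve-∀
  eq₄ : ∀ y z → 4 * y * z ≡ y * (4 * z)
  eq₄ = solve-∀

-- The two places where k ≥ 11 enters; l = k - 3.
non-dominant-numeric : ∀ l → 8 ≤ l → 5 * (3 + l) ^ (3 + l) ≤ 2 ^ (1 + l) * (2 + l) ^ (2 + l)
non-dominant-numeric l 8≤l = *-cancelˡ-≤ (10 ^ k) {{m^n≢0 10 k}} (begin
  10 ^ k * (5 * k ^ k)                        ≡⟨ eq₁ (10 ^ k) (k ^ k) ⟩
  5 * (10 ^ k * k ^ k)                        ≡⟨ cong (5 *_) (sym (^-distribʳ-* 10 k k)) ⟩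
  5 * (10 * k) ^ k                            ≤⟨ *-monoʳ-≤ 5 (^-monoˡ-≤ k 10k≤11m) ⟩
  5 * (11 * m) ^ k                            ≡⟨ cong (5 *_) (^-distribʳ-* 11 m k) ⟩
  5 * (11 ^ k * (m * m ^ m))                  ≡⟨ eq₂ (11 ^ k) m (m ^ m) ⟩
  5 * 11 ^ k * m * m ^ m                      ≤⟨ *-monoˡ-≤ (m ^ m) (base (m≤n⇒∃[o]m+o≡n 8≤l)) ⟩
  10 ^ k * 2 ^ (1 + l) * m ^ m                ≡⟨ *-assoc (10 ^ k) _ _ ⟩
  10 ^ k * (2 ^ (1 + l) * m ^ m)              ∎)
  where
  open ≤-Reasoning
  k = 3 + l
  m = 2 + l
  eq₁ : ∀ a b → a * (5 * b) ≡ 5 * (a * b)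
  eq₁ = solve-∀
  eq₂ : ∀ a m b → 5 * (a * (m * b)) ≡ 5 * a * m * b
  eq₂ = solve-∀
  -- As `k = m + 1`, this amounts to `m ≥ 10`; it replaces `k ^ k` by a multiple of `m ^ k`.
  10k≤11m : 10 * k ≤ 11 * m
  10k≤11m = help (m≤n⇒∃[o]m+o≡n 8≤l)
    where
    e : ∀ o → 10 * (3 + (8 + o)) + o ≡ 11 * (2 + (8 + o))
    e = solve-∀
    help : ∃ (λ o → 8 + o ≡ l) → 10 * (3 + l) ≤ 11 * (2 + l)
    help (o , refl) = ≤-trans (m≤m+n _ o) (≤-reflexive (e o))
  go : ∀ o → let l = 8 + o in 5 * 11 ^ (3 + l) * (2 + l) ≤ 10 ^ (3 + l) * 2 ^ (1 + l)
  go zero    = ≤ᵇ⇒≤ _ _ _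
  go (suc o) = begin
    5 * (11 * a) * (11 + o)         ≡⟨ e₁ a o ⟩
    11 * (11 + o) * (5 * a)         ≤⟨ *-monoˡ-≤ (5 * a) (≤-trans (m≤m+n _ (79 + 9 * o)) (≤-reflexive (e₂ o))) ⟩
    20 * (10 + o) * (5 * a)         ≡⟨ e₃ a o ⟩
    20 * (5 * a * (10 + o))         ≤⟨ *-monoʳ-≤ 20 (go o) ⟩
    20 * (b * c)                    ≡⟨ e₄ b c ⟩
    10 * b * (2 * c)                ∎
    where
    a = 11 ^ (11 + o)
    b = 10 ^ (11 + o)
    c = 2 ^ (9 + o)
    e₁ : ∀ a o → 5 * (11 * a) * (11 + o) ≡ 11 * (11 + o) * (5 * a)
    e₁ = solve-∀
    e₂ : ∀ o → 11 * (11 + o) + (79 + 9 * o) ≡ 20 * (10 + o)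
    e₂ = solve-∀
    e₃ : ∀ a o → 20 * (10 + o) * (5 * a) ≡ 20 * (5 * a * (10 + o))
    e₃ = solve-∀
    e₄ : ∀ b c → 20 * (b * c) ≡ 10 * b * (2 * c)
    e₄ = solve-∀
  base : ∃ (λ o → 8 + o ≡ l) → 5 * 11 ^ (3 + l) * (2 + l) ≤ 10 ^ (3 + l) * 2 ^ (1 + l)
  base (o , refl) = go o

-- The sharper of the two conditions: it fails for `l = 7`. With the base on the right frozen at 32,
-- each step multiplies the left side by at most `5 * (4 / 3) ^ 5 < 32`.
rare-numeric : ∀ l → 8 ≤ l → 4 * (3 + l) ^ 5 * 5 ^ l ≤ (4 * l) ^ l
rare-numeric l 8≤l = ≤-trans (base (m≤n⇒∃[o]m+o≡n 8≤l)) (^-monoˡ-≤ l (*-monoʳ-≤ 4 8≤l))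
  where
  open ≤-Reasoning
  go : ∀ o → let l = 8 + o in 4 * (3 + l) ^ 5 * 5 ^ l ≤ 32 ^ l
  go zero    = ≤ᵇ⇒≤ _ _ _
  go (suc o) = begin
    4 * (12 + o) ^ 5 * (5 * a)        ≡⟨ e₁ ((12 + o) ^ 5) a ⟩
    5 * (12 + o) ^ 5 * (4 * a)        ≤⟨ *-monoˡ-≤ (4 * a) step ⟩
    32 * b * (4 * a)                  ≡⟨ e₃ b a ⟩
    32 * (4 * b * a)                  ≤⟨ *-monoʳ-≤ 32 (go o) ⟩
    32 * 32 ^ (8 + o)                 ∎
    where
    a = 5 ^ (8 + o)
    b = (11 + o) ^ 5
    e₁ : ∀ x a → 4 * x * (5 * a) ≡ 5 * x * (4 * a)
    e₁ = solve-∀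
    e₂ : ∀ o → 3 * (12 + o) + (8 + o) ≡ 4 * (11 + o)
    e₂ = solve-∀
    e₃ : ∀ b a → 32 * b * (4 * a) ≡ 32 * (4 * b * a)
    e₃ = solve-∀
    e₄ : ∀ x → 243 * (5 * x) ≡ 5 * (243 * x)
    e₄ = solve-∀
    e₅ : ∀ b → 5 * (1024 * b) ≡ 5120 * b
    e₅ = solve-∀
    e₆ : ∀ b → 7776 * b ≡ 243 * (32 * b)
    e₆ = solve-∀
    3[12+o]≤4[11+o] : 3 * (12 + o) ≤ 4 * (11 + o)
    3[12+o]≤4[11+o] = ≤-trans (m≤m+n _ (8 + o)) (≤-reflexive (e₂ o))
    step : 5 * (12 + o) ^ 5 ≤ 32 * b
    step = *-cancelˡ-≤ 243 (begin
      243 * (5 * (12 + o) ^ 5)   ≡⟨ e₄ ((12 + o) ^ 5) ⟩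
      5 * (243 * (12 + o) ^ 5)   ≡⟨ cong (5 *_) (sym (^-distribʳ-* 3 (12 + o) 5)) ⟩
      5 * (3 * (12 + o)) ^ 5     ≤⟨ *-monoʳ-≤ 5 (^-monoˡ-≤ 5 {3 * (12 + o)} {4 * (11 + o)} 3[12+o]≤4[11+o]) ⟩
      5 * (4 * (11 + o)) ^ 5     ≡⟨ cong (5 *_) (^-distribʳ-* 4 (11 + o) 5) ⟩
      5 * (1024 * b)             ≡⟨ e₅ b ⟩
      5120 * b                   ≤⟨ *-monoˡ-≤ b (≤ᵇ⇒≤ 5120 7776 _) ⟩
      7776 * b                   ≡⟨ e₆ b ⟩
      243 * (32 * b)             ∎)
  base : ∃ (λ o → 8 + o ≡ l) → 4 * (3 + l) ^ 5 * 5 ^ l ≤ 32 ^ l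
  base (o , refl) = go o

-- Sums and products over lists

∑ ∏ : List A → (A → ℕ) → ℕ
∑ xs f = sum (map f xs)
∏ xs f = product (map f xs)

∑-mono-∈ : ∀ {f g : A → ℕ} xs → (∀ {x} → x ∈ xs → f x ≤ g x) → ∑ xs f ≤ ∑ xs g
∑-mono-∈ []       f≤g = z≤n
∑-mono-∈ (x ∷ xs) f≤g = +-mono-≤ (f≤g (here refl)) (∑-mono-∈ xs (f≤g ∘ there))

∑-mono : ∀ {f g : A → ℕ} xs → (∀ x → f x ≤ g x) → ∑ xs f ≤ ∑ xs g
∑-mono xs f≤g = ∑-mono-∈ xs (λ {x} _ → f≤g x)

∏-mono-∈ : ∀ {f g : A → ℕ} xs → (∀ {x} → x ∈ xs → f x ≤ g x) → ∏ xs f ≤ ∏ xs g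
∏-mono-∈ []       f≤g = ≤-refl
∏-mono-∈ (x ∷ xs) f≤g = *-mono-≤ (f≤g (here refl)) (∏-mono-∈ xs (f≤g ∘ there))

∑-cong : ∀ {f g : A → ℕ} xs → (∀ x → f x ≡ g x) → ∑ xs f ≡ ∑ xs g
∑-cong xs f≗g = cong sum (map-cong f≗g xs)

∏-cong : ∀ {f g : A → ℕ} xs → (∀ x → f x ≡ g x) → ∏ xs f ≡ ∏ xs g
∏-cong xs f≗g = cong product (map-cong f≗g xs)

∑-↭ : ∀ {xs ys} (f : A → ℕ) → xs ↭ ys → ∑ xs f ≡ ∑ ys f
∑-↭ f xs↭ys = sum-↭ (↭-map⁺ f xs↭ys)

∏-↭ : ∀ {xs ys} (f : A → ℕ) → xs ↭ ys → ∏ xs f ≡ ∏ ys f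
∏-↭ f xs↭ys = product-↭ (↭-map⁺ f xs↭ys)

∑-++ : ∀ xs ys (f : A → ℕ) → ∑ (xs ++ ys) f ≡ ∑ xs f + ∑ ys f
∑-++ xs ys f = trans (cong sum (map-++ f xs ys)) (sum-++ (map f xs) (map f ys))

∏-++ : ∀ xs ys (f : A → ℕ) → ∏ (xs ++ ys) f ≡ ∏ xs f * ∏ ys f
∏-++ xs ys f = trans (cong product (map-++ f xs ys)) (product-++ (map f xs) (map f ys))

∑-map : ∀ (g : A → A′) (f : A′ → ℕ) xs → ∑ (map g xs) f ≡ ∑ xs (f ∘ g)
∑-map g f xs = cong sum (sym (map-∘ xs))

∏-map : ∀ (g : A → A′) (f : A′ → ℕ) xs → ∏ (map g xs) f ≡ ∏ xs (f ∘ g)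
∏-map g f xs = cong product (sym (map-∘ xs))

+-interchange : ∀ a b c d → a + b + (c + d) ≡ a + c + (b + d)
+-interchange = solve-∀

*-interchange : ∀ a b c d → a * b * (c * d) ≡ a * c * (b * d)
*-interchange = solve-∀

∑-+ : ∀ (f g : A → ℕ) xs → ∑ xs (λ x → f x + g x) ≡ ∑ xs f + ∑ xs g
∑-+ f g []       = refl
∑-+ f g (x ∷ xs) = trans (cong (f x + g x +_) (∑-+ f g xs)) (+-interchange (f x) (g x) _ _)

∏-* : ∀ (f g : A → ℕ) xs → ∏ xs (λ x → f x * g x) ≡ ∏ xs f * ∏ xs g
∏-* f g []       = refl
∏-* f g (x ∷ xs) = trans (cong (f x * g x *_) (∏-* f g xs)) (*-interchange (f x) (g x) _ _)

∑-*ˡ : ∀ c (f : A → ℕ) xs → ∑ xs (λ x → c * f x) ≡ c * ∑ xs f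
∑-*ˡ c f []       = sym (*-zeroʳ c)
∑-*ˡ c f (x ∷ xs) = trans (cong (c * f x +_) (∑-*ˡ c f xs)) (sym (*-distribˡ-+ c (f x) _))

∑-*ʳ : ∀ c (f : A → ℕ) xs → ∑ xs (λ x → f x * c) ≡ ∑ xs f * c
∑-*ʳ c f []       = refl
∑-*ʳ c f (x ∷ xs) = trans (cong (f x * c +_) (∑-*ʳ c f xs)) (sym (*-distribʳ-+ c (f x) _))

∑-const : ∀ c (xs : List A) → ∑ xs (λ _ → c) ≡ length xs * c
∑-const c []       = refl
∑-const c (x ∷ xs) = cong (c +_) (∑-const c xs)

∏-const : ∀ c (xs : List A) → ∏ xs (λ _ → c) ≡ c ^ length xs
∏-const c []       = refl
∏-const c (x ∷ xs) = cong (c *_) (∏-const c xs)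

∏-^ : ∀ (f : A → ℕ) m xs → ∏ xs (λ x → f x ^ m) ≡ ∏ xs f ^ m
∏-^ f m []       = sym (^-zeroˡ m)
∏-^ f m (x ∷ xs) = trans (cong (f x ^ m *_) (∏-^ f m xs)) (sym (^-distribʳ-* (f x) _ m))

∑-swap : ∀ (f : A → A′ → ℕ) xs ys → ∑ xs (λ x → ∑ ys (f x)) ≡ ∑ ys (λ y → ∑ xs (λ x → f x y))
∑-swap f []       ys = sym (trans (∑-const 0 ys) (*-zeroʳ (length ys)))
∑-swap f (x ∷ xs) ys = trans (cong (∑ ys (f x) +_) (∑-swap f xs ys)) (sym (∑-+ (f x) _ ys))

term≤∑ : ∀ {xs x} (f : A → ℕ) → x ∈ xs → f x ≤ ∑ xs f
term≤∑ f (here refl) = m≤m+n _ _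
term≤∑ f (there x∈)  = ≤-trans (term≤∑ f x∈) (m≤n+m _ _)

∑-superadditive : ∀ g → Superadditive g → g 0 ≡ 0 → ∀ (f : A → ℕ) xs → ∑ xs (g ∘ f) ≤ g (∑ xs f)
∑-superadditive g sg g0 f []       = z≤n
∑-superadditive g sg g0 f (x ∷ xs) = ≤-trans (+-monoʳ-≤ (g (f x)) (∑-superadditive g sg g0 f xs)) (sg (f x) _)

-- allFin (3 + l) would unfold to three explicit elements inside every sum.
abstract
  fins : ∀ n → List (Fin n)
  fins n = allFin n

  ∈-fins : ∀ {n} (i : Fin n) → i ∈ fins n
  ∈-fins = ∈-allFin

  fins-unique : ∀ n → Unique (fins n)
  fins-unique = Unique.allFin⁺

  length-fins : ∀ n → length (fins n) ≡ n
  length-fins n = length-tabulate id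

  ∏-fins-zero : ∀ (f : Fin 0 → ℕ) → ∏ (fins 0) f ≡ 1
  ∏-fins-zero f = refl

  ∑-fins-suc : ∀ n (f : Fin (suc n) → ℕ) → ∑ (fins (suc n)) f ≡ f zero + ∑ (fins n) (f ∘ suc)
  ∑-fins-suc n f = cong (λ z → f zero + sum z) (trans (map-tabulate suc f) (sym (map-tabulate id (f ∘ suc))))

  ∏-fins-suc : ∀ n (f : Fin (suc n) → ℕ) → ∏ (fins (suc n)) f ≡ f zero * ∏ (fins n) (f ∘ suc)
  ∏-fins-suc n f = cong (λ z → f zero * product z) (trans (map-tabulate suc f) (sym (map-tabulate id (f ∘ suc))))

am-gm : ∀ (f : A → ℕ) xs → ∏ xs f * length xs ^ length xs ≤ ∑ xs f ^ length xs
am-gm f []       = ≤-refl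
am-gm f (x ∷ xs) = *-cancelʳ-≤ _ _ (m ^ m) {{m^m≢0 m}} (begin
  f x * Π * suc m ^ suc m * m ^ m      ≡⟨ eq (f x) Π (suc m ^ suc m) (m ^ m) ⟩
  f x * suc m ^ suc m * (Π * m ^ m)    ≤⟨ *-monoʳ-≤ (f x * suc m ^ suc m) (am-gm f xs) ⟩
  f x * suc m ^ suc m * S ^ m          ≡⟨ eq′ (f x) (suc m ^ suc m) (S ^ m) ⟩
  f x * S ^ m * suc m ^ suc m          ≤⟨ am-gm-step (f x) S m ⟩
  (f x + S) ^ suc m * m ^ m            ∎)
  where
  open ≤-Reasoning
  m = length xs
  Π = ∏ xs f
  S = ∑ xs f
  m^m≢0 : ∀ m → NonZero (m ^ m)
  m^m≢0 zero    = _
  m^m≢0 (suc m) = m^n≢0 (suc m) (suc m)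
  eq : ∀ a b c d → a * b * c * d ≡ a * c * (b * d)
  eq = solve-∀
  eq′ : ∀ a b c → a * b * c ≡ a * c * b
  eq′ = solve-∀

-- Indicators and finite counting

⟦_⟧ : Dec P → ℕ
⟦ P? ⟧ = if does P? then 1 else 0

⟦⟧≡1 : (P? : Dec P) → P → ⟦ P? ⟧ ≡ 1
⟦⟧≡1 (yes _) p = refl
⟦⟧≡1 (no ¬p) p = ⊥-elim (¬p p)

⟦⟧≤ : ∀ {n} (P? : Dec P) → (P → 1 ≤ n) → ⟦ P? ⟧ ≤ n
⟦⟧≤ (yes p) 1≤n = 1≤n p
⟦⟧≤ (no _)  1≤n = z≤n

⟦⟧*≤ : ∀ {a b} (P? : Dec P) → (P → a ≤ b) → ⟦ P? ⟧ * a ≤ ⟦ P? ⟧ * b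
⟦⟧*≤ (yes p) a≤b = *-monoʳ-≤ 1 (a≤b p)
⟦⟧*≤ (no _)  a≤b = z≤n

⟦⟧-mono : (P? : Dec P) (Q? : Dec Q) → (P → Q) → ⟦ P? ⟧ ≤ ⟦ Q? ⟧
⟦⟧-mono P? Q? P→Q = ⟦⟧≤ P? (λ p → ≤-reflexive (sym (⟦⟧≡1 Q? (P→Q p))))

⟦⟧≤1 : (P? : Dec P) → ⟦ P? ⟧ ≤ 1
⟦⟧≤1 P? = ⟦⟧≤ P? (λ _ → ≤-refl)

-- At most one term is 1. Applied to the colours of one edge, it shows that the colour classes at a
-- vertex are disjoint.
∑-exclusive : ∀ {R : A → Set} (R? : ∀ x → Dec (R x)) (Q? : Dec Q) {xs} →
              AllPairs (λ x y → R x → ¬ R y) xs → (∀ x → R x → Q) → ∑ xs (λ x → ⟦ R? x ⟧) ≤ ⟦ Q? ⟧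
∑-exclusive R? Q? []       R→Q = z≤n
∑-exclusive R? Q? {x ∷ xs} (x# ∷ xs#) R→Q with R? x
... | no  _  = ∑-exclusive R? Q? xs# R→Q
... | yes rx = ≤-trans (s≤s (none x#)) (≤-reflexive (sym (⟦⟧≡1 Q? (R→Q x rx))))
  where
  none : ∀ {ys} → All (λ y → _ → ¬ _) ys → ∑ ys (λ y → ⟦ R? y ⟧) ≤ 0
  none []       = z≤n
  none (¬ry ∷ ¬rys) = +-mono-≤ (⟦⟧≤ (R? _) (λ ry → contradiction ry (¬ry rx))) (none ¬rys)

∑-δ : ∀ {n} (x : Fin n) (f : Fin n → ℕ) → ∑ (fins n) (λ v → ⟦ x Fin.≟ v ⟧ * f v) ≡ f x
∑-δ {suc n} zero    f = begin
  ∑ (fins (suc n)) (λ v → ⟦ zero Fin.≟ v ⟧ * f v)   ≡⟨ ∑-fins-suc n (λ v → ⟦ zero Fin.≟ v ⟧ * f v) ⟩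
  1 * f zero + ∑ (fins n) (λ _ → 0)                 ≡⟨ cong₂ _+_ (*-identityˡ (f zero)) (∑-const 0 (fins n)) ⟩
  f zero + length (fins n) * 0                      ≡⟨ cong (f zero +_) (*-zeroʳ (length (fins n))) ⟩
  f zero + 0                                          ≡⟨ +-identityʳ (f zero) ⟩
  f zero                                              ∎
  where open ≡-Reasoning
∑-δ {suc n} (suc x) f = trans (∑-fins-suc n (λ v → ⟦ suc x Fin.≟ v ⟧ * f v)) (∑-δ x (f ∘ suc))

abstract
  extract : ∀ {x : A} {xs} → x ∈ xs → ∃ λ ys → xs ↭ x ∷ ys
  extract x∈xs with ∈-∃++ x∈xs
  ... | ys , zs , refl = ys ++ zs , shift _ ys zs

extend-to : ∀ {cs xs : List A} → Unique cs → (∀ {x} → x ∈ cs → x ∈ xs) → ∃ λ ys → xs ↭ cs ++ ys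
extend-to {cs = []}     _            _     = _ , ↭-refl
extend-to {cs = c ∷ cs} (c∉cs ∷ uniq) cs⊆xs with extract (cs⊆xs (here refl))
... | xs′ , xs↭ with extend-to uniq cs⊆xs′
  where
  cs⊆xs′ : ∀ {x} → x ∈ cs → x ∈ xs′
  cs⊆xs′ x∈cs with ∈-resp-↭ xs↭ (cs⊆xs (there x∈cs))
  ... | here refl = contradiction refl (All.lookup c∉cs x∈cs)
  ... | there x∈  = x∈
...   | ys , xs′↭ = ys , ↭-trans xs↭ (prep c xs′↭)

Unique-⊆⇒length≤ : ∀ {xs ys : List A} → Unique xs → (∀ {x} → x ∈ xs → x ∈ ys) → length xs ≤ length ys
Unique-⊆⇒length≤ {xs = xs} uniq xs⊆ys with extend-to uniq xs⊆ys
... | zs , ys↭ = ≤-trans (m≤m+n _ _) (≤-reflexive (sym (trans (↭-length ys↭) (length-++ xs))))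

-- Boxes of words and the distributive law

boxes : ∀ {m} → (Fin m → List A) → List (Vec A m)
boxes {m = zero}  L = [] ∷ []
boxes {m = suc m} L = cartesianProductWith _∷_ (L zero) (boxes (L ∘ suc))

∈-boxes⁺ : ∀ {m} (L : Fin m → List A) φ → (∀ i → lookup φ i ∈ L i) → φ ∈ boxes L
∈-boxes⁺ L []      φ∈L = here refl
∈-boxes⁺ L (x ∷ φ) φ∈L = ∈-cartesianProductWith⁺ _∷_ (φ∈L zero) (∈-boxes⁺ (L ∘ suc) φ (φ∈L ∘ suc))

∈-boxes⁻ : ∀ {m} (L : Fin m → List A) {φ} → φ ∈ boxes L → ∀ i → lookup φ i ∈ L i
∈-boxes⁻ {m = suc m} L φ∈ i with ∈-cartesianProductWith⁻ _∷_ (L zero) (boxes (L ∘ suc)) φ∈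
∈-boxes⁻ {m = suc m} L φ∈ zero    | _ , _ , x∈ , φ∈′ , refl = x∈
∈-boxes⁻ {m = suc m} L φ∈ (suc i) | _ , _ , x∈ , φ∈′ , refl = ∈-boxes⁻ (L ∘ suc) φ∈′ i

boxes-unique : ∀ {m} (L : Fin m → List A) → (∀ i → Unique (L i)) → Unique (boxes L)
boxes-unique {m = zero}  L uniq = [] ∷ []
boxes-unique {m = suc m} L uniq =
  Unique.cartesianProductWith⁺ _∷_ Vec.∷-injective (uniq zero) (boxes-unique (L ∘ suc) (uniq ∘ suc))

∑-cartesianProductWith : ∀ {X : Set} (_⊙_ : A → A′ → X) (F : X → ℕ) xs ys →
  ∑ (cartesianProductWith _⊙_ xs ys) F ≡ ∑ xs (λ x → ∑ ys (λ y → F (x ⊙ y)))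
∑-cartesianProductWith _⊙_ F []       ys = refl
∑-cartesianProductWith _⊙_ F (x ∷ xs) ys =
  trans (∑-++ (map (x ⊙_) ys) _ F) (cong₂ _+_ (∑-map (x ⊙_) F ys) (∑-cartesianProductWith _⊙_ F xs ys))

∏-cartesianProductWith : ∀ {X : Set} (_⊙_ : A → A′ → X) (F : X → ℕ) xs ys →
  ∏ (cartesianProductWith _⊙_ xs ys) F ≡ ∏ xs (λ x → ∏ ys (λ y → F (x ⊙ y)))
∏-cartesianProductWith _⊙_ F []       ys = refl
∏-cartesianProductWith _⊙_ F (x ∷ xs) ys =
  trans (∏-++ (map (x ⊙_) ys) _ F) (cong₂ _*_ (∏-map (x ⊙_) F ys) (∏-cartesianProductWith _⊙_ F xs ys))

∑-boxes : ∀ {m} (L : Fin m → List A) (g : Fin m → A → ℕ) →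
  ∑ (boxes L) (λ φ → ∏ (fins m) (λ j → g j (lookup φ j))) ≡ ∏ (fins m) (λ j → ∑ (L j) (g j))
∑-boxes {m = zero}  L g = trans (+-identityʳ _) (trans (∏-fins-zero _) (sym (∏-fins-zero _)))
∑-boxes {m = suc m} L g = begin
  ∑ (boxes L) (λ φ → ∏ (fins (suc m)) (λ j → g j (lookup φ j)))
    ≡⟨ ∑-cartesianProductWith _∷_ _ (L zero) (boxes (L ∘ suc)) ⟩
  ∑ (L zero) (λ x → ∑ (boxes (L ∘ suc)) (λ φ → ∏ (fins (suc m)) (λ j → g j (lookup (x ∷ φ) j))))
    ≡⟨ ∑-cong (L zero) (λ x → trans (∑-cong (boxes (L ∘ suc)) (λ φ → ∏-fins-suc m (λ j → g j (lookup (x ∷ φ) j)))) (∑-*ˡ (g zero x) _ (boxes (L ∘ suc)))) ⟩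
  ∑ (L zero) (λ x → g zero x * ∑ (boxes (L ∘ suc)) (λ φ → ∏ (fins m) (λ j → g (suc j) (lookup φ j))))
    ≡⟨ ∑-*ʳ _ (g zero) (L zero) ⟩
  ∑ (L zero) (g zero) * ∑ (boxes (L ∘ suc)) (λ φ → ∏ (fins m) (λ j → g (suc j) (lookup φ j)))
    ≡⟨ cong (∑ (L zero) (g zero) *_) (∑-boxes (L ∘ suc) (g ∘ suc)) ⟩
  ∑ (L zero) (g zero) * ∏ (fins m) (λ j → ∑ (L (suc j)) (g (suc j)))
    ≡⟨ sym (∏-fins-suc m (λ j → ∑ (L j) (g j))) ⟩
  ∏ (fins (suc m)) (λ j → ∑ (L j) (g j)) ∎
  where open ≡-Reasoning

length≡∑1 : (xs : List A) → length xs ≡ ∑ xs (λ _ → 1)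
length≡∑1 xs = sym (trans (∑-const 1 xs) (*-identityʳ _))

length-boxes : ∀ {m} (L : Fin m → List A) → length (boxes L) ≡ ∏ (fins m) (length ∘ L)
length-boxes {m = m} L = begin
  length (boxes L)                                     ≡⟨ length≡∑1 (boxes L) ⟩
  ∑ (boxes L) (λ _ → 1)                                ≡⟨ ∑-cong (boxes L) (λ _ → sym (trans (∏-const 1 (fins m)) (^-zeroˡ (length (fins m))))) ⟩
  ∑ (boxes L) (λ _ → ∏ (fins m) (λ _ → 1))           ≡⟨ ∑-boxes L (λ _ _ → 1) ⟩
  ∏ (fins m) (λ j → ∑ (L j) (λ _ → 1))               ≡⟨ ∏-cong (fins m) (λ j → sym (length≡∑1 (L j))) ⟩
  ∏ (fins m) (length ∘ L)                            ∎
  where open ≡-Reasoning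

words : List A → ∀ m → List (Vec A m)
words xs m = boxes {m = m} (λ _ → xs)

-- Each letter occurs `m * k ^ (m - 1)` times in all words of length `m` together. Raising to the
-- power `k` avoids the exponent `m - 1`.
∏-words : ∀ (x : A → ℕ) xs m → let k = length xs in
  ∏ (words xs m) (λ w → ∏ (fins m) (λ j → x (lookup w j))) ^ k ≡ ∏ xs x ^ (m * k ^ m)
∏-words x xs zero    = trans (cong (_^ length xs) (trans (*-identityʳ _) (∏-fins-zero _))) (^-zeroˡ (length xs))
∏-words x xs (suc m) = begin
  ∏ (words xs (suc m)) (mon (suc m)) ^ k
    ≡⟨ cong (_^ k) (trans (∏-cartesianProductWith _∷_ (mon (suc m)) xs (words xs m)) (∏-cong xs inner)) ⟩
  ∏ xs (λ y → x y ^ k ^ m * q) ^ k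
    ≡⟨ cong (_^ k) (trans (∏-* (λ y → x y ^ k ^ m) (λ _ → q) xs) (cong₂ _*_ (∏-^ x (k ^ m) xs) (∏-const q xs))) ⟩
  (Π ^ k ^ m * q ^ k) ^ k
    ≡⟨ cong (λ z → (Π ^ k ^ m * z) ^ k) (∏-words x xs m) ⟩
  (Π ^ k ^ m * Π ^ (m * k ^ m)) ^ k
    ≡⟨ cong (_^ k) (sym (^-distribˡ-+-* Π (k ^ m) (m * k ^ m))) ⟩
  (Π ^ (suc m * k ^ m)) ^ k
    ≡⟨ ^-*-assoc Π (suc m * k ^ m) k ⟩
  Π ^ (suc m * k ^ m * k)
    ≡⟨ cong (Π ^_) (trans (*-assoc (suc m) (k ^ m) k) (cong (suc m *_) (*-comm (k ^ m) k))) ⟩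
  Π ^ (suc m * k ^ suc m) ∎
  where
  open ≡-Reasoning
  k = length xs
  Π = ∏ xs x
  mon : ∀ m → Vec _ m → ℕ
  mon m w = ∏ (fins m) (λ j → x (lookup w j))
  q = ∏ (words xs m) (mon m)
  length-words : length (words xs m) ≡ k ^ m
  length-words = trans (length-boxes {m = m} (λ _ → xs)) (trans (∏-const k (fins m)) (cong (k ^_) (length-fins m)))
  inner : ∀ y → ∏ (words xs m) (λ w → mon (suc m) (y ∷ w)) ≡ x y ^ k ^ m * q
  inner y = trans (∏-cong (words xs m) (λ w → ∏-fins-suc m (λ j → x (lookup (y ∷ w) j))))
    (trans (∏-* (λ _ → x y) (mon m) (words xs m))
      (cong (_* q) (trans (∏-const (x y) (words xs m)) (cong (x y ^_) length-words))))

-- (Σ x)^k expands into k^k words; each letter occurs equally often among the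
-- k^k - k non-constant ones, so AM-GM bounds their sum from below.
mixed-words : ∀ k′ (x : Fin (suc k′) → ℕ) → let k = suc k′ ; ks = fins k in
  (k ^ k ∸ k) * ∏ ks x + ∑ ks (λ i → x i ^ k) ≤ ∑ ks x ^ k
mixed-words k′ x = begin
  K * Π + ∑ ks (λ i → x i ^ k)          ≤⟨ +-monoˡ-≤ _ KΠ≤ ⟩
  ∑ ys mon + ∑ ks (λ i → x i ^ k)       ≡⟨ +-comm (∑ ys mon) _ ⟩
  ∑ ks (λ i → x i ^ k) + ∑ ys mon       ≡⟨ cong (_+ ∑ ys mon) (trans (∑-cong ks (sym ∘ mon-const)) (sym (∑-map (replicate k) mon ks))) ⟩
  ∑ cs mon + ∑ ys mon                   ≡⟨ sym (∑-++ cs ys mon) ⟩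
  ∑ (cs ++ ys) mon                      ≡⟨ sym (∑-↭ mon ws↭) ⟩
  ∑ ws mon                              ≡⟨ ∑-boxes {m = k} (λ _ → ks) (λ _ → x) ⟩
  ∏ ks (λ _ → ∑ ks x)                   ≡⟨ trans (∏-const (∑ ks x) ks) (cong (∑ ks x ^_) (length-fins k)) ⟩
  ∑ ks x ^ k                            ∎
  where
  open ≤-Reasoning
  k  = suc k′
  ks = fins k
  K  = k ^ k ∸ k
  Π  = ∏ ks x
  ws = words ks k
  cs = map (replicate k) ks
  mon : Vec (Fin k) k → ℕ
  mon w = ∏ ks (λ j → x (lookup w j))
  mon-const : ∀ i → mon (replicate k i) ≡ x i ^ k
  mon-const i = trans (∏-cong ks (λ j → cong x (Vec.lookup-replicate j i)))
                      (trans (∏-const (x i) ks) (cong (x i ^_) (length-fins k)))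
  complement : ∃ λ ys → ws ↭ cs ++ ys
  complement = extend-to (Unique.map⁺ (λ {a} {b} e → proj₁ (Vec.∷-injective e)) (fins-unique k))
                         (λ {w} _ → ∈-boxes⁺ {m = k} (λ _ → ks) w (λ i → ∈-fins (lookup w i)))
  ys  = proj₁ complement
  ws↭ = proj₂ complement
  length-ys : length ys ≡ K
  length-ys = sym (trans (cong (_∸ k) (trans (sym total) (trans (↭-length ws↭) (trans (length-++ cs)
                (cong (_+ length ys) (trans (length-map _ ks) (length-fins k))))))) (m+n∸m≡n k _))
    where
    total : length ws ≡ k ^ k
    total = trans (length-boxes {m = k} (λ _ → ks)) (trans (∏-const (length ks) ks) (cong₂ _^_ (length-fins k) (length-fins k)))
  k≤k^k : k ≤ k ^ k
  k≤k^k = ≤-trans (≤-reflexive (sym (*-identityʳ k))) (*-monoʳ-≤ k (m^n>0 k k′))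
  Π^≤ : Π ^ (k ^ k) ≤ ∏ ws mon
  Π^≤ = ^-cancelˡ-≤ k (≤-reflexive (trans (^-*-assoc Π (k ^ k) k)
          (trans (cong (Π ^_) (*-comm (k ^ k) k)) (sym words-power))))
    where
    words-power : ∏ ws mon ^ k ≡ Π ^ (k * k ^ k)
    words-power = subst (λ z → ∏ ws mon ^ z ≡ Π ^ (k * z ^ k)) (length-fins k) (∏-words x ks k)
  ∏-cs : ∏ cs mon ≡ Π ^ k
  ∏-cs = trans (∏-map (replicate k) mon ks) (trans (∏-cong ks mon-const) (∏-^ x k ks))
  -- AM-GM over the `K` non-constant monomials. Cancelling needs `K` and `Π` to be non-zero; `KΠ≤`
  -- adds the degenerate cases.
  KΠ≤′ : .{{NonZero Π}} → .{{NonZero K}} → K * Π ≤ ∑ ys mon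
  KΠ≤′ = ^-cancelˡ-≤ K (begin
    (K * Π) ^ K             ≡⟨ trans (cong (_^ K) (*-comm K Π)) (^-distribʳ-* Π K K) ⟩
    Π ^ K * K ^ K           ≤⟨ *-monoˡ-≤ (K ^ K) Π^K≤ ⟩
    ∏ ys mon * K ^ K        ≡⟨ cong (λ z → ∏ ys mon * z ^ z) (sym length-ys) ⟩
    ∏ ys mon * length ys ^ length ys ≤⟨ am-gm mon ys ⟩
    ∑ ys mon ^ length ys    ≡⟨ cong (∑ ys mon ^_) length-ys ⟩
    ∑ ys mon ^ K            ∎)
    where
    -- The constant words contribute exactly `Π ^ k` to the product over all words, which is
    -- cancelled here.
    Π^K≤ : Π ^ K ≤ ∏ ys mon
    Π^K≤ = *-cancelˡ-≤ (Π ^ k) {{m^n≢0 Π k}} (begin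
      Π ^ k * Π ^ K          ≡⟨ sym (^-distribˡ-+-* Π k K) ⟩
      Π ^ (k + K)            ≡⟨ cong (Π ^_) (m+[n∸m]≡n k≤k^k) ⟩
      Π ^ (k ^ k)            ≤⟨ Π^≤ ⟩
      ∏ ws mon               ≡⟨ ∏-↭ mon ws↭ ⟩
      ∏ (cs ++ ys) mon       ≡⟨ ∏-++ cs ys mon ⟩
      ∏ cs mon * ∏ ys mon    ≡⟨ cong (_* ∏ ys mon) ∏-cs ⟩
      Π ^ k * ∏ ys mon       ∎)
  KΠ≤ : K * Π ≤ ∑ ys mon
  KΠ≤ with Π ≟ 0 | K ≟ 0
  ... | yes Π≡0 | _       = ≤-trans (≤-reflexive (trans (cong (K *_) Π≡0) (*-zeroʳ K))) z≤n
  ... | no _    | yes K≡0 = ≤-trans (≤-reflexive (cong (_* Π) K≡0)) z≤n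
  ... | no Π≢0  | no K≢0  = KΠ≤′ {{≢-nonZero Π≢0}} {{≢-nonZero K≢0}}

⟦×⟧ : ∀ {P Q : Set} (P? : Dec P) (Q? : Dec Q) → ⟦ P? ×-dec Q? ⟧ ≡ ⟦ P? ⟧ * ⟦ Q? ⟧
⟦×⟧ (yes _) (yes _) = refl
⟦×⟧ (yes _) (no _)  = refl
⟦×⟧ (no _)  Q?      = refl

-- The upper bound

-- The square of the smaller product is at most the product of both, where `D` occurs twice and
-- every other class once. AM-GM is therefore applied to `D`, `D`, all `2 * f y` and all `2 * g y`:
-- these are `2 * m` numbers with sum at most `2 * n`. The doubled entries produce the gain
-- `2 ^ length ys`.
two-stars-am-gm : ∀ {A : Set} ys (f g : A → ℕ) D n → let m = suc (length ys) in
  D + ∑ ys f + ∑ ys g ≤ n → D * ∏ ys g ≤ D * ∏ ys f → D * ∏ ys g * (2 ^ length ys * m ^ m) ≤ n ^ m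
two-stars-am-gm ys f g D n D+f+g≤n pg≤pf = *-cancelˡ-≤ (2 ^ m) {{m^n≢0 2 m}} (begin
  2 ^ m * (pg * (2 ^ r * m ^ m))   ≡⟨ eq₁ (2 ^ m) pg (2 ^ r) (m ^ m) ⟩
  2 ^ r * pg * (2 ^ m * m ^ m)     ≡⟨ cong (2 ^ r * pg *_) (sym (^-distribʳ-* 2 m m)) ⟩
  2 ^ r * pg * (2 * m) ^ m         ≤⟨ root ⟩
  (2 * n) ^ m                      ≡⟨ ^-distribʳ-* 2 n m ⟩
  2 ^ m * n ^ m                    ∎)
  where
  open ≤-Reasoning
  r = length ys
  m = suc r
  pf = D * ∏ ys f
  pg = D * ∏ ys g
  xs = D ∷ D ∷ (map (λ y → 2 * f y) ys ++ map (λ y → 2 * g y) ys)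
  eq₁ : ∀ a b c d → a * (b * (c * d)) ≡ c * b * (a * d)
  eq₁ = solve-∀
  length-xs : length xs ≡ m * 2
  length-xs = trans (cong (2 +_) (trans (length-++ (map (λ y → 2 * f y) ys))
                (cong₂ _+_ (length-map _ ys) (length-map _ ys)))) (e r)
    where
    e : ∀ r → 2 + (r + r) ≡ suc r * 2
    e = solve-∀
  double-∏ : ∀ (h : _ → ℕ) → ∏ (map (λ y → 2 * h y) ys) id ≡ 2 ^ r * ∏ ys h
  double-∏ h = trans (∏-map _ id ys) (trans (∏-* (λ _ → 2) h ys) (cong (_* ∏ ys h) (∏-const 2 ys)))
  double-∑ : ∀ (h : _ → ℕ) → ∑ (map (λ y → 2 * h y) ys) id ≡ 2 * ∑ ys h
  double-∑ h = trans (∑-map _ id ys) (∑-*ˡ 2 h ys)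
  ∏-xs : ∏ xs id ≡ (2 ^ r * pf) * (2 ^ r * pg)
  ∏-xs = trans (cong (λ z → D * (D * z)) (trans (∏-++ (map (λ y → 2 * f y) ys) _ id) (cong₂ _*_ (double-∏ f) (double-∏ g))))
               (e D (2 ^ r) (∏ ys f) (∏ ys g))
    where
    e : ∀ D t a b → D * (D * (t * a * (t * b))) ≡ t * (D * a) * (t * (D * b))
    e = solve-∀
  ∑-xs : ∑ xs id ≤ 2 * n
  ∑-xs = begin
    ∑ xs id                             ≡⟨ cong (λ z → D + (D + z)) (trans (∑-++ (map (λ y → 2 * f y) ys) _ id) (cong₂ _+_ (double-∑ f) (double-∑ g))) ⟩
    D + (D + (2 * ∑ ys f + 2 * ∑ ys g)) ≡⟨ e D (∑ ys f) (∑ ys g) ⟩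
    2 * (D + ∑ ys f + ∑ ys g)           ≤⟨ *-monoʳ-≤ 2 D+f+g≤n ⟩
    2 * n                               ∎
    where
    e : ∀ D a b → D + (D + (2 * a + 2 * b)) ≡ 2 * (D + a + b)
    e = solve-∀
  root : 2 ^ r * pg * (2 * m) ^ m ≤ (2 * n) ^ m
  root = ^-cancelˡ-≤ 2 (begin
    (2 ^ r * pg * (2 * m) ^ m) ^ 2                     ≡⟨ e (2 ^ r * pg) ((2 * m) ^ m) ⟩
    (2 ^ r * pg) * (2 ^ r * pg) * ((2 * m) ^ m) ^ 2    ≤⟨ *-monoˡ-≤ (((2 * m) ^ m) ^ 2) (*-monoˡ-≤ (2 ^ r * pg) (*-monoʳ-≤ (2 ^ r) pg≤pf)) ⟩
    (2 ^ r * pf) * (2 ^ r * pg) * ((2 * m) ^ m) ^ 2    ≡⟨ cong₂ _*_ (sym ∏-xs) (trans (^-*-assoc (2 * m) m 2) (cong₂ _^_ (trans (*-comm 2 m) (sym length-xs)) (sym length-xs))) ⟩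
    ∏ xs id * length xs ^ length xs                    ≤⟨ am-gm id xs ⟩
    ∑ xs id ^ length xs                                ≡⟨ cong (∑ xs id ^_) length-xs ⟩
    ∑ xs id ^ (m * 2)                                  ≤⟨ ^-monoˡ-≤ (m * 2) ∑-xs ⟩
    (2 * n) ^ (m * 2)                                  ≡⟨ sym (^-*-assoc (2 * n) m 2) ⟩
    ((2 * n) ^ m) ^ 2                                  ∎)
    where
    e : ∀ a b → (a * b) * ((a * b) * 1) ≡ a * a * (b * (b * 1))
    e = solve-∀

Unique-resp-↭ : ∀ {A : Set} {xs ys : List A} → xs ↭ ys → Unique xs → Unique ys
Unique-resp-↭ {A} xs↭ys = Permutationₛ.Unique-resp-↭ (setoid A) (↭⇒↭ₛ xs↭ys)

head≢ : ∀ {A : Set} {x y : A} {ys} → Unique (x ∷ ys) → y ∈ ys → x ≢ y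
head≢ (x∉ys ∷ _) = All.lookup x∉ys

abstract
  maximiser : ∀ {n} (f : Fin (suc n) → ℕ) → ∃ λ a → ∀ i → f i ≤ f a
  maximiser f = argmax f zero (fins _) , λ i → All.lookup (f[xs]≤f[argmax] {f = f} zero (fins _)) (∈-fins i)

-- E v w i j: the edge vw has the colour of the edge ij of the rainbow clique.
module UpperBound (l : ℕ) (8≤l : 8 ≤ l) (N : ℕ)
  (E : Fin N → Fin N → Fin (3 + l) → Fin (3 + l) → Set)
  (E? : ∀ v w i j → Dec (E v w i j))
  (E-swap : ∀ {v w i j} → E v w i j → E v w j i)
  (E-unique : ∀ {v w i j i′ j′} → E v w i j → E v w i′ j′ → (i ≡ i′ × j ≡ j′) ⊎ (i ≡ j′ × j ≡ i′))
  where

  m k K : ℕ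
  m = 2 + l
  k = suc m
  K = k ^ k ∸ k

  ks = fins k
  vs = fins N

  card : {U : Fin N → Set} → (∀ v → Dec (U v)) → ℕ
  card U? = ∑ vs (λ v → ⟦ U? v ⟧)

  card-mono : ∀ {U U′ : Fin N → Set} (U? : ∀ v → Dec (U v)) (U′? : ∀ v → Dec (U′ v)) →
              (∀ v → U v → U′ v) → card U? ≤ card U′?
  card-mono U? U′? U⊆U′ = ∑-mono vs (λ v → ⟦⟧-mono (U? v) (U′? v) (U⊆U′ v))

  card-singleton : ∀ v → card (v Fin.≟_) ≡ 1
  card-singleton v = trans (∑-cong vs (λ w → sym (*-identityʳ ⟦ v Fin.≟ w ⟧))) (∑-δ v (λ _ → 1))

  #_ : {Q : Vec (Fin N) k → Set} → (∀ φ → Dec (Q φ)) → ℕ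
  # Q? = ∑ (words vs k) (λ φ → ⟦ Q? φ ⟧)

  -- For copies through a fixed vertex `v` the box keeps only the colours seen from `v`; giving up
  -- the other edges makes the bound a product.
  box-bound : ∀ {Q : Vec (Fin N) k → Set} (Q? : ∀ φ → Dec (Q φ)) {B : Fin k → Fin N → Set} (B? : ∀ j v → Dec (B j v)) →
              (∀ φ → Q φ → ∀ j → B j (lookup φ j)) → # Q? ≤ ∏ ks (λ j → card (B? j))
  box-bound Q? B? Q⇒B = ≤-trans
    (∑-mono (words vs k) (λ φ → ⟦⟧≤ (Q? φ) (λ q → ≤-reflexive (sym (all-one φ q)))))
    (≤-reflexive (∑-boxes {m = k} (λ _ → vs) (λ j v → ⟦ B? j v ⟧)))
    where
    all-one : ∀ φ → _ → ∏ ks (λ j → ⟦ B? j (lookup φ j) ⟧) ≡ 1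
    all-one φ q = trans (∏-cong ks (λ j → ⟦⟧≡1 (B? j (lookup φ j)) (Q⇒B φ q j)))
                        (trans (∏-const 1 ks) (^-zeroˡ (length ks)))

  Hom : Vec (Fin N) k → Set
  Hom φ = ∀ i j → i ≢ j → E (lookup φ i) (lookup φ j) i j

  hom? : ∀ φ → Dec (Hom φ)
  hom? φ = Fin.all? λ i → Fin.all? λ j → ¬? (i Fin.≟ j) →-dec E? (lookup φ i) (lookup φ j) i j

  Copy : (Fin N → Set) → Vec (Fin N) k → Set
  Copy U φ = (∀ i → U (lookup φ i)) × Hom φ

  copy? : ∀ {U} → (∀ v → Dec (U v)) → ∀ φ → Dec (Copy U φ)
  copy? U? φ = Fin.all? (λ i → U? (lookup φ i)) ×-dec hom? φ

  others : Fin k → List (Fin k)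
  others i = proj₁ (extract (∈-fins i))

  ks↭ : ∀ i → ks ↭ i ∷ others i
  ks↭ i = proj₂ (extract (∈-fins i))

  unique-from : ∀ {xs} → ks ↭ xs → Unique xs
  unique-from ks↭xs = Unique-resp-↭ ks↭xs (fins-unique k)

  length-others : ∀ i → length (others i) ≡ m
  length-others i = suc-injective (trans (sym (↭-length (ks↭ i))) (length-fins k))

  others∌ : ∀ i {j} → j ∈ others i → i ≢ j
  others∌ i = head≢ (unique-from (ks↭ i))

  ∈-others : ∀ {i j} → i ≢ j → j ∈ others i
  ∈-others {i} {j} i≢j with ∈-resp-↭ (ks↭ i) (∈-fins j)
  ... | here j≡i = contradiction (sym j≡i) i≢j
  ... | there j∈ = j∈

  pair-split : ∀ {a i} → a ≢ i → ∃ λ ys → others a ↭ i ∷ ys × others i ↭ a ∷ ys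
  pair-split {a} {i} a≢i with extract (∈-others a≢i)
  ... | ys , a↭ = ys , a↭ , drop-∷ (↭-trans (↭-sym (ks↭ i)) (↭-trans (ks↭ a) (↭-trans (prep a a↭) (swap a i ↭-refl))))

  third-role : ∀ {a c : Fin k} → a ≢ c → ∃ λ q → q ≢ a × q ≢ c
  third-role {a} {c} a≢c with pair-split a≢c
  ... | [] , a↭ , _ = contradiction (trans (sym (length-others a)) (↭-length a↭)) λ ()
  ... | q ∷ ys , a↭ , c↭ = q , ≢-sym (others∌ a (∈-resp-↭ (↭-sym a↭) (there (here refl))))
                             , ≢-sym (others∌ c (∈-resp-↭ (↭-sym c↭) (there (here refl))))

  -- Applied to the parts f i of the vertices of a copy.  In the last case the edge iq
  -- joins two different parts and has a wrong colour, and f i ∉ {i , q}.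
  classify : ∀ (f : Fin k → Fin k) → (∀ i → f i ≡ i) ⊎ (∃ λ a → ∀ i → f i ≡ a) ⊎
             (∃₂ λ i q → f i ≢ i × q ≢ i × q ≢ f i × f q ≢ f i)
  classify f with Fin.any? (λ i → Fin.any? λ q → ¬? (f i Fin.≟ i) ×-dec ¬? (q Fin.≟ i) ×-dec ¬? (q Fin.≟ f i) ×-dec ¬? (f q Fin.≟ f i))
  ... | yes (i , q , w) = inj₂ (inj₂ (i , q , w))
  ... | no none with Fin.all? (λ i → f i Fin.≟ i)
  ...   | yes id = inj₁ id
  ...   | no ¬id with Fin.¬∀⟶∃¬ k _ (λ i → f i Fin.≟ i) ¬id
  ...     | i , fi≢i = inj₂ (inj₁ (f i , const))
    where
    rest : ∀ q → q ≢ f i → f q ≡ f i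
    rest q q≢fi with q Fin.≟ i | f q Fin.≟ f i
    ... | yes refl | _          = refl
    ... | no _     | yes fq≡fi = fq≡fi
    ... | no q≢i   | no fq≢fi  = contradiction (i , q , fi≢i , q≢i , q≢fi , fq≢fi) none
    const : ∀ q → f q ≡ f i
    const q with q Fin.≟ f i | f (f i) Fin.≟ f i
    ... | no q≢fi  | _         = rest q q≢fi
    ... | yes refl | yes ffi≡ = ffi≡
    -- Now `f i` is misplaced as well, so a third role `t` would be sent both to `f i` and to
    -- `f (f i)`.
    ... | yes refl | no ffi≢ with third-role (≢-sym ffi≢)
    ...   | t , t≢fi , t≢ffi =
      contradiction (f i , t , ffi≢ , t≢fi , t≢ffi , λ ft≡ → ffi≢ (trans (sym ft≡) (rest t t≢fi))) none

  #-mono : ∀ {Q R : Vec (Fin N) k → Set} (Q? : ∀ φ → Dec (Q φ)) (R? : ∀ φ → Dec (R φ)) →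
           (∀ φ → Q φ → R φ) → # Q? ≤ # R?
  #-mono Q? R? Q⊆R = ∑-mono (words vs k) (λ φ → ⟦⟧-mono (Q? φ) (R? φ) (Q⊆R φ))

  ∑-# : ∀ {X : Set} (xs : List X) (c : X → ℕ) {R : X → Vec (Fin N) k → Set} (R? : ∀ x φ → Dec (R x φ)) →
        ∑ (words vs k) (λ φ → ∑ xs (λ x → c x * ⟦ R? x φ ⟧)) ≡ ∑ xs (λ x → c x * # (R? x))
  ∑-# xs c R? = trans (∑-swap (λ φ x → c x * ⟦ R? x φ ⟧) (words vs k) xs)
                      (∑-cong xs (λ x → ∑-*ˡ (c x) (λ φ → ⟦ R? x φ ⟧) (words vs k)))

  -- For union bounds: a word is accounted for once it is exhibited at a single place `x` where both
  -- indicators are 1.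
  covered : ∀ {X Cond R : Set} {xs : List X} {x} (c r : X → ℕ) (C? : Dec Cond) (R? : Dec R) → c x ≡ ⟦ C? ⟧ → r x ≡ ⟦ R? ⟧ →
            x ∈ xs → Cond → R → 1 ≤ ∑ xs (λ x → c x * r x)
  covered c r C? R? c≡ r≡ x∈ Cond R = ≤-trans
    (≤-reflexive (sym (cong₂ _*_ (trans c≡ (⟦⟧≡1 C? Cond)) (trans r≡ (⟦⟧≡1 R? R)))))
    (term≤∑ (λ x → c x * r x) x∈)

  module Within (U : Fin N → Set) (U? : ∀ v → Dec (U v)) where

    n : ℕ
    n = card U?

    deg : Fin k → Fin N → ℕ
    deg i v = # (λ φ → copy? U? φ ×-dec (v Fin.≟ lookup φ i))

    d : Fin k → Fin k → Fin N → ℕ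
    d i j v = card (λ w → U? w ×-dec E? v w i j)

    p s : Fin k → Fin N → ℕ
    p i v = ∏ (others i) (λ j → d i j v)
    s i v = ∑ (others i) (λ j → d i j v)

    d-swap : ∀ i j v → d i j v ≡ d j i v
    d-swap i j v = ≤-antisym (half i j) (half j i)
      where
      half : ∀ i j → d i j v ≤ d j i v
      half i j = card-mono (λ w → U? w ×-dec E? v w i j) (λ w → U? w ×-dec E? v w j i) (λ w (uw , e) → uw , E-swap e)

    deg≤p : ∀ i v → deg i v ≤ p i v
    deg≤p i v = begin
      deg i v                                   ≤⟨ box-bound (λ φ → copy? U? φ ×-dec (v Fin.≟ lookup φ i)) B? inB ⟩
      ∏ ks (λ j → card (B? j))                  ≡⟨ ∏-↭ (λ j → card (B? j)) (ks↭ i) ⟩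
      card (B? i) * ∏ (others i) (λ j → card (B? j))
        ≤⟨ *-mono-≤ (≤-trans (card-mono (B? i) (v Fin.≟_) (λ w b → proj₁ b refl)) (≤-reflexive (card-singleton v)))
                    (∏-mono-∈ (others i) (λ {j} j∈ → card-mono (B? j) (λ w → U? w ×-dec E? v w i j)
                                                      (λ w b → proj₁ (proj₂ b) , proj₂ (proj₂ b) (others∌ i j∈)))) ⟩
      1 * p i v                                 ≡⟨ *-identityˡ (p i v) ⟩
      p i v                                     ∎
      where
      open ≤-Reasoning
      B : Fin k → Fin N → Set
      B j w = (i ≡ j → v ≡ w) × U w × (i ≢ j → E v w i j)
      B? : ∀ j w → Dec (B j w)
      B? j w = (i Fin.≟ j →-dec v Fin.≟ w) ×-dec U? w ×-dec (¬? (i Fin.≟ j) →-dec E? v w i j)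
      inB : ∀ φ → Copy U φ × v ≡ lookup φ i → ∀ j → B j (lookup φ j)
      inB φ ((inU , hom) , refl) j = (λ { refl → refl }) , inU j , hom i j

    Same : Fin k × Fin k → Fin k × Fin k → Set
    Same (i , j) (i′ , j′) = (i ≡ i′ × j ≡ j′) ⊎ (i ≡ j′ × j ≡ i′)

    colours-sum : ∀ v {cs} → AllPairs (λ c c′ → ¬ Same c c′) cs → ∑ cs (λ (i , j) → d i j v) ≤ n
    colours-sum v {cs} distinct = ≤-trans
      (≤-reflexive (∑-swap (λ (i , j) w → ⟦ U? w ×-dec E? v w i j ⟧) cs vs))
      (∑-mono vs (λ w → ∑-exclusive (λ (i , j) → U? w ×-dec E? v w i j) (U? w)
        (AllPairs.map (λ ¬same (_ , e) (_ , e′) → ¬same (E-unique e e′)) distinct) (λ _ → proj₁)))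

    -- E-unique makes the colours at the role a disjoint from those at i that avoid a.
    stars-sum : ∀ v {i a ys} → i ≢ a → Unique (i ∷ ys) → (∀ {j} → j ∈ ys → j ≢ a) →
                ∑ ys (λ j → d i j v) + s a v ≤ n
    stars-sum v {i} {a} {ys} i≢a i∷ys! a∉ys = ≤-trans
      (≤-reflexive (sym (trans (∑-++ (map (i ,_) ys) _ D) (cong₂ _+_ (∑-map (i ,_) D ys) (∑-map (a ,_) D (others a))))))
      (colours-sum v {map (i ,_) ys ++ map (a ,_) (others a)}
        (AllPairs.++⁺ (star i∷ys!) (star (unique-from (ks↭ a))) (All.map⁺ (All.tabulate (λ j∈ → All.map⁺ (All.tabulate λ j′∈ → cross j∈ j′∈))))))
      where
      D : Fin k × Fin k → ℕ
      D (i , j) = d i j v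
      star : ∀ {i ys} → Unique (i ∷ ys) → AllPairs (λ c c′ → ¬ Same c c′) (map (i ,_) ys)
      star (i∉ ∷ ys!) = AllPairs.map⁺ (go i∉ ys!)
        where
        go : ∀ {i ys} → All (i ≢_) ys → Unique ys → AllPairs (λ j j′ → ¬ Same (i , j) (i , j′)) ys
        go []          []           = []
        go (i≢j ∷ i∉) (j∉ ∷ ys!) =
          All.zipWith (λ { (j≢j′ , i≢j′) (inj₁ (_ , j≡j′)) → j≢j′ j≡j′ ; (j≢j′ , i≢j′) (inj₂ (i≡j′ , _)) → i≢j′ i≡j′ }) (j∉ , i∉)
          ∷ go i∉ ys!
      cross : ∀ {j j′} → j ∈ ys → j′ ∈ others a → ¬ Same (i , j) (a , j′)
      cross j∈ j′∈ (inj₁ (i≡a , _)) = i≢a i≡a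
      cross j∈ j′∈ (inj₂ (_ , j≡a)) = a∉ys j∈ j≡a

    -- The stars at `a` and `i` share only the colour `ai`, which plays the part of `D`. The factor
    -- `2 ^ (1 + l)` is the gain over `n ^ m / m ^ m`, the AM-GM bound for a single star.
    non-dominant : ∀ v {a i} → a ≢ i → p i v ≤ p a v → p i v * (2 ^ (1 + l) * m ^ m) ≤ n ^ m
    non-dominant v {a} {i} a≢i pi≤pa with pair-split a≢i
    ... | ys , a↭ , i↭ = subst₂ (λ x y → x * (2 ^ y * suc y ^ suc y) ≤ n ^ suc y) (sym pi≡) length-ys
      (two-stars-am-gm ys f g D n sum≤n (subst₂ _≤_ pi≡ pa≡ pi≤pa))
      where
      D = d a i v
      f g : Fin k → ℕ
      f j = d a j v
      g j = d i j v
      pa≡ : p a v ≡ D * ∏ ys f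
      pa≡ = ∏-↭ f a↭
      pi≡ : p i v ≡ D * ∏ ys g
      pi≡ = trans (∏-↭ g i↭) (cong (_* ∏ ys g) (d-swap i a v))
      length-ys : length ys ≡ 1 + l
      length-ys = suc-injective (trans (sym (↭-length a↭)) (length-others a))
      i∷a∷ys! : Unique (i ∷ a ∷ ys)
      i∷a∷ys! = unique-from (↭-trans (ks↭ i) (prep i i↭))
      sum≤n : D + ∑ ys f + ∑ ys g ≤ n
      sum≤n with i∷a∷ys!
      ... | (_ ∷ i∉ys) ∷ a∷ys! = ≤-trans
        (≤-reflexive (trans (+-comm _ (∑ ys g)) (cong (∑ ys g +_) (sym (∑-↭ f a↭)))))
        (stars-sum v (λ i≡a → a≢i (sym i≡a)) (i∉ys ∷ AllPairs.tail a∷ys!) (λ j∈ j≡a → head≢ a∷ys! j∈ (sym j≡a)))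

    -- The maximum is taken over the products `p i v` and not over the degrees, because
    -- `non-dominant` compares products.
    ρ : Fin N → Fin k
    ρ v = proj₁ (maximiser (λ i → p i v))

    p≤pρ : ∀ v i → p i v ≤ p (ρ v) v
    p≤pρ v = proj₂ (maximiser (λ i → p i v))

    -- By `non-dominant`, the `m` other roles together supply at most a fifth of the required
    -- `n ^ m / k ^ m`, so `p (ρ v) v` supplies more than four fifths. If `s (ρ v) v` were below
    -- `(4 * m - 1) / (4 * k)` of `n`, AM-GM and `dominant-gap` would keep it at four fifths. The
    -- coefficient on the left is `4 * m - 1`.
    dominant : ∀ v → n ^ m < k ^ m * ∑ ks (λ i → deg i v) → (3 + 4 * (1 + l)) * n ≤ 4 * k * s (ρ v) v
    dominant v large with (3 + 4 * (1 + l)) * n ≤? 4 * k * s (ρ v) v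
    ... | yes yn≤4ks = yn≤4ks
    ... | no  yn≰4ks = contradiction large (≤⇒≯ (*-cancelˡ-≤ 5 (begin
      5 * (k ^ m * ∑ ks (λ i → deg i v))                ≤⟨ *-monoʳ-≤ 5 (*-monoʳ-≤ (k ^ m) (∑-mono ks (λ i → deg≤p i v))) ⟩
      5 * (k ^ m * ∑ ks (λ i → p i v))                  ≡⟨ cong (λ z → 5 * (k ^ m * z)) (∑-↭ (λ i → p i v) (ks↭ a)) ⟩
      5 * (k ^ m * (p a v + rest))                      ≡⟨ e (k ^ m) (p a v) rest ⟩
      5 * (k ^ m * p a v) + 5 * (k ^ m * rest)          ≤⟨ +-mono-≤ pa-small rest-small ⟩
      4 * n ^ m + n ^ m                                 ≡⟨ e′ (n ^ m) ⟩
      5 * n ^ m                                         ∎)))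
      where
      open ≤-Reasoning
      a = ρ v
      y = 3 + 4 * (1 + l)
      rest = ∑ (others a) (λ i → p i v)
      e : ∀ c x y → 5 * (c * (x + y)) ≡ 5 * (c * x) + 5 * (c * y)
      e = solve-∀
      e′ : ∀ x → 4 * x + x ≡ 5 * x
      e′ = solve-∀
      am-gm-a : p a v * m ^ m ≤ s a v ^ m
      am-gm-a = subst (λ z → p a v * z ^ z ≤ s a v ^ z) (length-others a) (am-gm (λ j → d a j v) (others a))
      pa-small : 5 * (k ^ m * p a v) ≤ 4 * n ^ m
      pa-small = *-cancelˡ-≤ ((4 * m) ^ m) {{m^n≢0 (4 * m) m}} (begin
        (4 * m) ^ m * (5 * (k ^ m * p a v))            ≡⟨ cong (_* (5 * (k ^ m * p a v))) (^-distribʳ-* 4 m m) ⟩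
        4 ^ m * m ^ m * (5 * (k ^ m * p a v))          ≡⟨ e₁ (4 ^ m) (m ^ m) (k ^ m) (p a v) ⟩
        5 * (4 ^ m * k ^ m * (p a v * m ^ m))          ≤⟨ *-monoʳ-≤ 5 (*-monoʳ-≤ (4 ^ m * k ^ m) am-gm-a) ⟩
        5 * (4 ^ m * k ^ m * s a v ^ m)                ≡⟨ cong (5 *_) (sym (trans (^-distribʳ-* (4 * k) (s a v) m) (cong (_* s a v ^ m) (^-distribʳ-* 4 k m)))) ⟩
        5 * (4 * k * s a v) ^ m                        ≤⟨ *-monoʳ-≤ 5 (^-monoˡ-≤ m (<⇒≤ (≰⇒> yn≰4ks))) ⟩
        5 * (y * n) ^ m                                ≡⟨ trans (cong (5 *_) (^-distribʳ-* y n m)) (sym (*-assoc 5 (y ^ m) (n ^ m))) ⟩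
        5 * y ^ m * n ^ m                              ≤⟨ *-monoˡ-≤ (n ^ m) (dominant-gap (1 + l)) ⟩
        4 * (4 * m) ^ m * n ^ m                        ≡⟨ e₂ ((4 * m) ^ m) (n ^ m) ⟩
        (4 * m) ^ m * (4 * n ^ m)                      ∎)
        where
        e₁ : ∀ f m k p → f * m * (5 * (k * p)) ≡ 5 * (f * k * (p * m))
        e₁ = solve-∀
        e₂ : ∀ x y → 4 * x * y ≡ x * (4 * y)
        e₂ = solve-∀
      rest-small : 5 * (k ^ m * rest) ≤ n ^ m
      rest-small = *-cancelˡ-≤ k (begin
        k * (5 * (k ^ m * rest))              ≡⟨ e₁ k (k ^ m) rest ⟩
        5 * k ^ k * rest                      ≡⟨ sym (∑-*ˡ (5 * k ^ k) (λ i → p i v) (others a)) ⟩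
        ∑ (others a) (λ i → 5 * k ^ k * p i v) ≤⟨ ∑-mono-∈ (others a) (λ {i} i∈ → others-small i (others∌ a i∈)) ⟩
        ∑ (others a) (λ i → n ^ m)            ≡⟨ trans (∑-const (n ^ m) (others a)) (cong (_* n ^ m) (length-others a)) ⟩
        m * n ^ m                             ≤⟨ *-monoˡ-≤ (n ^ m) (n≤1+n m) ⟩
        k * n ^ m                             ∎)
        where
        e₁ : ∀ k x r → k * (5 * (x * r)) ≡ 5 * (k * x) * r
        e₁ = solve-∀
        others-small : ∀ i → a ≢ i → 5 * k ^ k * p i v ≤ n ^ m
        others-small i a≢i = begin
          5 * k ^ k * p i v                      ≤⟨ *-monoˡ-≤ (p i v) (non-dominant-numeric l 8≤l) ⟩
          2 ^ (1 + l) * m ^ m * p i v            ≡⟨ *-comm _ (p i v) ⟩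
          p i v * (2 ^ (1 + l) * m ^ m)          ≤⟨ non-dominant v a≢i (p≤pρ v i) ⟩
          n ^ m                                  ∎

    -- The value that `crossing≤` requires: 2 for the two orders of a pair of roles, 2 and `k ^ k`
    -- from `Π-large`, and `k * k` for averaging over pairs of parts.
    rare-constant : ℕ
    rare-constant = 4 * (k * k * k ^ k)

    module _ (v : Fin N) (dom : (3 + 4 * (1 + l)) * n ≤ 4 * k * s (ρ v) v) where

      -- The colours `ij` with `j` in `ys` do not occur in the star at `ρ v`, so they share the at
      -- most `5 / (4 * k)` of `n` which that star leaves over; note `4 * k - 5 = 3 + 4 * (1 + l)`.
      -- AM-GM over these `l` colours does the rest.
      rare-product : ∀ {i q ys} → ks ↭ i ∷ ρ v ∷ q ∷ ys → rare-constant * ∏ ys (λ j → d i j v) ≤ n ^ l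
      rare-product {i} {q} {ys} ks↭′ = *-cancelˡ-≤ (5 ^ l) {{m^n≢0 5 l}} (begin
        5 ^ l * (4 * (k * k * k ^ k) * Z)             ≡⟨ e₁ (5 ^ l) k (k ^ l) Z ⟩
        4 * k ^ 5 * 5 ^ l * (k ^ l * Z)               ≤⟨ *-monoˡ-≤ (k ^ l * Z) (rare-numeric l 8≤l) ⟩
        (4 * l) ^ l * (k ^ l * Z)                     ≡⟨ cong (_* (k ^ l * Z)) (^-distribʳ-* 4 l l) ⟩
        4 ^ l * l ^ l * (k ^ l * Z)                   ≡⟨ e₂ (4 ^ l) (l ^ l) (k ^ l) Z ⟩
        4 ^ l * k ^ l * (Z * l ^ l)                   ≤⟨ *-monoʳ-≤ (4 ^ l * k ^ l) am-gm-Z ⟩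
        4 ^ l * k ^ l * S ^ l                         ≡⟨ sym (trans (^-distribʳ-* (4 * k) S l) (cong (_* S ^ l) (^-distribʳ-* 4 k l))) ⟩
        (4 * k * S) ^ l                               ≤⟨ ^-monoˡ-≤ l 4kS≤5n ⟩
        (5 * n) ^ l                                   ≡⟨ ^-distribʳ-* 5 n l ⟩
        5 ^ l * n ^ l                                 ∎)
        where
        open ≤-Reasoning
        Z = ∏ ys (λ j → d i j v)
        S = ∑ ys (λ j → d i j v)
        e₁ : ∀ f k x Z → f * (4 * (k * k * (k * (k * (k * x)))) * Z) ≡ 4 * (k * (k * (k * (k * (k * 1))))) * f * (x * Z)
        e₁ = solve-∀
        e₂ : ∀ a b c d → a * b * (c * d) ≡ a * c * (d * b)
        e₂ = solve-∀
        length-ys : length ys ≡ l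
        length-ys = suc-injective (suc-injective (suc-injective (trans (sym (↭-length ks↭′)) (length-fins k))))
        am-gm-Z : Z * l ^ l ≤ S ^ l
        am-gm-Z = subst (λ z → Z * z ^ z ≤ S ^ z) length-ys (am-gm (λ j → d i j v) ys)
        S+s≤n : S + s (ρ v) v ≤ n
        S+s≤n with unique-from ks↭′
        ... | (i≢a ∷ _ ∷ i∉ys) ∷ (_ ∷ a∉ys) ∷ _ ∷ ys! =
          stars-sum v i≢a (i∉ys ∷ ys!) (λ j∈ j≡a → All.lookup a∉ys j∈ (sym j≡a))
        4kS≤5n : 4 * k * S ≤ 5 * n
        4kS≤5n = +-cancelʳ-≤ ((3 + 4 * (1 + l)) * n) _ _ (begin
          4 * k * S + (3 + 4 * (1 + l)) * n        ≤⟨ +-monoʳ-≤ (4 * k * S) dom ⟩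
          4 * k * S + 4 * k * s (ρ v) v            ≡⟨ sym (*-distribˡ-+ (4 * k) S _) ⟩
          4 * k * (S + s (ρ v) v)                  ≤⟨ *-monoʳ-≤ (4 * k) S+s≤n ⟩
          4 * k * n                                ≡⟨ e l n ⟩
          5 * n + (3 + 4 * (1 + l)) * n            ∎)
          where
          e : ∀ l n → 4 * (3 + l) * n ≡ 5 * n + (3 + 4 * (1 + l)) * n
          e = solve-∀

      -- Role `i` is pinned to `v`. Role `ρ v` gets the trivial factor `n`, since its colour also
      -- lies in the dominant star. Role `q` is left to `B`, which will be all of `U` or a single
      -- vertex, and `rare-product` treats the other `l` roles.
      rare : ∀ {i q} → i ≢ ρ v → q ≢ i → q ≢ ρ v → {B : Fin N → Set} (B? : ∀ w → Dec (B w)) →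
             rare-constant * # (λ φ → copy? U? φ ×-dec (v Fin.≟ lookup φ i) ×-dec B? (lookup φ q)) ≤ n * n ^ l * card B?
      rare {i} {q} i≢a q≢i q≢a {B} B? with extract (∈-others i≢a)
      ... | zs , i↭ with extract q∈zs
        where
        q∈zs : q ∈ zs
        q∈zs with ∈-resp-↭ i↭ (∈-others (λ i≡q → q≢i (sym i≡q)))
        ... | here q≡a = contradiction q≡a q≢a
        ... | there q∈ = q∈
      ... | ys , zs↭ = begin
        rare-constant * # Q?                             ≤⟨ *-monoʳ-≤ rare-constant (≤-trans (box-bound Q? C? inC) (≤-reflexive (∏-↭ (λ j → card (C? j)) ks↭′))) ⟩
        rare-constant * (card (C? i) * (card (C? (ρ v)) * (card (C? q) * ∏ ys (λ j → card (C? j)))))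
          ≤⟨ *-monoʳ-≤ rare-constant (*-mono-≤ C-i (*-mono-≤ (card-mono (C? (ρ v)) U? (λ w c → proj₁ (proj₂ (proj₂ c))))
               (*-mono-≤ (card-mono (C? q) B? (λ w c → proj₁ (proj₂ c) refl)) (∏-mono-∈ ys C-j)))) ⟩
        rare-constant * (1 * (n * (card B? * Z)))        ≡⟨ e rare-constant n (card B?) Z ⟩
        n * (rare-constant * Z) * card B?                ≤⟨ *-monoˡ-≤ (card B?) (*-monoʳ-≤ n (rare-product ks↭′)) ⟩
        n * n ^ l * card B?                              ∎
        where
        open ≤-Reasoning
        ks↭′ : ks ↭ i ∷ ρ v ∷ q ∷ ys
        ks↭′ = ↭-trans (ks↭ i) (prep i (↭-trans i↭ (prep (ρ v) zs↭)))
        Z = ∏ ys (λ j → d i j v)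
        Q? : ∀ φ → Dec _
        Q? φ = copy? U? φ ×-dec (v Fin.≟ lookup φ i) ×-dec B? (lookup φ q)
        Box : Fin k → Fin N → Set
        Box j w = (i ≡ j → v ≡ w) × (q ≡ j → B w) × U w × (i ≢ j → E v w i j)
        C? : ∀ j w → Dec (Box j w)
        C? j w = (i Fin.≟ j →-dec v Fin.≟ w) ×-dec (q Fin.≟ j →-dec B? w) ×-dec U? w ×-dec (¬? (i Fin.≟ j) →-dec E? v w i j)
        inC : ∀ φ → Copy U φ × v ≡ lookup φ i × B (lookup φ q) → ∀ j → Box j (lookup φ j)
        inC φ ((inU , hom) , refl , b) j = (λ { refl → refl }) , (λ { refl → b }) , inU j , hom i j
        C-i : card (C? i) ≤ 1
        C-i = ≤-trans (card-mono (C? i) (v Fin.≟_) (λ w c → proj₁ c refl)) (≤-reflexive (card-singleton v))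
        C-j : ∀ {j} → j ∈ ys → card (C? j) ≤ d i j v
        C-j {j} j∈ = card-mono (C? j) (λ w → U? w ×-dec E? v w i j)
          (λ w c → proj₁ (proj₂ (proj₂ c)) , proj₂ (proj₂ (proj₂ c)) (head≢ (unique-from ks↭′) (there (there j∈))))
        e : ∀ c n b Z → c * (1 * (n * (b * Z))) ≡ n * (c * Z) * b
        e = solve-∀

    part? : ∀ a v → Dec (U v × ρ v ≡ a)
    part? a v = U? v ×-dec (ρ v Fin.≟ a)

    size : Fin k → ℕ
    size a = card (part? a)

    Π : ℕ
    Π = ∏ ks size

    size≤n : ∀ a → size a ≤ n
    size≤n a = card-mono (part? a) U? (λ _ → proj₁)

    ∑-size : ∑ ks size ≡ n
    ∑-size = trans (∑-swap (λ a v → ⟦ part? a v ⟧) ks vs)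
      (∑-cong vs (λ v → trans (∑-cong ks (λ a → trans (⟦×⟧ (U? v) (ρ v Fin.≟ a)) (*-comm ⟦ U? v ⟧ _))) (∑-δ (ρ v) (λ _ → ⟦ U? v ⟧))))

    total : ℕ
    total = # (copy? U?)

    kks = cartesianProduct ks ks
    vvs = cartesianProduct vs vs

    ∑-pairs : ∀ {X Y : Set} (F : X × Y → ℕ) xs ys → ∑ (cartesianProduct xs ys) F ≡ ∑ xs (λ x → ∑ ys (λ y → F (x , y)))
    ∑-pairs F xs ys = ∑-cartesianProductWith _,_ F xs ys

    ∑-deg : ∀ i → ∑ vs (deg i) ≤ total
    ∑-deg i = ≤-trans (≤-reflexive (∑-swap (λ v φ → ⟦ copy? U? φ ×-dec (v Fin.≟ lookup φ i) ⟧) vs (words vs k)))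
      (∑-mono (words vs k) (λ φ → ≤-trans
        (∑-mono vs (λ v → ⟦⟧≤ (copy? U? φ ×-dec (v Fin.≟ lookup φ i)) (λ (c , v≡) →
          ≤-reflexive (sym (cong₂ _*_ (⟦⟧≡1 (lookup φ i Fin.≟ v) (sym v≡)) (⟦⟧≡1 (copy? U? φ) c))))))
        (≤-reflexive (∑-δ (lookup φ i) (λ _ → ⟦ copy? U? φ ⟧)))))

    transversal? : ∀ φ → Dec (∀ i → U (lookup φ i) × ρ (lookup φ i) ≡ i)
    transversal? φ = Fin.all? (λ i → part? i (lookup φ i))

    good? : ∀ φ → Dec (Copy U φ × (∀ i → ρ (lookup φ i) ≡ i))
    good? φ = copy? U? φ ×-dec Fin.all? (λ i → ρ (lookup φ i) Fin.≟ i)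

    good : ℕ
    good = # good?

    good≤Π : good ≤ Π
    good≤Π = box-bound good? part? (λ φ ((inU , _) , fixed) j → inU j , fixed j)

    -- Structure when every vertex lies in many copies

    module LargeDegrees (n>0 : n > 0) (large : ∀ v → U v → n ^ m < k ^ m * ∑ ks (λ i → deg i v)) where

      open ≤-Reasoning

      instance
        n≢0 : NonZero n
        n≢0 = >-nonZero n>0
        k^k≢0 : NonZero (k ^ k)
        k^k≢0 = m^n≢0 k k

      dominant-at : ∀ {v} → U v → (3 + 4 * (1 + l)) * n ≤ 4 * k * s (ρ v) v
      dominant-at {v} uv = dominant v (large v uv)

      -- Summing the degree condition over `U` counts every copy `k` times.
      many-copies : n ^ k ≤ k ^ k * total
      many-copies = begin
        n * n ^ m                                                ≡⟨ sym (∑-*ʳ (n ^ m) (λ v → ⟦ U? v ⟧) vs) ⟩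
        ∑ vs (λ v → ⟦ U? v ⟧ * n ^ m)                            ≤⟨ ∑-mono vs (λ v → ⟦⟧*≤ (U? v) (λ uv → <⇒≤ (large v uv))) ⟩
        ∑ vs (λ v → ⟦ U? v ⟧ * (k ^ m * ∑ ks (λ i → deg i v)))   ≤⟨ ∑-mono vs (λ v → *-monoˡ-≤ _ (⟦⟧≤1 (U? v))) ⟩
        ∑ vs (λ v → 1 * (k ^ m * ∑ ks (λ i → deg i v)))          ≡⟨ ∑-cong vs (λ v → *-identityˡ _) ⟩
        ∑ vs (λ v → k ^ m * ∑ ks (λ i → deg i v))                ≡⟨ ∑-*ˡ (k ^ m) (λ v → ∑ ks (λ i → deg i v)) vs ⟩
        k ^ m * ∑ vs (λ v → ∑ ks (λ i → deg i v))                ≡⟨ cong (k ^ m *_) (∑-swap (λ v i → deg i v) vs ks) ⟩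
        k ^ m * ∑ ks (λ i → ∑ vs (deg i))                        ≤⟨ *-monoʳ-≤ (k ^ m) (∑-mono ks ∑-deg) ⟩
        k ^ m * ∑ ks (λ i → total)                                  ≡⟨ cong (k ^ m *_) (trans (∑-const total ks) (cong (_* total) (length-fins k))) ⟩
        k ^ m * (k * total)                                         ≡⟨ e (k ^ m) k total ⟩
        k * k ^ m * total                                           ∎
        where
        e : ∀ a k c → a * (k * c) ≡ k * a * c
        e = solve-∀

      misplaced? : ∀ ((i , v) : Fin k × Fin N) → Dec (U v × ρ v ≢ i)
      misplaced? (i , v) = U? v ×-dec ¬? (ρ v Fin.≟ i)

      misplaced : ℕ
      misplaced = ∑ (cartesianProduct ks vs) (λ (i , v) → ⟦ misplaced? (i , v) ⟧ * deg i v)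

      -- A crude cover, in which even the copies inside one part count as misplaced. It serves to
      -- bound `Π` from below; the finer cover is `total≤Π+inner`.
      total≤Π+misplaced : total ≤ Π + misplaced
      total≤Π+misplaced = begin
        total                        ≤⟨ ∑-mono (words vs k) (λ φ → ⟦⟧≤ (copy? U? φ) (pointwise φ)) ⟩
        ∑ (words vs k) (λ φ → ⟦ good? φ ⟧ + ∑ ivs (λ x → ⟦ misplaced? x ⟧ * ⟦ at? x φ ⟧))
                                  ≡⟨ ∑-+ (λ φ → ⟦ good? φ ⟧) _ (words vs k) ⟩
        good + ∑ (words vs k) (λ φ → ∑ ivs (λ x → ⟦ misplaced? x ⟧ * ⟦ at? x φ ⟧))
                                  ≡⟨ cong (good +_) (∑-# ivs (λ x → ⟦ misplaced? x ⟧) at?) ⟩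
        good + misplaced          ≤⟨ +-monoˡ-≤ misplaced good≤Π ⟩
        Π + misplaced             ∎
        where
        ivs = cartesianProduct ks vs
        at? : ∀ ((i , v) : Fin k × Fin N) φ → Dec (Copy U φ × v ≡ lookup φ i)
        at? (i , v) φ = copy? U? φ ×-dec (v Fin.≟ lookup φ i)
        pointwise : ∀ φ → Copy U φ → 1 ≤ ⟦ good? φ ⟧ + ∑ ivs (λ x → ⟦ misplaced? x ⟧ * ⟦ at? x φ ⟧)
        pointwise φ copy with Fin.all? (λ i → ρ (lookup φ i) Fin.≟ i)
        ... | yes fixed = ≤-trans (≤-reflexive (sym (⟦⟧≡1 (good? φ) (copy , fixed)))) (m≤m+n _ _)
        ... | no ¬fixed with Fin.¬∀⟶∃¬ k _ (λ i → ρ (lookup φ i) Fin.≟ i) ¬fixed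
        ...   | i , ρ≢i = ≤-trans
          (covered (λ x → ⟦ misplaced? x ⟧) (λ x → ⟦ at? x φ ⟧) (misplaced? (i , lookup φ i)) (at? (i , lookup φ i) φ) refl refl
            (∈-cartesianProduct⁺ (∈-fins i) (∈-fins (lookup φ i))) (proj₁ copy i , ρ≢i) (copy , refl)) (m≤n+m _ _)

      misplaced-small : rare-constant * misplaced ≤ k * n ^ k
      misplaced-small = begin
        rare-constant * misplaced                              ≡⟨ sym (∑-*ˡ rare-constant _ ivs) ⟩
        ∑ ivs (λ (i , v) → rare-constant * (⟦ misplaced? (i , v) ⟧ * deg i v))
                                                               ≤⟨ ∑-mono ivs bound ⟩
        ∑ ivs (λ (i , v) → ⟦ U? v ⟧ * (n * n ^ l * n))         ≡⟨ ∑-pairs _ ks vs ⟩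
        ∑ ks (λ i → ∑ vs (λ v → ⟦ U? v ⟧ * (n * n ^ l * n)))   ≡⟨ ∑-cong ks (λ i → ∑-*ʳ (n * n ^ l * n) (λ v → ⟦ U? v ⟧) vs) ⟩
        ∑ ks (λ i → n * (n * n ^ l * n))                       ≡⟨ trans (∑-const (n * (n * n ^ l * n)) ks) (cong (_* (n * (n * n ^ l * n))) (length-fins k)) ⟩
        k * (n * (n * n ^ l * n))                              ≡⟨ e k n (n ^ l) ⟩
        k * n ^ k                                              ∎
        where
        ivs = cartesianProduct ks vs
        e : ∀ k n x → k * (n * (n * x * n)) ≡ k * (n * (n * (n * x)))
        e = solve-∀
        e′ : ∀ c i d → c * (i * d) ≡ i * (c * d)
        e′ = solve-∀
        bound : ∀ ((i , v) : Fin k × Fin N) → rare-constant * (⟦ misplaced? (i , v) ⟧ * deg i v) ≤ ⟦ U? v ⟧ * (n * n ^ l * n)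
        bound (i , v) = begin
          rare-constant * (⟦ misplaced? (i , v) ⟧ * deg i v)  ≡⟨ e′ rare-constant ⟦ misplaced? (i , v) ⟧ (deg i v) ⟩
          ⟦ misplaced? (i , v) ⟧ * (rare-constant * deg i v)  ≤⟨ ⟦⟧*≤ (misplaced? (i , v)) (λ (uv , ρ≢i) → at-misplaced uv ρ≢i (third-role ρ≢i)) ⟩
          ⟦ misplaced? (i , v) ⟧ * (n * n ^ l * n)            ≤⟨ *-monoˡ-≤ (n * n ^ l * n) (⟦⟧-mono (misplaced? (i , v)) (U? v) proj₁) ⟩
          ⟦ U? v ⟧ * (n * n ^ l * n)                          ∎
          where
          -- Nothing is known about the vertex in the third role `q`, so all of `U` is allowed
          -- there.
          at-misplaced : U v → ρ v ≢ i → (∃ λ q → q ≢ ρ v × q ≢ i) → rare-constant * deg i v ≤ n * n ^ l * n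
          at-misplaced uv ρ≢i (q , q≢ρ , q≢i) = ≤-trans
            (*-monoʳ-≤ rare-constant (#-mono (λ φ → copy? U? φ ×-dec (v Fin.≟ lookup φ i)) (λ φ → copy? U? φ ×-dec (v Fin.≟ lookup φ i) ×-dec U? (lookup φ q))
              (λ φ (copy , v≡) → copy , v≡ , proj₁ copy q)))
            (rare v (dominant-at uv) (≢-sym ρ≢i) q≢i q≢ρ U?)

      -- Misplaced copies are at most half of the `n ^ k / k ^ k` copies that `many-copies`
      -- guarantees; the rest are transversals.
      Π-large : n ^ k ≤ 2 * (k ^ k * Π)
      Π-large = +-cancelˡ-≤ (n ^ k) _ _ (begin
        n ^ k + n ^ k                                   ≤⟨ +-mono-≤ many-copies many-copies ⟩
        k ^ k * total + k ^ k * total                         ≡⟨ e₁ (k ^ k) total ⟩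
        2 * (k ^ k * total)                                ≤⟨ *-monoʳ-≤ 2 (*-monoʳ-≤ (k ^ k) total≤Π+misplaced) ⟩
        2 * (k ^ k * (Π + misplaced))                   ≡⟨ e₂ (k ^ k) Π misplaced ⟩
        2 * (k ^ k * misplaced) + 2 * (k ^ k * Π)       ≤⟨ +-monoˡ-≤ _ misplaced-small′ ⟩
        n ^ k + 2 * (k ^ k * Π)                         ∎)
        where
        e₁ : ∀ a b → a * b + a * b ≡ 2 * (a * b)
        e₁ = solve-∀
        e₂ : ∀ a b c → 2 * (a * (b + c)) ≡ 2 * (a * c) + 2 * (a * b)
        e₂ = solve-∀
        misplaced-small′ : 2 * (k ^ k * misplaced) ≤ n ^ k
        misplaced-small′ = *-cancelˡ-≤ k (begin
          k * (2 * (k ^ k * misplaced))          ≤⟨ *-monoʳ-≤ k (*-monoˡ-≤ (k ^ k * misplaced) (≤-trans (m≤m+n 2 2) (*-monoʳ-≤ 4 (s≤s (z≤n {m}))))) ⟩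
          k * (4 * k * (k ^ k * misplaced))      ≡⟨ e k (k ^ k) misplaced ⟩
          rare-constant * misplaced              ≤⟨ misplaced-small ⟩
          k * n ^ k                              ∎)
          where
          e : ∀ k x y → k * (4 * k * (x * y)) ≡ 4 * (k * k * x) * y
          e = solve-∀

      bad? : ∀ ((a , b) : Fin k × Fin k) ((v , w) : Fin N × Fin N) → Dec (a ≢ b × (U v × ρ v ≡ a) × (U w × ρ w ≡ b) × ¬ E v w a b)
      bad? (a , b) (v , w) = ¬? (a Fin.≟ b) ×-dec part? a v ×-dec part? b w ×-dec ¬? (E? v w a b)

      bad-between : Fin k × Fin k → ℕ
      bad-between ab = ∑ vvs (λ vw → ⟦ bad? ab vw ⟧)

      bad : ℕ
      bad = ∑ kks bad-between

      -- At most `q = Π / (size a * size b)` transversals contain a given pair from the parts `a`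
      -- and `b`, and good copies use only pairs of the right colour. So each bad pair costs `q`,
      -- which is at least `Π / (n * n)`. A transversal may contain several bad pairs; treating one
      -- `ab` at a time and averaging in `missing-total` avoids inclusion-exclusion for a factor
      -- `k * k`.
      missing : ∀ ab → n * n * good + bad-between ab * Π ≤ n * n * Π
      missing (a , b) with a Fin.≟ b
      -- On the diagonal `bad?` is always false.
      ... | yes refl = ≤-trans (≤-reflexive (trans (cong (λ z → n * n * good + z * Π) (trans (∑-const 0 vvs) (*-zeroʳ (length vvs)))) (+-identityʳ _)))
                               (*-monoʳ-≤ (n * n) good≤Π)
      ... | no a≢b with pair-split a≢b
      ...   | ys , a↭ , b↭ = begin
        n * n * good + B * Π                             ≡⟨ cong (λ z → n * n * good + B * z) Π≡ ⟩
        n * n * good + B * (size a * (size b * q))       ≡⟨ e₁ (n * n * good) B (size a) (size b) q ⟩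
        n * n * good + size a * size b * (B * q)         ≤⟨ +-monoʳ-≤ (n * n * good) (*-monoˡ-≤ (B * q) (*-mono-≤ (size≤n a) (size≤n b))) ⟩
        n * n * good + n * n * (B * q)                   ≡⟨ sym (*-distribˡ-+ (n * n) good (B * q)) ⟩
        n * n * (good + B * q)                           ≤⟨ *-monoʳ-≤ (n * n) (+-monoˡ-≤ (B * q) good≤) ⟩
        n * n * (G * q + B * q)                          ≡⟨ cong (n * n *_) (sym (*-distribʳ-+ q G B)) ⟩
        n * n * ((G + B) * q)                            ≤⟨ *-monoʳ-≤ (n * n) (*-monoˡ-≤ q G+B≤) ⟩
        n * n * (size a * size b * q)                    ≡⟨ cong (n * n *_) (trans (*-assoc (size a) (size b) q) (sym Π≡)) ⟩
        n * n * Π                                        ∎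
        where
        q = ∏ ys size
        ks↭′ : ks ↭ a ∷ b ∷ ys
        ks↭′ = ↭-trans (ks↭ a) (prep a a↭)
        Π≡ : Π ≡ size a * (size b * q)
        Π≡ = ∏-↭ size ks↭′
        e₁ : ∀ x B a b q → x + B * (a * (b * q)) ≡ x + a * b * (B * q)
        e₁ = solve-∀
        badab? : ∀ ((v , w) : Fin N × Fin N) → Dec (a ≢ b × (U v × ρ v ≡ a) × (U w × ρ w ≡ b) × ¬ E v w a b)
        badab? (v , w) = yes a≢b ×-dec part? a v ×-dec part? b w ×-dec ¬? (E? v w a b)
        B = ∑ vvs (λ vw → ⟦ badab? vw ⟧)
        edge? : ∀ ((v , w) : Fin N × Fin N) → Dec ((U v × ρ v ≡ a) × (U w × ρ w ≡ b) × E v w a b)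
        edge? (v , w) = part? a v ×-dec part? b w ×-dec E? v w a b
        G = ∑ vvs (λ vw → ⟦ edge? vw ⟧)
        G+B≤ : G + B ≤ size a * size b
        G+B≤ = begin
          G + B                                                ≡⟨ sym (∑-+ (λ vw → ⟦ edge? vw ⟧) _ vvs) ⟩
          ∑ vvs (λ vw → ⟦ edge? vw ⟧ + ⟦ badab? vw ⟧)           ≤⟨ ∑-mono vvs exclusive ⟩
          ∑ vvs (λ (v , w) → ⟦ part? a v ⟧ * ⟦ part? b w ⟧)    ≡⟨ ∑-pairs (λ (v , w) → ⟦ part? a v ⟧ * ⟦ part? b w ⟧) vs vs ⟩
          ∑ vs (λ v → ∑ vs (λ w → ⟦ part? a v ⟧ * ⟦ part? b w ⟧)) ≡⟨ ∑-cong vs (λ v → ∑-*ˡ ⟦ part? a v ⟧ (λ w → ⟦ part? b w ⟧) vs) ⟩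
          ∑ vs (λ v → ⟦ part? a v ⟧ * size b)                  ≡⟨ ∑-*ʳ (size b) (λ v → ⟦ part? a v ⟧) vs ⟩
          size a * size b                                      ∎
          where
          exclusive : ∀ vw → ⟦ edge? vw ⟧ + ⟦ badab? vw ⟧ ≤ ⟦ part? a (proj₁ vw) ⟧ * ⟦ part? b (proj₂ vw) ⟧
          exclusive (v , w) = help (part? a v) (part? b w) (E? v w a b)
            where
            help : ∀ {P Q R : Set} (P? : Dec P) (Q? : Dec Q) (R? : Dec R) →
                   ⟦ P? ×-dec Q? ×-dec R? ⟧ + ⟦ P? ×-dec Q? ×-dec ¬? R? ⟧ ≤ ⟦ P? ⟧ * ⟦ Q? ⟧
            help (yes _) (yes _) (yes _) = ≤-refl
            help (yes _) (yes _) (no _)  = ≤-refl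
            help (yes _) (no _)  _       = ≤-refl
            help (no _)  _       _       = ≤-refl
        through? : ∀ ((v , w) : Fin N × Fin N) φ → Dec ((∀ i → U (lookup φ i) × ρ (lookup φ i) ≡ i) × v ≡ lookup φ a × w ≡ lookup φ b)
        through? (v , w) φ = transversal? φ ×-dec (v Fin.≟ lookup φ a) ×-dec (w Fin.≟ lookup φ b)
        through≤ : ∀ vw → # (through? vw) ≤ q
        through≤ (v , w) = begin
          # (through? (v , w))                                ≤⟨ box-bound (through? (v , w)) C? inC ⟩
          ∏ ks (λ j → card (C? j))                            ≡⟨ ∏-↭ (λ j → card (C? j)) ks↭′ ⟩
          card (C? a) * (card (C? b) * ∏ ys (λ j → card (C? j)))
            ≤⟨ *-mono-≤ (≤-trans (card-mono (C? a) (v Fin.≟_) (λ u c → proj₁ c refl)) (≤-reflexive (card-singleton v)))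
               (*-mono-≤ (≤-trans (card-mono (C? b) (w Fin.≟_) (λ u c → proj₁ (proj₂ c) refl)) (≤-reflexive (card-singleton w)))
                         (∏-mono-∈ ys (λ {j} _ → card-mono (C? j) (part? j) (λ u c → proj₂ (proj₂ c))))) ⟩
          1 * (1 * q)                                         ≡⟨ trans (*-identityˡ _) (*-identityˡ q) ⟩
          q                                                   ∎
          where
          C? : ∀ j u → Dec ((a ≡ j → v ≡ u) × (b ≡ j → w ≡ u) × (U u × ρ u ≡ j))
          C? j u = (a Fin.≟ j →-dec v Fin.≟ u) ×-dec (b Fin.≟ j →-dec w Fin.≟ u) ×-dec part? j u
          inC : ∀ φ → (∀ i → U (lookup φ i) × ρ (lookup φ i) ≡ i) × v ≡ lookup φ a × w ≡ lookup φ b →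
                ∀ j → (a ≡ j → v ≡ lookup φ j) × (b ≡ j → w ≡ lookup φ j) × (U (lookup φ j) × ρ (lookup φ j) ≡ j)
          inC φ (tr , refl , refl) j = (λ { refl → refl }) , (λ { refl → refl }) , tr j
        good≤ : good ≤ G * q
        good≤ = begin
          good                                                       ≤⟨ ∑-mono (words vs k) (λ φ → ⟦⟧≤ (good? φ) (pointwise φ)) ⟩
          ∑ (words vs k) (λ φ → ∑ vvs (λ vw → ⟦ edge? vw ⟧ * ⟦ through? vw φ ⟧)) ≡⟨ ∑-# vvs (λ vw → ⟦ edge? vw ⟧) through? ⟩
          ∑ vvs (λ vw → ⟦ edge? vw ⟧ * # (through? vw))              ≤⟨ ∑-mono vvs (λ vw → *-monoʳ-≤ ⟦ edge? vw ⟧ (through≤ vw)) ⟩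
          ∑ vvs (λ vw → ⟦ edge? vw ⟧ * q)                            ≡⟨ ∑-*ʳ q (λ vw → ⟦ edge? vw ⟧) vvs ⟩
          G * q                                                      ∎
          where
          pointwise : ∀ φ → Copy U φ × (∀ i → ρ (lookup φ i) ≡ i) → 1 ≤ ∑ vvs (λ vw → ⟦ edge? vw ⟧ * ⟦ through? vw φ ⟧)
          pointwise φ ((inU , hom) , fixed) =
            covered (λ vw → ⟦ edge? vw ⟧) (λ vw → ⟦ through? vw φ ⟧) (edge? x) (through? x φ) refl refl
              (∈-cartesianProduct⁺ (∈-fins (lookup φ a)) (∈-fins (lookup φ b)))
              ((inU a , fixed a) , (inU b , fixed b) , hom a b a≢b) ((λ i → inU i , fixed i) , refl , refl)
            where
            x = lookup φ a , lookup φ b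

      missing-total : k * k * (n * n * good) + bad * Π ≤ k * k * (n * n * Π)
      missing-total = begin
        k * k * (n * n * good) + bad * Π                                  ≡⟨ cong₂ _+_ (const-sum (n * n * good)) (sym (∑-*ʳ Π bad-between kks)) ⟩
        ∑ kks (λ _ → n * n * good) + ∑ kks (λ ab → bad-between ab * Π)    ≡⟨ sym (∑-+ (λ _ → n * n * good) (λ ab → bad-between ab * Π) kks) ⟩
        ∑ kks (λ ab → n * n * good + bad-between ab * Π)                  ≤⟨ ∑-mono kks missing ⟩
        ∑ kks (λ _ → n * n * Π)                                           ≡⟨ sym (const-sum (n * n * Π)) ⟩
        k * k * (n * n * Π)                                               ∎
        where
        const-sum : ∀ c → k * k * c ≡ ∑ kks (λ _ → c)
        const-sum c = sym (trans (∑-pairs (λ _ → c) ks ks) (trans (∑-cong ks (λ _ → trans (∑-const c ks) (cong (_* c) (length-fins k))))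
          (trans (∑-const (k * c) ks) (trans (cong (_* (k * c)) (length-fins k)) (sym (*-assoc k k c))))))

      -- The third outcome of `classify`, with `v` and `w` as the vertices in the roles `i` and `j`.
      crossing? : ∀ (((i , j) , (v , w)) : (Fin k × Fin k) × (Fin N × Fin N)) →
                  Dec ((U v × ρ v ≢ i × j ≢ i × j ≢ ρ v) × (U w × ρ w ≢ ρ v) × E v w i j)
      crossing? ((i , j) , (v , w)) =
        (U? v ×-dec ¬? (ρ v Fin.≟ i) ×-dec ¬? (j Fin.≟ i) ×-dec ¬? (j Fin.≟ ρ v)) ×-dec (U? w ×-dec ¬? (ρ w Fin.≟ ρ v)) ×-dec E? v w i j

      through? : ∀ (((i , j) , (v , w)) : (Fin k × Fin k) × (Fin N × Fin N)) φ → Dec (Copy U φ × v ≡ lookup φ i × w ≡ lookup φ j)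
      through? ((i , j) , (v , w)) φ = copy? U? φ ×-dec (v Fin.≟ lookup φ i) ×-dec (w Fin.≟ lookup φ j)

      places = cartesianProduct kks vvs

      crossing : ℕ
      crossing = ∑ places (λ x → ⟦ crossing? x ⟧ * # (through? x))

      ∑-E≤2 : ∀ v w → ∑ kks (λ (i , j) → ⟦ E? v w i j ⟧) ≤ 2
      ∑-E≤2 v w with Fin.any? (λ i → Fin.any? (λ j → E? v w i j))
      ... | no none = ≤-trans (∑-mono kks (λ (i , j) → ⟦⟧≤ {n = 0} (E? v w i j) (λ e → contradiction (i , j , e) none)))
                              (≤-trans (≤-reflexive (trans (∑-const 0 kks) (*-zeroʳ (length kks)))) z≤n)
      ... | yes (a , b , eab) = begin
        ∑ kks (λ (i , j) → ⟦ E? v w i j ⟧)                        ≤⟨ ∑-mono kks two ⟩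
        ∑ kks (λ ij → one a b ij + one b a ij)                    ≡⟨ ∑-+ (one a b) (one b a) kks ⟩
        ∑ kks (one a b) + ∑ kks (one b a)                         ≡⟨ cong₂ _+_ (∑-one a b) (∑-one b a) ⟩
        2                                                         ∎
        where
        one : Fin k → Fin k → Fin k × Fin k → ℕ
        one a b (i , j) = ⟦ a Fin.≟ i ⟧ * (⟦ b Fin.≟ j ⟧ * 1)
        ∑-one : ∀ a b → ∑ kks (one a b) ≡ 1
        ∑-one a b = trans (∑-pairs (one a b) ks ks)
          (trans (∑-cong ks (λ i → trans (∑-*ˡ ⟦ a Fin.≟ i ⟧ (λ j → ⟦ b Fin.≟ j ⟧ * 1) ks) (cong (⟦ a Fin.≟ i ⟧ *_) (∑-δ b (λ _ → 1)))))
                 (∑-δ a (λ _ → 1)))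
        one≡1 : ∀ {a b i j} → a ≡ i → b ≡ j → 1 ≤ one a b (i , j)
        one≡1 {a} {b} refl refl = ≤-reflexive (sym (cong₂ (λ x y → x * (y * 1)) (⟦⟧≡1 (a Fin.≟ a) refl) (⟦⟧≡1 (b Fin.≟ b) refl)))
        two : ∀ ((i , j) : Fin k × Fin k) → ⟦ E? v w i j ⟧ ≤ one a b (i , j) + one b a (i , j)
        two (i , j) = ⟦⟧≤ (E? v w i j) (λ e → cases (E-unique eab e))
          where
          cases : (a ≡ i × b ≡ j) ⊎ (a ≡ j × b ≡ i) → 1 ≤ one a b (i , j) + one b a (i , j)
          cases (inj₁ (a≡i , b≡j)) = ≤-trans (one≡1 a≡i b≡j) (m≤m+n _ _)
          cases (inj₂ (a≡j , b≡i)) = ≤-trans (one≡1 b≡i a≡j) (m≤n+m _ _)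

      -- The colour `ij` avoids the role `ρ v`, so it is not the colour prescribed between the parts
      -- of `v` and `w`, and the pair is bad. As a pair has only one colour, it arises from at most
      -- two ordered pairs `ij`.
      ∑-crossing : ∑ places (λ x → ⟦ crossing? x ⟧) ≤ 2 * bad
      ∑-crossing = begin
        ∑ places (λ x → ⟦ crossing? x ⟧)                          ≡⟨ ∑-pairs (λ x → ⟦ crossing? x ⟧) kks vvs ⟩
        ∑ kks (λ ij → ∑ vvs (λ vw → ⟦ crossing? (ij , vw) ⟧))     ≡⟨ ∑-swap (λ ij vw → ⟦ crossing? (ij , vw) ⟧) kks vvs ⟩
        ∑ vvs (λ vw → ∑ kks (λ ij → ⟦ crossing? (ij , vw) ⟧))     ≤⟨ ∑-mono vvs at ⟩
        ∑ vvs (λ vw → 2 * ∑ kks (λ ab → ⟦ bad? ab vw ⟧))          ≡⟨ ∑-*ˡ 2 (λ vw → ∑ kks (λ ab → ⟦ bad? ab vw ⟧)) vvs ⟩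
        2 * ∑ vvs (λ vw → ∑ kks (λ ab → ⟦ bad? ab vw ⟧))          ≡⟨ cong (2 *_) (∑-swap (λ vw ab → ⟦ bad? ab vw ⟧) vvs kks) ⟩
        2 * bad                                                   ∎
        where
        at : ∀ ((v , w) : Fin N × Fin N) → ∑ kks (λ ij → ⟦ crossing? (ij , (v , w)) ⟧) ≤ 2 * ∑ kks (λ ab → ⟦ bad? ab (v , w) ⟧)
        at (v , w) = begin
          ∑ kks (λ ij → ⟦ crossing? (ij , (v , w)) ⟧)             ≤⟨ ∑-mono kks (λ ij → ⟦⟧≤ (crossing? (ij , (v , w))) (is-bad ij)) ⟩
          ∑ kks (λ (i , j) → ⟦ E? v w i j ⟧ * ⟦ bad? ab (v , w) ⟧) ≡⟨ ∑-*ʳ ⟦ bad? ab (v , w) ⟧ (λ (i , j) → ⟦ E? v w i j ⟧) kks ⟩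
          ∑ kks (λ (i , j) → ⟦ E? v w i j ⟧) * ⟦ bad? ab (v , w) ⟧ ≤⟨ *-mono-≤ (∑-E≤2 v w) (term≤∑ (λ ab → ⟦ bad? ab (v , w) ⟧) (∈-cartesianProduct⁺ (∈-fins (ρ v)) (∈-fins (ρ w)))) ⟩
          2 * ∑ kks (λ ab → ⟦ bad? ab (v , w) ⟧)                  ∎
          where
          ab = ρ v , ρ w
          is-bad : ∀ ((i , j) : Fin k × Fin k) → (U v × ρ v ≢ i × j ≢ i × j ≢ ρ v) × (U w × ρ w ≢ ρ v) × E v w i j →
                   1 ≤ ⟦ E? v w i j ⟧ * ⟦ bad? ab (v , w) ⟧
          is-bad (i , j) ((uv , ρv≢i , j≢i , j≢ρv) , (uw , ρw≢ρv) , e) =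
            ≤-reflexive (sym (cong₂ _*_ (⟦⟧≡1 (E? v w i j) e)
              (⟦⟧≡1 (bad? ab (v , w)) (≢-sym ρw≢ρv , (uv , refl) , (uw , refl) , λ e′ → clash (E-unique e e′)))))
            where
            clash : ¬ ((i ≡ ρ v × j ≡ ρ w) ⊎ (i ≡ ρ w × j ≡ ρ v))
            clash (inj₁ (i≡ρv , _)) = ρv≢i (sym i≡ρv)
            clash (inj₂ (_ , j≡ρv)) = j≢ρv j≡ρv

      crossing-small : rare-constant * crossing ≤ 2 * bad * (n * n ^ l)
      crossing-small = begin
        rare-constant * crossing                                                ≡⟨ sym (∑-*ˡ rare-constant _ places) ⟩
        ∑ places (λ x → rare-constant * (⟦ crossing? x ⟧ * # (through? x)))     ≤⟨ ∑-mono places at ⟩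
        ∑ places (λ x → ⟦ crossing? x ⟧ * (n * n ^ l))                          ≡⟨ ∑-*ʳ (n * n ^ l) (λ x → ⟦ crossing? x ⟧) places ⟩
        ∑ places (λ x → ⟦ crossing? x ⟧) * (n * n ^ l)                          ≤⟨ *-monoˡ-≤ (n * n ^ l) ∑-crossing ⟩
        2 * bad * (n * n ^ l)                                                   ∎
        where
        e : ∀ c i d → c * (i * d) ≡ i * (c * d)
        e = solve-∀
        at : ∀ x → rare-constant * (⟦ crossing? x ⟧ * # (through? x)) ≤ ⟦ crossing? x ⟧ * (n * n ^ l)
        at x@((i , j) , (v , w)) = ≤-trans (≤-reflexive (e rare-constant ⟦ crossing? x ⟧ (# (through? x))))
          (⟦⟧*≤ (crossing? x) λ ((uv , ρv≢i , j≢i , j≢ρv) , _) → ≤-trans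
            (rare v (dominant-at uv) (≢-sym ρv≢i) j≢i j≢ρv (w Fin.≟_))
            (≤-reflexive (trans (cong (n * n ^ l *_) (card-singleton w)) (*-identityʳ _))))

      -- The loss `bad * Π / (k * k * (n * n))` from `missing-total` pays for all crossing copies,
      -- because each bad pair lies in few of them by `rare` and `Π` is large.
      good+crossing≤Π : good + crossing ≤ Π
      good+crossing≤Π = *-cancelˡ-≤ (k * k * (n * n)) {{m*n≢0 (k * k) (n * n) {{_}} {{m*n≢0 n n}}}} (begin
        k * k * (n * n) * (good + crossing)                            ≡⟨ e₁ (k * k) (n * n) good crossing ⟩
        k * k * (n * n * good) + k * k * (n * n) * crossing            ≤⟨ +-monoʳ-≤ (k * k * (n * n * good)) crossing≤ ⟩
        k * k * (n * n * good) + bad * Π                               ≤⟨ missing-total ⟩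
        k * k * (n * n * Π)                                            ≡⟨ sym (*-assoc (k * k) (n * n) Π) ⟩
        k * k * (n * n) * Π                                            ∎)
        where
        e₁ : ∀ k n g c → k * n * (g + c) ≡ k * (n * g) + k * n * c
        e₁ = solve-∀
        crossing≤ : k * k * (n * n) * crossing ≤ bad * Π
        crossing≤ = *-cancelˡ-≤ (2 * (k ^ k)) {{m*n≢0 2 (k ^ k)}} (*-cancelˡ-≤ 2 (begin
          2 * (2 * (k ^ k) * (k * k * (n * n) * crossing))   ≡⟨ e₂ k (k ^ k) n crossing ⟩
          n * n * (rare-constant * crossing)                 ≤⟨ *-monoʳ-≤ (n * n) crossing-small ⟩
          n * n * (2 * bad * (n * n ^ l))                    ≡⟨ e₃ n bad (n ^ l) ⟩
          2 * (bad * n ^ k)                                  ≤⟨ *-monoʳ-≤ 2 (*-monoʳ-≤ bad Π-large) ⟩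
          2 * (bad * (2 * (k ^ k * Π)))                      ≡⟨ e₄ bad (k ^ k) Π ⟩
          2 * (2 * (k ^ k) * (bad * Π))                      ∎))
          where
          e₂ : ∀ k x n c → 2 * (2 * x * (k * k * (n * n) * c)) ≡ n * n * (4 * (k * k * x) * c)
          e₂ = solve-∀
          e₃ : ∀ n b x → n * n * (2 * b * (n * x)) ≡ 2 * (b * (n * (n * (n * x))))
          e₃ = solve-∀
          e₄ : ∀ b x P → 2 * (b * (2 * (x * P))) ≡ 2 * (2 * x * (b * P))
          e₄ = solve-∀

      total≤Π+inner : total ≤ Π + ∑ ks (λ a → # (copy? (part? a)))
      total≤Π+inner = begin
        total                                           ≤⟨ ∑-mono (words vs k) (λ φ → ⟦⟧≤ (copy? U? φ) (pointwise φ)) ⟩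
        ∑ (words vs k) (λ φ → ⟦ good? φ ⟧ + X φ + Y φ)
          ≡⟨ trans (∑-+ (λ φ → ⟦ good? φ ⟧ + X φ) Y (words vs k)) (cong₂ _+_ (∑-+ (λ φ → ⟦ good? φ ⟧) X (words vs k)) (∑-swap (λ φ a → ⟦ copy? (part? a) φ ⟧) (words vs k) ks)) ⟩
        good + ∑ (words vs k) X + inner              ≡⟨ cong (λ z → good + z + inner) (∑-# places (λ x → ⟦ crossing? x ⟧) through?) ⟩
        good + crossing + inner                      ≤⟨ +-monoˡ-≤ inner good+crossing≤Π ⟩
        Π + inner                                    ∎
        where
        inner = ∑ ks (λ a → # (copy? (part? a)))
        X Y : Vec (Fin N) k → ℕ
        X φ = ∑ places (λ x → ⟦ crossing? x ⟧ * ⟦ through? x φ ⟧)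
        Y φ = ∑ ks (λ a → ⟦ copy? (part? a) φ ⟧)
        pointwise : ∀ φ → Copy U φ → 1 ≤ ⟦ good? φ ⟧ + X φ + Y φ
        pointwise φ copy@(inU , hom) with classify (λ i → ρ (lookup φ i))
        ... | inj₁ fixed = ≤-trans (≤-reflexive (sym (⟦⟧≡1 (good? φ) (copy , fixed)))) (≤-trans (m≤m+n _ (X φ)) (m≤m+n _ (Y φ)))
        ... | inj₂ (inj₁ (a , const)) = ≤-trans
          (≤-trans (≤-reflexive (sym (⟦⟧≡1 (copy? (part? a) φ) ((λ i → inU i , const i) , hom)))) (term≤∑ (λ a → ⟦ copy? (part? a) φ ⟧) (∈-fins a)))
          (m≤n+m (Y φ) (⟦ good? φ ⟧ + X φ))
        ... | inj₂ (inj₂ (i , j , ρi≢i , j≢i , j≢ρi , ρj≢ρi)) = ≤-trans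
          (covered (λ x → ⟦ crossing? x ⟧) (λ x → ⟦ through? x φ ⟧) (crossing? x) (through? x φ) refl refl
            (∈-cartesianProduct⁺ (∈-cartesianProduct⁺ (∈-fins i) (∈-fins j)) (∈-cartesianProduct⁺ (∈-fins (lookup φ i)) (∈-fins (lookup φ j))))
            ((inU i , ρi≢i , j≢i , j≢ρi) , (inU j , ρj≢ρi) , hom i j (≢-sym j≢i)) (copy , refl , refl))
          (≤-trans (m≤n+m (X φ) ⟦ good? φ ⟧) (m≤m+n _ (Y φ)))
          where
          x = (i , j) , (lookup φ i , lookup φ j)

      -- `Π-large` makes every part non-empty, so no part is all of `U` and the induction can
      -- descend.
      size<n : ∀ a → size a < n
      size<n a with third-role {a} {other a} (other≢ a)
        where
        other : Fin k → Fin k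
        other zero    = suc zero
        other (suc _) = zero
        other≢ : ∀ a → a ≢ other a
        other≢ zero    ()
        other≢ (suc _) ()
      ... | b , b≢a , _ = begin-strict
        size a                          ≡⟨ sym (+-identityʳ (size a)) ⟩
        size a + 0                      <⟨ +-monoʳ-< (size a) size-b>0 ⟩
        size a + size b                 ≤⟨ +-monoʳ-≤ (size a) (term≤∑ size (∈-others (≢-sym b≢a))) ⟩
        size a + ∑ (others a) size      ≡⟨ trans (sym (∑-↭ size (ks↭ a))) ∑-size ⟩
        n                               ∎
        where
        size-b>0 : size b > 0
        size-b>0 = n≢0⇒n>0 (λ size-b≡0 → contradiction
          (≤-trans Π-large (≤-reflexive (trans (cong (λ z → 2 * (k ^ k * z)) (trans (∏-↭ size (ks↭ b)) (cong (_* ∏ (others b) size) size-b≡0))) (trans (cong (2 *_) (*-zeroʳ (k ^ k))) refl))))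
          (<⇒≱ (m^n>0 n k)))

  -- The induction runs over subsets of one fixed `Fin N`, so that neither deleting a vertex nor
  -- passing to a part needs a relabelling.
  copies-bound : ∀ (U : Fin N → Set) (U? : ∀ v → Dec (U v)) → Acc _<_ (card U?) → K * # (copy? U?) < suc (card U?) ^ k
  copies-bound U U? (acc rec) with card U? ≟ 0
  ... | yes n≡0 = begin-strict
    K * # (copy? U?)        ≤⟨ *-monoʳ-≤ K (box-bound (copy? U?) (λ _ → U?) (λ φ → proj₁)) ⟩
    K * ∏ ks (λ _ → card U?) ≡⟨ cong (K *_) (trans (∏-const (card U?) ks) (cong₂ _^_ n≡0 (length-fins k))) ⟩
    K * 0                   ≡⟨ *-zeroʳ K ⟩
    0                       <⟨ m^n>0 (suc (card U?)) k ⟩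
    suc (card U?) ^ k       ∎
    where open ≤-Reasoning
  -- The test is exactly what makes deletion of `v` preserve the bound: the induction hypothesis for
  -- the remaining set is a bound by `n ^ k`.
  ... | no n≢0 with Fin.any? (λ v → U? v ×-dec (K * ∑ ks (λ i → Within.deg U U? i v) + card U? ^ k ≤? suc (card U?) ^ k))
  ...   | yes (v , uv , low) = begin-strict
    K * # (copy? U?)                                      ≤⟨ *-monoʳ-≤ K delete ⟩
    K * (# (copy? U′?) + ∑ ks (λ i → deg i v))            ≡⟨ *-distribˡ-+ K (# (copy? U′?)) _ ⟩
    K * # (copy? U′?) + K * ∑ ks (λ i → deg i v)          <⟨ +-monoˡ-< (K * ∑ ks (λ i → deg i v)) (copies-bound U′ U′? (rec (≤-reflexive (sym card-U)))) ⟩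
    suc (card U′?) ^ k + K * ∑ ks (λ i → deg i v)         ≡⟨ trans (cong (λ z → z ^ k + K * ∑ ks (λ i → deg i v)) (sym card-U)) (+-comm (card U? ^ k) _) ⟩
    K * ∑ ks (λ i → deg i v) + card U? ^ k                ≤⟨ low ⟩
    suc (card U?) ^ k                                     ∎
    where
    open ≤-Reasoning
    deg : Fin k → Fin N → ℕ
    deg = Within.deg U U?
    U′ : Fin N → Set
    U′ w = U w × v ≢ w
    U′? : ∀ w → Dec (U′ w)
    U′? w = U? w ×-dec ¬? (v Fin.≟ w)
    card-U : card U? ≡ suc (card U′?)
    card-U = trans (∑-cong vs split) (trans (∑-+ (λ w → ⟦ v Fin.≟ w ⟧) (λ w → ⟦ U′? w ⟧) vs) (cong (_+ card U′?) (card-singleton v)))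
      where
      split : ∀ w → ⟦ U? w ⟧ ≡ ⟦ v Fin.≟ w ⟧ + ⟦ U′? w ⟧
      split w with v Fin.≟ w | U? w
      ... | yes refl | yes _  = refl
      ... | yes refl | no ¬uv = contradiction uv ¬uv
      ... | no _     | yes _  = refl
      ... | no _     | no _   = refl
    delete : # (copy? U?) ≤ # (copy? U′?) + ∑ ks (λ i → deg i v)
    delete = begin
      # (copy? U?)                                                      ≤⟨ ∑-mono (words vs k) (λ φ → ⟦⟧≤ (copy? U? φ) (pointwise φ)) ⟩
      ∑ (words vs k) (λ φ → ⟦ copy? U′? φ ⟧ + ∑ ks (λ i → ⟦ at? i φ ⟧)) ≡⟨ ∑-+ (λ φ → ⟦ copy? U′? φ ⟧) _ (words vs k) ⟩
      # (copy? U′?) + ∑ (words vs k) (λ φ → ∑ ks (λ i → ⟦ at? i φ ⟧))   ≡⟨ cong (# (copy? U′?) +_) (∑-swap (λ φ i → ⟦ at? i φ ⟧) (words vs k) ks) ⟩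
      # (copy? U′?) + ∑ ks (λ i → deg i v)                              ∎
      where
      at? : ∀ i φ → Dec (Copy U φ × v ≡ lookup φ i)
      at? i φ = copy? U? φ ×-dec (v Fin.≟ lookup φ i)
      pointwise : ∀ φ → Copy U φ → 1 ≤ ⟦ copy? U′? φ ⟧ + ∑ ks (λ i → ⟦ at? i φ ⟧)
      pointwise φ copy@(inU , hom) with Fin.any? (λ i → v Fin.≟ lookup φ i)
      ... | yes (i , v≡) = ≤-trans (≤-trans (≤-reflexive (sym (⟦⟧≡1 (at? i φ) (copy , v≡)))) (term≤∑ (λ i → ⟦ at? i φ ⟧) (∈-fins i))) (m≤n+m _ ⟦ copy? U′? φ ⟧)
      ... | no avoid     = ≤-trans (≤-reflexive (sym (⟦⟧≡1 (copy? U′? φ) ((λ i → inU i , λ v≡ → avoid (i , v≡)) , hom)))) (m≤m+n _ _)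
  ...   | no none = begin-strict
    K * # (copy? U?)                                       ≤⟨ *-monoʳ-≤ K (Within.LargeDegrees.total≤Π+inner U U? n>0 large) ⟩
    K * (Π + ∑ ks (λ a → # (copy? (part? a))))             ≡⟨ trans (*-distribˡ-+ K Π _) (cong (K * Π +_) (sym (∑-*ˡ K (λ a → # (copy? (part? a))) ks))) ⟩
    K * Π + ∑ ks (λ a → K * # (copy? (part? a)))           ≤⟨ +-monoʳ-≤ (K * Π) (∑-mono ks by-induction) ⟩
    K * Π + ∑ ks (λ a → size a ^ k + lower-terms m (size a)) ≡⟨ trans (cong (K * Π +_) (∑-+ (λ a → size a ^ k) (λ a → lower-terms m (size a)) ks)) (sym (+-assoc (K * Π) _ _)) ⟩
    K * Π + ∑ ks (λ a → size a ^ k) + ∑ ks (λ a → lower-terms m (size a))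
      -- The leading terms recombine by AM-GM over mixed words, the errors by superadditivity.
      ≤⟨ +-mono-≤ (mixed-words m size) (∑-superadditive (lower-terms m) (lower-terms-superadditive m) (lower-terms-0 m) size ks) ⟩
    ∑ ks size ^ k + lower-terms m (∑ ks size)              ≡⟨ cong (λ z → z ^ k + lower-terms m z) (Within.∑-size U U?) ⟩
    n ^ k + lower-terms m n                                ≡⟨ sym (shift-power-split m n) ⟩
    shift-power m n                                        <⟨ ≤-reflexive (shift-power-spec m n) ⟩
    suc n ^ k                                              ∎
    where
    open ≤-Reasoning
    n Π : ℕ
    n = card U?
    Π = Within.Π U U?
    deg : Fin k → Fin N → ℕ
    deg = Within.deg U U?
    size : Fin k → ℕ
    size = Within.size U U?
    part? : ∀ a v → Dec (U v × Within.ρ U U? v ≡ a)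
    part? = Within.part? U U?
    n>0 : n > 0
    n>0 = n≢0⇒n>0 n≢0
    -- An undeletable `v` has `K * deg > (n + 1) ^ k - n ^ k ≥ k * n ^
    -- m`, where `deg` is summed over the roles, and `K ≤ k * k ^ m`.
    large : ∀ v → U v → n ^ m < k ^ m * ∑ ks (λ i → deg i v)
    large v uv = *-cancelˡ-< k _ _ (+-cancelʳ-< (n ^ k) _ _ (begin-strict
      k * n ^ m + n ^ k                             ≡⟨ +-comm (k * n ^ m) (n ^ k) ⟩
      n ^ k + k * n ^ m                             ≤⟨ bernoulli n m ⟩
      suc n ^ k                                     <⟨ ≰⇒> (λ low → none (v , uv , low)) ⟩
      K * ∑ ks (λ i → deg i v) + n ^ k              ≤⟨ +-monoˡ-≤ (n ^ k) (≤-trans (*-monoˡ-≤ _ (m∸n≤m (k ^ k) k)) (≤-reflexive (*-assoc k (k ^ m) _))) ⟩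
      k * (k ^ m * ∑ ks (λ i → deg i v)) + n ^ k    ∎))
    -- By integrality the strict bound gives up 1, which removes the constant term of the error.
    by-induction : ∀ a → K * # (copy? (part? a)) ≤ size a ^ k + lower-terms m (size a)
    by-induction a = ≤-pred (≤-trans (copies-bound _ (part? a) (rec (Within.LargeDegrees.size<n U U? n>0 large a)))
      (≤-reflexive (trans (sym (shift-power-spec m (size a))) (cong suc (shift-power-split m (size a))))))

  homs-bound : ∀ {ψs} → Unique ψs → (∀ {ψ} → ψ ∈ ψs → Hom ψ) → K * length ψs < suc N ^ k
  homs-bound {ψs} ψs! hom = begin-strict
    K * length ψs            ≤⟨ *-monoʳ-≤ K (length≤ (extend-to ψs! (λ {ψ} _ → ∈-boxes⁺ {m = k} (λ _ → vs) ψ (λ i → ∈-fins (lookup ψ i))))) ⟩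
    K * # (copy? all?)       <⟨ copies-bound (λ _ → ⊤) all? (<-wellFounded _) ⟩
    suc (card all?) ^ k      ≡⟨ cong (λ z → suc z ^ k) (trans (sym (length≡∑1 vs)) (length-fins N)) ⟩
    suc N ^ k                ∎
    where
    open ≤-Reasoning
    all? : (v : Fin N) → Dec ⊤
    all? _ = yes tt
    copy : Vec (Fin N) k → ℕ
    copy ψ = ⟦ copy? all? ψ ⟧
    length≤ : (∃ λ ys → words vs k ↭ ψs ++ ys) → length ψs ≤ # (copy? all?)
    length≤ (ys , words↭) = begin
      length ψs              ≡⟨ length≡∑1 ψs ⟩
      ∑ ψs (λ _ → 1)         ≤⟨ ∑-mono-∈ ψs (λ {ψ} ψ∈ → ≤-reflexive (sym (⟦⟧≡1 (copy? all? ψ) ((λ _ → tt) , hom ψ∈)))) ⟩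
      ∑ ψs copy              ≤⟨ m≤m+n (∑ ψs copy) (∑ ys copy) ⟩
      ∑ ψs copy + ∑ ys copy  ≡⟨ sym (trans (∑-↭ copy words↭) (∑-++ ψs ys copy)) ⟩
      # (copy? all?)         ∎

-- Auxiliary facts on roles, words and subsets

two-others : ∀ {l} (i : Fin (3 + l)) → ∃₂ λ j j′ → i ≢ j × i ≢ j′ × j ≢ j′
two-others zero          = suc zero , suc (suc zero) , (λ ()) , (λ ()) , (λ ())
two-others (suc zero)    = zero , suc (suc zero) , (λ ()) , (λ ()) , (λ ())
two-others (suc (suc i)) = zero , suc zero , (λ ()) , (λ ()) , (λ ())

lookup-ext : ∀ {A : Set} {n} {φ ψ : Vec A n} → (∀ i → lookup φ i ≡ lookup ψ i) → φ ≡ ψ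
lookup-ext {φ = φ} {ψ} eq = trans (sym (Vec.tabulate∘lookup φ)) (trans (Vec.tabulate-cong eq) (Vec.tabulate∘lookup ψ))

⊆-ext : ∀ {n} {S S′ : Subset n} → (∀ v → v ∈ₛ S → v ∈ₛ S′) → (∀ v → v ∈ₛ S′ → v ∈ₛ S) → S ≡ S′
⊆-ext {S = S} {S′} S⊆S′ S′⊆S = lookup-ext (λ v → same v (lookup S v) (lookup S′ v) refl refl)
  where
  same : ∀ v a b → lookup S v ≡ a → lookup S′ v ≡ b → lookup S v ≡ lookup S′ v
  same v true  b     e e′ = trans e (sym (Vec.[]=⇒lookup (S⊆S′ v (Vec.lookup⇒[]= v S e))))
  same v false true  e e′ = trans (Vec.[]=⇒lookup (S′⊆S v (Vec.lookup⇒[]= v S′ e′))) (sym e′)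
  same v false false e e′ = trans e (sym e′)

length-concat-map : ∀ {A B : Set} (f : A → List B) xs → length (concat (map f xs)) ≡ ∑ xs (length ∘ f)
length-concat-map f []       = refl
length-concat-map f (x ∷ xs) = trans (length-++ (f x)) (cong (length (f x) +_) (length-concat-map f xs))

Unique-map-∈ : ∀ {A B : Set} (f : A → B) {xs} → Unique xs → (∀ {x y} → x ∈ xs → y ∈ xs → f x ≡ f y → x ≡ y) → Unique (map f xs)
Unique-map-∈ f []          inj = []
Unique-map-∈ f (x∉ ∷ xs!) inj =
  All.map⁺ (All.tabulate (λ y∈ fx≡fy → All.lookup x∉ y∈ (inj (here refl) (there y∈) fx≡fy)))
  ∷ Unique-map-∈ f xs! (λ x∈ y∈ → inj (there x∈) (there y∈))

-- Densities and limits

nC0≡1 : ∀ n → n C 0 ≡ 1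
nC0≡1 n = trans (nCk≡nC[n∸k] {k = 0} {n = n} z≤n) (nCn≡1 n)

factorial-C : ∀ n k → suc k ! * (suc n C suc k) ≡ suc k * (k ! * (n C k)) + suc k ! * (n C suc k)
factorial-C n k = trans (cong (suc k ! *_) (sym (nCk+nC[k+1]≡[n+1]C[k+1] n k))) (e k (k !) (n C k) (n C suc k))
  where
  e : ∀ k f a b → suc k * f * (a + b) ≡ suc k * (f * a) + suc k * f * b
  e = solve-∀

k!*nCk≤n^k : ∀ n k → k ! * (n C k) ≤ n ^ k
k!*nCk≤n^k n       zero    = ≤-reflexive (cong (1 *_) (nC0≡1 n))
k!*nCk≤n^k zero    (suc k) = ≤-trans (≤-reflexive (trans (cong (suc k ! *_) (k>n⇒nCk≡0 {0} {suc k} (s≤s z≤n))) (*-zeroʳ (suc k !)))) z≤n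
k!*nCk≤n^k (suc n) (suc k) = begin
  suc k ! * (suc n C suc k)                             ≡⟨ factorial-C n k ⟩
  suc k * (k ! * (n C k)) + suc k ! * (n C suc k)       ≤⟨ +-mono-≤ (*-monoʳ-≤ (suc k) (k!*nCk≤n^k n k)) (k!*nCk≤n^k n (suc k)) ⟩
  suc k * n ^ k + n ^ suc k                             ≡⟨ +-comm (suc k * n ^ k) _ ⟩
  n ^ suc k + suc k * n ^ k                             ≤⟨ bernoulli n k ⟩
  suc n ^ suc k                                         ∎
  where open ≤-Reasoning

-- The right side is the product of `y + 1` up to `y + k`. With the previous lemma it places
-- `k ! * (n C k)` between `(n - k) ^ k` and `n ^ k`.
y^k≤k!*[y+k]Ck : ∀ y k → y ^ k ≤ k ! * ((y + k) C k)
y^k≤k!*[y+k]Ck y       zero    = ≤-reflexive (sym (cong (1 *_) (nC0≡1 (y + 0))))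
y^k≤k!*[y+k]Ck zero    (suc k) = z≤n
y^k≤k!*[y+k]Ck (suc y) (suc k) = begin
  suc y ^ suc k                                                     ≤⟨ ^-growth 1 (≤-reflexive (sym (+-comm y 1))) k ⟩
  y ^ suc k + suc k * 1 * suc y ^ k                                 ≡⟨ e (y ^ suc k) (suc k) (suc y ^ k) ⟩
  suc k * suc y ^ k + y ^ suc k                                     ≤⟨ +-mono-≤ (*-monoʳ-≤ (suc k) (y^k≤k!*[y+k]Ck (suc y) k)) (y^k≤k!*[y+k]Ck y (suc k)) ⟩
  suc k * (k ! * ((suc y + k) C k)) + suc k ! * ((y + suc k) C suc k) ≡⟨ cong (λ z → suc k * (k ! * (z C k)) + suc k ! * ((y + suc k) C suc k)) (sym (+-suc y k)) ⟩
  suc k * (k ! * ((y + suc k) C k)) + suc k ! * ((y + suc k) C suc k) ≡⟨ sym (factorial-C (y + suc k) k) ⟩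
  suc k ! * ((suc y + suc k) C suc k)                               ∎
  where
  open ≤-Reasoning
  e : ∀ a b c → a + b * 1 * c ≡ b * c + a
  e = solve-∀

toℚᵘ-divℕ : ∀ a c → toℚᵘ (divℕ a (suc c)) ℚᵘ.≃ mkℚᵘ (pos a) c
toℚᵘ-divℕ a c = ℚ.toℚᵘ-fromℚᵘ (mkℚᵘ (pos a) c)

divℕ-<-+ : ∀ a c b K e d .{{_ : NonZero c}} .{{_ : NonZero K}}  .(cop : Coprime e (suc d)) → a * (K * suc d) < (b * suc d + e * K) * c →
           divℕ a c <ℚ divℕ b K +ℚ mkℚ (pos e) d cop
divℕ-<-+ a (suc c) b (suc K) e d cop a<b = ℚ.toℚᵘ-cancel-< (ℚᵘ.<-respˡ-≃ (ℚᵘ.≃-sym (toℚᵘ-divℕ a c))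
  (ℚᵘ.<-respʳ-≃ (ℚᵘ.≃-sym (ℚᵘ.≃-trans (ℚ.toℚᵘ-homo-+ (divℕ b (suc K)) (mkℚ (pos e) d cop)) (ℚᵘ.+-congˡ (mkℚᵘ (pos e) d) (toℚᵘ-divℕ b K))))
    (ℚᵘ.*<* (subst₂ ℤ._<_ lhs rhs (ℤ.+<+ a<b)))))
  where
  lhs : pos (a * (suc K * suc d)) ≡ pos a ℤ.* pos (suc K * suc d)
  lhs = ℤ.pos-* a (suc K * suc d)
  rhs : pos ((b * suc d + e * suc K) * suc c) ≡ (pos b ℤ.* pos (suc d) ℤ.+ pos e ℤ.* pos (suc K)) ℤ.* pos (suc c)
  rhs = trans (ℤ.pos-* (b * suc d + e * suc K) (suc c)) (cong (ℤ._* pos (suc c))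
          (trans (ℤ.pos-+ (b * suc d) (e * suc K)) (cong₂ ℤ._+_ (ℤ.pos-* b (suc d)) (ℤ.pos-* e (suc K)))))

x<q+ε⇒x-q<ε : ∀ x q ε → x <ℚ q +ℚ ε → x -ℚ q <ℚ ε
x<q+ε⇒x-q<ε x q ε x<q+ε = subst (x -ℚ q <ℚ_) (xyx⁻¹≈y q ε) (ℚ.+-monoˡ-< (-ℚ q) x<q+ε)

∣x-q∣<ε : ∀ x q ε → x <ℚ q +ℚ ε → q <ℚ x +ℚ ε → ∣ x -ℚ q ∣ <ℚ ε
∣x-q∣<ε x q ε x<q+ε q<x+ε with ℚ.∣p∣≡p∨∣p∣≡-p (x -ℚ q)
... | inj₁ eq = subst (_<ℚ ε) (sym eq) (x<q+ε⇒x-q<ε x q ε x<q+ε)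
... | inj₂ eq = subst (_<ℚ ε) (sym (trans eq (⁻¹-anti-homo‿- x q))) (x<q+ε⇒x-q<ε q x ε q<x+ε)

-- The error `D / (K * B)` is at most `1 / suc d` and hence at most the given tolerance. Two counts
-- occur because `x` is attained by an unknown graph, bounded from above, while the lower bound
-- comes from an explicit one.
density-close : ∀ e d .(cop : Coprime (suc e) (suc d)) F K B c c′ D .{{_ : NonZero K}} .{{_ : NonZero B}} →
  K * c < F * B + D → F * B < K * c′ + D → suc d * D ≤ K * B → ∀ x → divℕ c B ≡ x → divℕ c′ B ≤ℚ x →
  ∣ x -ℚ divℕ F K ∣ <ℚ mkℚ (pos (suc e)) d cop
density-close e d cop F K B c c′ D Kc<FB+D FB<Kc′+D dD≤KB _ refl c′/B≤x = ∣x-q∣<ε (divℕ c B) (divℕ F K) ε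
  (divℕ-<-+ c B F K (suc e) d cop (subst₂ _<_ (e₁ K c (suc d)) (e₂ F B (suc d) (suc e) K) (error-small Kc<FB+D)))
  (ℚ.<-≤-trans (divℕ-<-+ F K c′ B (suc e) d cop (subst₂ _<_ (e₃ F B (suc d)) (e₄ K c′ (suc d) (suc e) B) (error-small FB<Kc′+D)))
    (ℚ.+-monoˡ-≤ ε c′/B≤x))
  where
  open ≤-Reasoning
  ε = mkℚ (pos (suc e)) d cop
  e₁ : ∀ K c d → K * c * d ≡ c * (K * d)
  e₁ = solve-∀
  e₂ : ∀ F B d e K → F * B * d + e * (K * B) ≡ (F * d + e * K) * B
  e₂ = solve-∀
  e₃ : ∀ F B d → F * B * d ≡ F * (B * d)
  e₃ = solve-∀
  e₄ : ∀ K c d e B → K * c * d + e * (K * B) ≡ (c * d + e * B) * K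
  e₄ = solve-∀
  error-small : ∀ {a b} → a < b + D → a * suc d < b * suc d + suc e * (K * B)
  error-small {a} {b} a<b+D = begin-strict
    a * suc d                          <⟨ *-monoˡ-< (suc d) a<b+D ⟩
    (b + D) * suc d                    ≡⟨ trans (*-distribʳ-+ (suc d) b D) (cong (b * suc d +_) (*-comm D (suc d))) ⟩
    b * suc d + suc d * D              ≤⟨ +-monoʳ-≤ (b * suc d) (≤-trans dD≤KB (m≤m+n (K * B) (e * (K * B)))) ⟩
    b * suc d + suc e * (K * B)        ∎

-- Copies of a rainbow clique

module RainbowClique (l : ℕ) (8≤l : 8 ≤ l) (T : Set) (R : ColGraph T (3 + l)) (rainbow : Rainbow R) where

  m k K : ℕ
  m = 2 + l
  k = suc m
  K = k ^ k ∸ k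

  ks = fins k

  -- A vertex set is the range of its embedding, so different sets yield different words and
  -- `homs-bound` applies.
  upper-bound : ∀ {n} (G : ColGraph T n) c → ICount R G c → K * c < suc n ^ k
  upper-bound {n} G c (L , L! , L⇔ , refl) = begin-strict
    K * length L                    ≡⟨ cong (K *_) (sym (length-reduce copies)) ⟩
    K * length Ws                   <⟨ UpperBound.homs-bound l 8≤l n E E? E-swap E-unique (reduce-unique copies L!)
                                         (λ ψ∈ i j i≢j → i≢j , lose ψ∈ (inj₁ (refl , refl))) ⟩
    suc n ^ k                       ∎
    where
    open ≤-Reasoning
    word : ∀ {S} → InducedCopy R G S → Vec (Fin n) k
    word (φ , _) = Vec.tabulate φ
    copies : All (InducedCopy R G) L
    copies = All.tabulate (λ {S} S∈ → Equivalence.to (L⇔ S) S∈)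
    Ws = All.reduce word copies
    length-reduce : ∀ {xs} (cs : All (InducedCopy R G) xs) → length (All.reduce word cs) ≡ length xs
    length-reduce []       = refl
    length-reduce (_ ∷ cs) = cong suc (length-reduce cs)
    word-injective : ∀ {S S′} (c : InducedCopy R G S) (c′ : InducedCopy R G S′) → word c ≡ word c′ → S ≡ S′
    word-injective (φ , _ , S⇔ , _) (φ′ , _ , S′⇔ , _) eq =
      ⊆-ext (λ v v∈ → transfer φ≗φ′ (S⇔ v) (S′⇔ v) v∈) (λ v v∈ → transfer (sym ∘ φ≗φ′) (S′⇔ v) (S⇔ v) v∈)
      where
      φ≗φ′ : ∀ i → φ i ≡ φ′ i
      φ≗φ′ i = trans (sym (Vec.lookup∘tabulate φ i)) (trans (cong (λ ψ → lookup ψ i) eq) (Vec.lookup∘tabulate φ′ i))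
      transfer : ∀ {S S′ : Subset n} {φ φ′ : Fin k → Fin n} → (∀ i → φ i ≡ φ′ i) → ∀ {v} →
                 (v ∈ₛ S) ⇔ (∃ λ i → φ i ≡ v) → (v ∈ₛ S′) ⇔ (∃ λ i → φ′ i ≡ v) → v ∈ₛ S → v ∈ₛ S′
      transfer eq S⇔ S′⇔ v∈ with Equivalence.to S⇔ v∈
      ... | i , φi≡v = Equivalence.from S′⇔ (i , trans (sym (eq i)) φi≡v)
    reduce-unique : ∀ {xs} (cs : All (InducedCopy R G) xs) → Unique xs → Unique (All.reduce word cs)
    reduce-unique []       []         = []
    reduce-unique (c ∷ cs) (x∉ ∷ xs!) = fresh x∉ cs ∷ reduce-unique cs xs!
      where
      fresh : ∀ {xs} → All (_ ≢_) xs → (cs : All (InducedCopy R G) xs) → All (word c ≢_) (All.reduce word cs)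
      fresh []        []        = []
      fresh (≢y ∷ x∉) (c′ ∷ cs) = (λ eq → ≢y (word-injective c c′ eq)) ∷ fresh x∉ cs
    Embeds : Vec (Fin n) k → Set
    Embeds ψ = ∀ i j → i ≢ j → col G (lookup ψ i) (lookup ψ j) ≡ col R i j
    embeds : All Embeds Ws
    embeds = go copies
      where
      go : ∀ {xs} (cs : All (InducedCopy R G) xs) → All Embeds (All.reduce word cs)
      go []                        = []
      go ((φ , _ , _ , emb) ∷ cs) =
        (λ i j i≢j → trans (cong₂ (col G) (Vec.lookup∘tabulate φ i) (Vec.lookup∘tabulate φ j)) (emb i j i≢j)) ∷ go cs
    -- T need not have decidable equality, so colours are read off the given copies.
    E : Fin n → Fin n → Fin k → Fin k → Set
    E v w i j = i ≢ j × Any (λ ψ → (lookup ψ i ≡ v × lookup ψ j ≡ w) ⊎ (lookup ψ j ≡ v × lookup ψ i ≡ w)) Ws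
    E? : ∀ v w i j → Dec (E v w i j)
    E? v w i j = ¬? (i Fin.≟ j) ×-dec Any.any? (λ ψ → (lookup ψ i Fin.≟ v ×-dec lookup ψ j Fin.≟ w) ⊎-dec (lookup ψ j Fin.≟ v ×-dec lookup ψ i Fin.≟ w)) Ws
    E-swap : ∀ {v w i j} → E v w i j → E v w j i
    E-swap (i≢j , any) = ≢-sym i≢j , Any.map Sum.swap any
    E-colour : ∀ {v w i j} → E v w i j → col G v w ≡ col R i j
    E-colour {i = i} {j} (i≢j , any) with find any
    ... | ψ , ψ∈ , inj₁ (refl , refl) = All.lookup embeds ψ∈ i j i≢j
    ... | ψ , ψ∈ , inj₂ (refl , refl) = trans (All.lookup embeds ψ∈ j i (≢-sym i≢j)) (col-sym R j i)
    E-unique : ∀ {v w i j i′ j′} → E v w i j → E v w i′ j′ → (i ≡ i′ × j ≡ j′) ⊎ (i ≡ j′ × j ≡ i′)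
    E-unique e e′ = rainbow _ _ _ _ (proj₁ e) (proj₁ e′) (trans (sym (E-colour e)) (E-colour e′))

  -- The iterated balanced blow-up

  Embedding : ∀ {n} → ColGraph T n → Vec (Fin n) k → Set
  Embedding G φ = (∀ {i j} → lookup φ i ≡ lookup φ j → i ≡ j) × (∀ i j → i ≢ j → col G (lookup φ i) (lookup φ j) ≡ col R i j)

  -- Transversals, and recursively the copies inside the parts; these already give the lower bound.
  embeddings : ∀ {n G} → Blowup R n G → List (Vec (Fin n) k)
  embeddings (small _ _)                            = []
  embeddings (big _ _ part size emb _ _ _ _ sub _) =
    boxes (λ i → map (emb i) (fins (size i))) ++ concat (map (λ i → map (Vec.map (emb i)) (embeddings (sub i))) ks)

  embeddings-sound : ∀ {n G} (b : Blowup R n G) {φ} → φ ∈ embeddings b → Embedding G φ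
  embeddings-sound (big G _ part size emb inj part-emb _ _ sub cross) {φ} φ∈
    with ∈-++⁻ (boxes (λ i → map (emb i) (fins (size i)))) φ∈
  ... | inj₁ φ∈box = (λ {i} {j} eq → trans (sym (part-φ i)) (trans (cong part eq) (part-φ j))) , colours
    where
    part-φ : ∀ i → part (lookup φ i) ≡ i
    part-φ i with ∈-map⁻ (emb i) (∈-boxes⁻ (λ i → map (emb i) (fins (size i))) φ∈box i)
    ... | a , _ , eq = trans (cong part eq) (part-emb i a)
    colours : ∀ i j → i ≢ j → col G (lookup φ i) (lookup φ j) ≡ col R i j
    colours i j i≢j = trans
      (cross _ _ (λ eq → i≢j (trans (sym (part-φ i)) (trans eq (part-φ j)))))
      (cong₂ (col R) (part-φ i) (part-φ j))
  ... | inj₂ φ∈sub with find (Any-map⁻ (∈-concat⁻ (map (λ i → map (Vec.map (emb i)) (embeddings (sub i))) ks) φ∈sub))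
  ...   | a , _ , φ∈a with ∈-map⁻ (Vec.map (emb a)) φ∈a
  ...     | ψ , ψ∈ , refl with embeddings-sound (sub a) ψ∈
  ...       | ψ-inj , ψ-col =
    (λ {i} {j} eq → ψ-inj (inj a (trans (sym (Vec.lookup-map i (emb a) ψ)) (trans eq (Vec.lookup-map j (emb a) ψ))))) ,
    (λ i j i≢j → trans (cong₂ (col G) (Vec.lookup-map i (emb a) ψ) (Vec.lookup-map j (emb a) ψ)) (ψ-col i j i≢j))

  -- Along a transversal `part` runs through all roles, along a nested copy it is constant;
  -- comparing two coordinates separates the lists.
  embeddings-unique : ∀ {n G} (b : Blowup R n G) → Unique (embeddings b)
  embeddings-unique (small _ _) = []
  embeddings-unique {n} (big G _ part size emb inj part-emb _ _ sub _) =
    Unique.++⁺ (boxes-unique transversal (λ i → Unique.map⁺ (inj i) (fins-unique (size i))))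
      (Unique.concat⁺ (All.map⁺ (All.tabulate (λ {i} _ → Unique.map⁺ (vec-map-injective (inj i)) (embeddings-unique (sub i)))))
                      (AllPairs.map⁺ (AllPairs.map disjoint-parts (fins-unique k))))
      (λ (φ∈box , φ∈sub) → disjoint φ∈box (find (Any-map⁻ (∈-concat⁻ (map nested ks) φ∈sub))))
    where
    transversal : Fin k → List (Fin n)
    transversal i = map (emb i) (fins (size i))
    nested : Fin k → List (Vec (Fin n) k)
    nested i = map (Vec.map (emb i)) (embeddings (sub i))
    vec-map-injective : ∀ {A B : Set} {f : A → B} → (∀ {x y} → f x ≡ f y → x ≡ y) → ∀ {j} {φ ψ : Vec A j} →
                        Vec.map f φ ≡ Vec.map f ψ → φ ≡ ψ
    vec-map-injective {f = f} f-inj {φ = φ} {ψ} eq = lookup-ext (λ i →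
      f-inj (trans (sym (Vec.lookup-map i f φ)) (trans (cong (λ χ → lookup χ i) eq) (Vec.lookup-map i f ψ))))
    part-nested : ∀ i {φ} → φ ∈ nested i → ∀ j → part (lookup φ j) ≡ i
    part-nested i φ∈ j with ∈-map⁻ (Vec.map (emb i)) φ∈
    ... | ψ , _ , refl = trans (cong part (Vec.lookup-map j (emb i) ψ)) (part-emb i (lookup ψ j))
    disjoint-parts : ∀ {i j} → i ≢ j → Disjoint (nested i) (nested j)
    disjoint-parts i≢j (φ∈i , φ∈j) = i≢j (trans (sym (part-nested _ φ∈i zero)) (part-nested _ φ∈j zero))
    disjoint : ∀ {φ} → φ ∈ boxes transversal → (∃ λ i → i ∈ ks × φ ∈ nested i) → ⊥
    disjoint {φ} φ∈box (i , _ , φ∈i) with trans (sym (part-φ zero)) (trans (trans (part-nested i φ∈i zero) (sym (part-nested i φ∈i (suc zero)))) (part-φ (suc zero)))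
      where
      part-φ : ∀ j → part (lookup φ j) ≡ j
      part-φ j with ∈-map⁻ (emb j) (∈-boxes⁻ transversal φ∈box j)
      ... | a , _ , eq = trans (cong part eq) (part-emb j a)
    ... | ()

  K+k≡k^k : K + k ≡ k ^ k
  K+k≡k^k = m∸n+n≡m (≤-trans (≤-reflexive (sym (*-identityʳ k))) (*-monoʳ-≤ k (m^n>0 k m)))

  -- Replacing `q` by `q ∸ k` inside `k` parts loses at most `k * z ^ m`. By Bernoulli this is no
  -- more than what is gained because `x` is at most `z`, one below `k * q`.
  recursion-step : ∀ x q → x < k * q → x ^ k ≤ K * q ^ k + k * (q ∸ k) ^ k
  recursion-step x zero     x<0  = contradiction (<-≤-trans x<0 (≤-reflexive (*-zeroʳ k))) λ ()
  recursion-step x q@(suc q′) x<kq = ≤-trans (^-monoˡ-≤ k (≤-pred x<kq)) (+-cancelʳ-≤ (k * z ^ m) _ _ (begin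
    z ^ k + k * z ^ m                          ≤⟨ bernoulli z m ⟩
    (k * q) ^ k                                ≡⟨ trans (^-distribʳ-* k q k) (cong (_* q ^ k) (sym K+k≡k^k)) ⟩
    (K + k) * q ^ k                            ≡⟨ *-distribʳ-+ (q ^ k) K k ⟩
    K * q ^ k + k * q ^ k                      ≤⟨ +-monoʳ-≤ (K * q ^ k) (*-monoʳ-≤ k (^-growth k q≤y+k m)) ⟩
    K * q ^ k + k * (y ^ k + k * k * q ^ m)    ≤⟨ +-monoʳ-≤ (K * q ^ k) (*-monoʳ-≤ k (+-monoʳ-≤ (y ^ k) kkq≤)) ⟩
    K * q ^ k + k * (y ^ k + z ^ m)            ≡⟨ e (K * q ^ k) k (y ^ k) (z ^ m) ⟩
    K * q ^ k + k * y ^ k + k * z ^ m          ∎))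
    where
    open ≤-Reasoning
    -- Chosen so that `suc z` is `k * q`.
    z = q′ + m * q
    y = q ∸ k
    e : ∀ a k b c → a + k * (b + c) ≡ a + k * b + k * c
    e = solve-∀
    q≤y+k : q ≤ y + k
    q≤y+k = ≤-trans (m≤n+m∸n q k) (≤-reflexive (+-comm k y))
    kk≤m^m : k * k ≤ m ^ m
    kk≤m^m = begin
      k * k                       ≤⟨ *-mono-≤ k≤2m k≤2m ⟩
      (2 * m) * (2 * m)           ≡⟨ e₁ m ⟩
      m * (m * 4)                 ≤⟨ *-monoʳ-≤ m (*-monoʳ-≤ m 4≤m^l) ⟩
      m * (m * m ^ l)             ∎
      where
      e₁ : ∀ m → (2 * m) * (2 * m) ≡ m * (m * 4)
      e₁ = solve-∀
      k≤2m : k ≤ 2 * m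
      k≤2m = ≤-trans (m≤m+n k (1 + l)) (≤-reflexive (e₂ l))
        where
        e₂ : ∀ l → 3 + l + (1 + l) ≡ 2 * (2 + l)
        e₂ = solve-∀
      4≤m^l : 4 ≤ m ^ l
      4≤m^l = ≤-trans (^-monoˡ-≤ 2 (m≤m+n 2 l)) (^-monoʳ-≤ m (≤-trans (m≤m+n 2 6) 8≤l))
    kkq≤ : k * k * q ^ m ≤ z ^ m
    kkq≤ = begin
      k * k * q ^ m      ≤⟨ *-monoˡ-≤ (q ^ m) kk≤m^m ⟩
      m ^ m * q ^ m      ≡⟨ sym (^-distribʳ-* m q m) ⟩
      (m * q) ^ m        ≤⟨ ^-monoˡ-≤ m (m≤n+m (m * q) q′) ⟩
      z ^ m              ∎

  many-embeddings : ∀ {n G} (b : Blowup R n G) x → x + k ≤ n → x ^ k ≤ K * length (embeddings b)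
  many-embeddings (small _ n<k) x x+k≤n = contradiction (≤-trans (m≤n+m k x) x+k≤n) (<⇒≱ n<k)
  many-embeddings {n} (big G _ part size emb inj part-emb cover balanced sub _) x x+k≤n = begin
    x ^ k                                                ≤⟨ recursion-step x q x<kq ⟩
    K * q ^ k + k * y ^ k                                ≤⟨ +-mono-≤ (*-monoʳ-≤ K q^k≤) k*y^k≤ ⟩
    K * ∏ ks size + K * ∑ ks (λ i → length (embeddings (sub i))) ≡⟨ sym (*-distribˡ-+ K (∏ ks size) _) ⟩
    K * (∏ ks size + ∑ ks (λ i → length (embeddings (sub i)))) ≡⟨ cong (K *_) (sym length-embeddings) ⟩
    K * length (boxes transversal ++ concat (map nested ks)) ∎
    where
    open ≤-Reasoning
    transversal : Fin k → List (Fin n)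
    transversal i = map (emb i) (fins (size i))
    nested : Fin k → List (Vec (Fin n) k)
    nested i = map (Vec.map (emb i)) (embeddings (sub i))
    length-transversal : ∀ i → length (transversal i) ≡ size i
    length-transversal i = trans (length-map (emb i) (fins (size i))) (length-fins (size i))
    length-embeddings : length (boxes transversal ++ concat (map nested ks)) ≡ ∏ ks size + ∑ ks (λ i → length (embeddings (sub i)))
    length-embeddings = trans (length-++ (boxes transversal)) (cong₂ _+_
      (trans (length-boxes transversal) (∏-cong ks length-transversal))
      (trans (length-concat-map nested ks) (∑-cong ks (λ i → length-map (Vec.map (emb i)) (embeddings (sub i))))))
    n≤∑size : n ≤ ∑ ks size
    n≤∑size = begin
      n                                          ≡⟨ sym (length-fins n) ⟩
      length (fins n)                          ≤⟨ Unique-⊆⇒length≤ (fins-unique n) (λ {v} _ → covered′ v) ⟩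
      length (concat (map transversal ks))       ≡⟨ trans (length-concat-map transversal ks) (∑-cong ks length-transversal) ⟩
      ∑ ks size                                  ∎
      where
      covered′ : ∀ v → v ∈ concat (map transversal ks)
      covered′ v with cover v
      ... | a , eq = ∈-concat⁺′ (subst (_∈ transversal (part v)) eq (∈-map⁺ (emb (part v)) (∈-fins a))) (∈-map⁺ transversal (∈-fins (part v)))
    -- The other `m` parts exceed `size i` by at most 1, so `n ≤ k * size i + m`; the `k` spare
    -- vertices absorb the `m`.
    x<k*size : ∀ i → x < k * size i
    x<k*size i with extract (∈-fins i)
    ... | ys , ks↭ = +-cancelʳ-≤ m _ _ (begin
      suc x + m                          ≡⟨ sym (+-suc x m) ⟩
      x + k                              ≤⟨ x+k≤n ⟩
      n                                  ≤⟨ n≤∑size ⟩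
      ∑ ks size                          ≡⟨ ∑-↭ size ks↭ ⟩
      size i + ∑ ys size                 ≤⟨ +-monoʳ-≤ (size i) (∑-mono ys (λ j → balanced j i)) ⟩
      size i + ∑ ys (λ _ → suc (size i)) ≡⟨ cong (size i +_) (trans (∑-const (suc (size i)) ys) (cong (_* suc (size i)) length-ys)) ⟩
      size i + m * suc (size i)          ≡⟨ e m (size i) ⟩
      k * size i + m                     ∎)
      where
      length-ys : length ys ≡ m
      length-ys = suc-injective (trans (sym (↭-length ks↭)) (length-fins k))
      e : ∀ m s → s + m * suc s ≡ suc m * s + m
      e = solve-∀
    q = suc (x / k)
    y = q ∸ k
    x<kq : x < k * q
    x<kq = begin-strict
      x                   ≡⟨ m≡m%n+[m/n]*n x k ⟩
      x % k + x / k * k   <⟨ +-monoˡ-< (x / k * k) (m%n<n x k) ⟩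
      k + x / k * k       ≡⟨ *-comm q k ⟩
      k * q               ∎
    q≤size : ∀ i → q ≤ size i
    q≤size i = m<n*o⇒m/o<n (<-≤-trans (x<k*size i) (≤-reflexive (*-comm k (size i))))
    q^k≤ : q ^ k ≤ ∏ ks size
    q^k≤ = ≤-trans (≤-reflexive (sym (trans (∏-const q ks) (cong (q ^_) (length-fins k))))) (∏-mono-∈ ks (λ {i} _ → q≤size i))
    y^k≤ : ∀ i → y ^ k ≤ K * length (embeddings (sub i))
    y^k≤ i with k ≤? q
    ... | yes k≤q = many-embeddings (sub i) y (≤-trans (≤-reflexive (m∸n+n≡m k≤q)) (q≤size i))
    -- Truncated subtraction makes `y` zero here.
    ... | no k≰q  = ≤-trans (≤-reflexive (cong (_^ k) (m≤n⇒m∸n≡0 (<⇒≤ (≰⇒> k≰q))))) z≤n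
    k*y^k≤ : k * y ^ k ≤ K * ∑ ks (λ i → length (embeddings (sub i)))
    k*y^k≤ = begin
      k * y ^ k                                          ≡⟨ sym (trans (∑-const (y ^ k) ks) (cong (_* y ^ k) (length-fins k))) ⟩
      ∑ ks (λ _ → y ^ k)                                 ≤⟨ ∑-mono ks y^k≤ ⟩
      ∑ ks (λ i → K * length (embeddings (sub i)))       ≡⟨ ∑-*ˡ K (λ i → length (embeddings (sub i))) ks ⟩
      K * ∑ ks (λ i → length (embeddings (sub i)))       ∎

  -- Vertex sets of embeddings

  image : ∀ {n} → Vec (Fin n) k → Subset n
  image φ = Vec.tabulate (λ v → isYes (Fin.any? (λ i → lookup φ i Fin.≟ v)))

  ∈-image : ∀ {n} (φ : Vec (Fin n) k) v → (v ∈ₛ image φ) ⇔ (∃ λ i → lookup φ i ≡ v)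
  ∈-image φ v = mk⇔ to from
    where
    member? : ∀ v → Dec (∃ λ i → lookup φ i ≡ v)
    member? v = Fin.any? (λ i → lookup φ i Fin.≟ v)
    true⇒ : ∀ {P : Set} (P? : Dec P) → isYes P? ≡ true → P
    true⇒ (yes p) _ = p
    ⇒true : ∀ {P : Set} (P? : Dec P) → P → isYes P? ≡ true
    ⇒true (yes _) _ = refl
    ⇒true (no ¬p) p = contradiction p ¬p
    to : v ∈ₛ image φ → ∃ λ i → lookup φ i ≡ v
    to v∈ = true⇒ (member? v) (trans (sym (Vec.lookup∘tabulate (isYes ∘ member?) v)) (Vec.[]=⇒lookup v∈))
    from : (∃ λ i → lookup φ i ≡ v) → v ∈ₛ image φ
    from i = Vec.lookup⇒[]= v (image φ) (trans (Vec.lookup∘tabulate (isYes ∘ member?) v) (⇒true (member? v) i))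

  -- Each `i` is the only common point of two pairs `ij` and `ij′`. If `i` moved, both pairs would
  -- be swapped, and `j` and `j′` would both equal `σ i`.
  pairs-fixed⇒id : ∀ (σ : Fin k → Fin k) → (∀ i j → i ≢ j → (i ≡ σ i × j ≡ σ j) ⊎ (i ≡ σ j × j ≡ σ i)) → ∀ i → i ≡ σ i
  pairs-fixed⇒id σ pair i with two-others i
  ... | j , j′ , i≢j , i≢j′ , j≢j′ with pair i j i≢j | pair i j′ i≢j′
  ...   | inj₁ (i≡ , _) | _              = i≡
  ...   | inj₂ _        | inj₁ (i≡ , _)  = i≡
  ...   | inj₂ (_ , j≡) | inj₂ (_ , j′≡) = contradiction (trans j≡ (sym j′≡)) j≢j′

  -- A rainbow clique on at least three vertices has no non-trivial automorphism.
  image-injective : ∀ {n} {G : ColGraph T n} {φ ψ} → Embedding G φ → Embedding G ψ → image φ ≡ image ψ → φ ≡ ψ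
  image-injective {G = G} {φ} {ψ} (φ-inj , φ-col) (ψ-inj , ψ-col) eq = lookup-ext (λ i → trans (cong (lookup φ) (fixed i)) (proj₂ (σ i)))
    where
    σ : ∀ i → ∃ λ j → lookup φ j ≡ lookup ψ i
    σ i = Equivalence.to (∈-image φ (lookup ψ i)) (subst (lookup ψ i ∈ₛ_) (sym eq) (Equivalence.from (∈-image ψ (lookup ψ i)) (i , refl)))
    σ-inj : ∀ {i j} → proj₁ (σ i) ≡ proj₁ (σ j) → i ≡ j
    σ-inj {i} {j} e = ψ-inj (trans (sym (proj₂ (σ i))) (trans (cong (lookup φ) e) (proj₂ (σ j))))
    pair : ∀ i j → i ≢ j → (i ≡ proj₁ (σ i) × j ≡ proj₁ (σ j)) ⊎ (i ≡ proj₁ (σ j) × j ≡ proj₁ (σ i))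
    pair i j i≢j = rainbow i j _ _ i≢j (i≢j ∘ σ-inj)
      (trans (sym (ψ-col i j i≢j)) (trans (cong₂ (col G) (sym (proj₂ (σ i))) (sym (proj₂ (σ j)))) (φ-col _ _ (i≢j ∘ σ-inj))))
    fixed : ∀ i → i ≡ proj₁ (σ i)
    fixed = pairs-fixed⇒id (λ i → proj₁ (σ i)) pair

  -- The lowest base-k digits in which v and w differ.  The first argument is fuel; when it
  -- runs out the result is still a pair of distinct digits, so that its colour is decidable.
  digits : ℕ → ℕ → ℕ → Fin k × Fin k
  digits zero    v w = zero , suc zero
  digits (suc f) v w with v mod k Fin.≟ w mod k
  ... | yes _ = digits f (v / k) (w / k)
  ... | no  _ = v mod k , w mod k

  digits-differ : ∀ f v w → proj₁ (digits f v w) ≢ proj₂ (digits f v w)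
  digits-differ zero    v w ()
  digits-differ (suc f) v w with v mod k Fin.≟ w mod k
  ... | yes _   = digits-differ f (v / k) (w / k)
  ... | no v≢w = v≢w

  colour : ℕ → ℕ → ℕ → T
  colour f v w = uncurry (col R) (digits f v w)

  colour-sym : ∀ f v w → colour f v w ≡ colour f w v
  colour-sym zero    v w = refl
  colour-sym (suc f) v w with v mod k Fin.≟ w mod k | w mod k Fin.≟ v mod k
  ... | yes _   | yes _   = colour-sym f (v / k) (w / k)
  ... | yes v≡w | no w≢v  = contradiction (sym v≡w) w≢v
  ... | no v≢w  | yes w≡v = contradiction (sym w≡v) v≢w
  ... | no _    | no _    = col-sym R (v mod k) (w mod k)

  colour-same : ∀ f v w → v mod k ≡ w mod k → colour (suc f) v w ≡ colour f (v / k) (w / k)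
  colour-same f v w eq with v mod k Fin.≟ w mod k
  ... | yes _ = refl
  ... | no ne = contradiction eq ne

  colour-differ : ∀ f v w → v mod k ≢ w mod k → colour (suc f) v w ≡ col R (v mod k) (w mod k)
  colour-differ f v w ne with v mod k Fin.≟ w mod k
  ... | yes eq = contradiction eq ne
  ... | no _   = refl

  digit-graph : ℕ → ∀ n → ColGraph T n
  digit-graph f n = mkColGraph (λ v w → colour f (toℕ v) (toℕ w)) (λ v w → colour-sym f (toℕ v) (toℕ w))

  module _ (i : Fin k) (a : ℕ) where
    [i+ak]/k : (toℕ i + a * k) / k ≡ a
    [i+ak]/k = trans (+-distrib-/ (toℕ i) (a * k) small-sum) (cong₂ _+_ (m<n⇒m/n≡0 (Fin.toℕ<n i)) (m*n/n≡m a k))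
      where
      small-sum : toℕ i % k + a * k % k < k
      small-sum = ≤-<-trans (≤-reflexive (trans (cong (toℕ i % k +_) (m*n%n≡0 a k)) (+-identityʳ _))) (m%n<n (toℕ i) k)

    [i+ak]mod-k : (toℕ i + a * k) mod k ≡ i
    [i+ak]mod-k = Fin.toℕ-injective (trans (Fin.toℕ-fromℕ< (m%n<n (toℕ i + a * k) k))
      (trans ([m+kn]%n≡m%n (toℕ i) a k) (m<n⇒m%n≡m (Fin.toℕ<n i))))

  -- Lowest digits come first because residue classes modulo `k` are balanced by themselves, and
  -- division by `k` maps each class onto an initial segment with the same kind of colouring. `G` is
  -- only required to agree pointwise with that colouring, so that the statement applies to
  -- restrictions.
  digit-blowup : ∀ f n (G : ColGraph T n) → n ≤ f → (∀ v w → col G v w ≡ colour f (toℕ v) (toℕ w)) → Blowup R n G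
  digit-blowup f n G n≤f G≡ with n <? k
  ... | yes n<k = small G n<k
  digit-blowup zero    n G n≤f G≡ | no n≮k = contradiction (≤-<-trans n≤f (s≤s z≤n)) n≮k
  digit-blowup (suc f) n G n≤f G≡ | no n≮k =
    big G k≤n part size emb emb-injective part-emb cover balanced
      (λ i → digit-blowup f (size i) (restrict G (emb i)) (≤-pred (≤-trans (size<n i) n≤f)) (sub-colour i)) cross
    where
    open ≤-Reasoning
    k≤n = ≮⇒≥ n≮k
    part : Fin n → Fin k
    part v = toℕ v mod k
    -- The number of `v < n` in the residue class of `i`, the ceiling of `(n - i) / k`; as `i ≤ m`,
    -- this form never truncates.
    size : Fin k → ℕ
    size i = (n + (m ∸ toℕ i)) / k
    [m∸i]+i : ∀ i → m ∸ toℕ i + toℕ i ≡ m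
    [m∸i]+i i = m∸n+n≡m (≤-pred (Fin.toℕ<n i))
    index<n : ∀ i a → a < size i → toℕ i + a * k < n
    index<n i a a<size = +-cancelʳ-≤ m _ _ (begin
      suc (toℕ i + a * k) + m               ≡⟨ e₁ (toℕ i) (a * k) m ⟩
      suc a * k + toℕ i                     ≤⟨ +-monoˡ-≤ (toℕ i) (≤-trans (*-monoˡ-≤ k a<size) (m/n*n≤m _ k)) ⟩
      n + (m ∸ toℕ i) + toℕ i               ≡⟨ trans (+-assoc n _ _) (cong (n +_) ([m∸i]+i i)) ⟩
      n + m                                 ∎)
      where
      e₁ : ∀ i a m → suc (i + a) + m ≡ suc m + a + i
      e₁ = solve-∀
    emb : ∀ i → Fin (size i) → Fin n
    emb i a = fromℕ< (index<n i (toℕ a) (Fin.toℕ<n a))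
    toℕ-emb : ∀ i a → toℕ (emb i a) ≡ toℕ i + toℕ a * k
    toℕ-emb i a = Fin.toℕ-fromℕ< (index<n i (toℕ a) (Fin.toℕ<n a))
    emb-injective : ∀ i {a b} → emb i a ≡ emb i b → a ≡ b
    emb-injective i {a} {b} eq = Fin.toℕ-injective (*-cancelʳ-≡ (toℕ a) (toℕ b) k
      (+-cancelˡ-≡ (toℕ i) _ _ (trans (sym (toℕ-emb i a)) (trans (cong toℕ eq) (toℕ-emb i b)))))
    part-emb : ∀ i a → part (emb i a) ≡ i
    part-emb i a = trans (cong (_mod k) (toℕ-emb i a)) ([i+ak]mod-k i (toℕ a))
    cover : ∀ v → ∃ λ a → emb (part v) a ≡ v
    cover v = fromℕ< q<size , Fin.toℕ-injective (trans (toℕ-emb (part v) (fromℕ< q<size))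
        (trans (cong₂ (λ x y → x + y * k) toℕ-part (Fin.toℕ-fromℕ< q<size)) (sym (m≡m%n+[m/n]*n (toℕ v) k))))
      where
      toℕ-part : toℕ (part v) ≡ toℕ v % k
      toℕ-part = Fin.toℕ-fromℕ< (m%n<n (toℕ v) k)
      q = toℕ v / k
      q<size : q < size (part v)
      q<size = ≤-trans (≤-reflexive (sym (m*n/n≡m (suc q) k))) (/-monoˡ-≤ k (+-cancelʳ-≤ (toℕ (part v)) _ _ (begin
        suc q * k + toℕ (part v)                ≡⟨ cong (suc q * k +_) toℕ-part ⟩
        suc q * k + toℕ v % k                   ≡⟨ e₁ m (q * k) (toℕ v % k) ⟩
        suc (toℕ v % k + q * k) + m             ≡⟨ cong (λ z → suc z + m) (sym (m≡m%n+[m/n]*n (toℕ v) k)) ⟩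
        suc (toℕ v) + m                         ≤⟨ +-monoˡ-≤ m (Fin.toℕ<n v) ⟩
        n + m                                   ≡⟨ sym (trans (+-assoc n _ _) (cong (n +_) ([m∸i]+i (part v)))) ⟩
        n + (m ∸ toℕ (part v)) + toℕ (part v)   ∎)))
        where
        e₁ : ∀ m a r → suc m + a + r ≡ suc (r + a) + m
        e₁ = solve-∀
    balanced : ∀ i j → size i ≤ suc (size j)
    balanced i j = begin
      size i                             ≤⟨ /-monoˡ-≤ k (+-monoʳ-≤ n (≤-trans (m∸n≤m m (toℕ i)) (≤-trans (n≤1+n m) (m≤n+m k (m ∸ toℕ j))))) ⟩
      (n + (m ∸ toℕ j + k)) / k          ≡⟨ cong (_/ k) (sym (+-assoc n (m ∸ toℕ j) k)) ⟩
      (n + (m ∸ toℕ j) + k) / k          ≡⟨ m/n≡1+[m∸n]/n {n + (m ∸ toℕ j) + k} {k} (m≤n+m k (n + (m ∸ toℕ j))) ⟩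
      suc ((n + (m ∸ toℕ j) + k ∸ k) / k) ≡⟨ cong (λ z → suc (z / k)) (m+n∸n≡m (n + (m ∸ toℕ j)) k) ⟩
      suc (size j)                       ∎
    -- Each level spends one unit of fuel and loses at least one vertex, so fuel `n` suffices.
    size<n : ∀ i → size i < n
    size<n i = m<n*o⇒m/o<n (begin-strict
      n + (m ∸ toℕ i)   ≤⟨ +-monoʳ-≤ n (m∸n≤m m (toℕ i)) ⟩
      n + m             <⟨ +-monoʳ-< n (≤-trans k≤n (≤-trans (≤-reflexive (sym (*-identityʳ n))) (*-monoʳ-≤ n (s≤s z≤n)))) ⟩
      n + n * m         ≡⟨ sym (*-suc n m) ⟩
      n * k             ∎)
    sub-colour : ∀ i a b → col G (emb i a) (emb i b) ≡ colour f (toℕ a) (toℕ b)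
    sub-colour i a b = trans (G≡ (emb i a) (emb i b))
      (trans (cong₂ (colour (suc f)) (toℕ-emb i a) (toℕ-emb i b))
      (trans (colour-same f (toℕ i + toℕ a * k) (toℕ i + toℕ b * k) (trans ([i+ak]mod-k i (toℕ a)) (sym ([i+ak]mod-k i (toℕ b)))))
      (cong₂ (colour f) ([i+ak]/k i (toℕ a)) ([i+ak]/k i (toℕ b)))))
    cross : ∀ v w → part v ≢ part w → col G v w ≡ col R (part v) (part w)
    cross v w ne = trans (G≡ v w) (colour-differ f (toℕ v) (toℕ w) ne)

  -- Both sides are colours of edges of `R`, so rainbowness reduces their equality to that of
  -- digits, even if equality in `T` is undecidable.
  colour≟ : ∀ f v w i j → i ≢ j → Dec (colour f v w ≡ col R i j)
  colour≟ f v w i j i≢j = map′ to from (((a Fin.≟ i) ×-dec (b Fin.≟ j)) ⊎-dec ((a Fin.≟ j) ×-dec (b Fin.≟ i)))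
    where
    a = proj₁ (digits f v w)
    b = proj₂ (digits f v w)
    to : (a ≡ i × b ≡ j) ⊎ (a ≡ j × b ≡ i) → col R a b ≡ col R i j
    to (inj₁ (a≡i , b≡j)) = cong₂ (col R) a≡i b≡j
    to (inj₂ (a≡j , b≡i)) = trans (cong₂ (col R) a≡j b≡i) (col-sym R j i)
    from : col R a b ≡ col R i j → (a ≡ i × b ≡ j) ⊎ (a ≡ j × b ≡ i)
    from = rainbow a b i j (digits-differ f v w) i≢j

  abstract
    -- An exact count is a complete list of copies, obtained by filtering all subsets. Embeddings
    -- are searched among words, of which there are finitely many.
    inducedCopy? : ∀ f n S → Dec (InducedCopy R (digit-graph f n) S)
    inducedCopy? f n S = map′ to from (Any.any? (λ ψ → injective? ψ ×-dec range? ψ ×-dec colours? ψ) (words (fins n) k))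
      where
      G : ColGraph T n
      G = digit-graph f n
      Inj Range Colours : Vec (Fin n) k → Set
      Inj ψ     = ∀ i j → lookup ψ i ≡ lookup ψ j → i ≡ j
      Range ψ   = ∀ v → (v ∈ₛ S → ∃ λ i → lookup ψ i ≡ v) × ((∃ λ i → lookup ψ i ≡ v) → v ∈ₛ S)
      Colours ψ = ∀ i j → i ≢ j → col G (lookup ψ i) (lookup ψ j) ≡ col R i j
      injective? : ∀ ψ → Dec (Inj ψ)
      injective? ψ = Fin.all? λ i → Fin.all? λ j → lookup ψ i Fin.≟ lookup ψ j →-dec i Fin.≟ j
      range? : ∀ ψ → Dec (Range ψ)
      range? ψ = Fin.all? λ v → ((v Subset.∈? S) →-dec Fin.any? (λ i → lookup ψ i Fin.≟ v)) ×-dec (Fin.any? (λ i → lookup ψ i Fin.≟ v) →-dec (v Subset.∈? S))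
      colours? : ∀ ψ → Dec (Colours ψ)
      colours? ψ = Fin.all? λ i → Fin.all? λ j → off-diagonal i j
        where
        off-diagonal : ∀ i j → Dec (i ≢ j → col G (lookup ψ i) (lookup ψ j) ≡ col R i j)
        off-diagonal i j with i Fin.≟ j
        ... | yes i≡j = yes (λ i≢j → contradiction i≡j i≢j)
        ... | no i≢j  = map′ (λ eq _ → eq) (λ eq → eq i≢j) (colour≟ f (toℕ (lookup ψ i)) (toℕ (lookup ψ j)) i j i≢j)
      to : Any (λ ψ → Inj ψ × Range ψ × Colours ψ) (words (fins n) k) → InducedCopy R G S
      to any with find any
      ... | ψ , _ , inj , range , colours = lookup ψ , (λ {i} {j} → inj i j) , (λ v → mk⇔ (proj₁ (range v)) (proj₂ (range v))) , colours
      from : InducedCopy R G S → Any (λ ψ → Inj ψ × Range ψ × Colours ψ) (words (fins n) k)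
      from (φ , inj , range , colours) = lose (∈-boxes⁺ {m = k} (λ _ → fins n) ψ (λ i → ∈-fins (lookup ψ i)))
        ( (λ i j eq → inj (trans (sym (ψ≗φ i)) (trans eq (ψ≗φ j))))
        , (λ v → (λ v∈ → let i , eq = Equivalence.to (range v) v∈ in i , trans (ψ≗φ i) eq)
               , (λ (i , eq) → Equivalence.from (range v) (i , trans (sym (ψ≗φ i)) eq)))
        , (λ i j i≢j → trans (cong₂ (col G) (ψ≗φ i) (ψ≗φ j)) (colours i j i≢j)))
        where
        ψ : Vec (Fin n) k
        ψ = Vec.tabulate φ
        ψ≗φ : ∀ i → lookup ψ i ≡ φ i
        ψ≗φ = Vec.lookup∘tabulate φ

  lower-bound : ∀ n → ∃ λ (G : ColGraph T n) → Blowup R n G × ∃ λ c → ICount R G c × (∀ x → x + k ≤ n → x ^ k ≤ K * c)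
  lower-bound n = G , b , length L , (L , L! , L⇔ , refl) , λ x x+k≤n →
    ≤-trans (many-embeddings b x x+k≤n) (*-monoʳ-≤ K embeddings≤L)
    where
    G = digit-graph n n
    b = digit-blowup n n G ≤-refl (λ _ _ → refl)
    subsets = words (true ∷ false ∷ []) n
    L = filter (inducedCopy? n n) subsets
    L! : Unique L
    L! = Unique.filter⁺ (inducedCopy? n n) (boxes-unique {m = n} (λ _ → true ∷ false ∷ []) (λ _ → ((λ ()) ∷ []) ∷ [] ∷ []))
    ∈-subsets : ∀ S → S ∈ subsets
    ∈-subsets S = ∈-boxes⁺ {m = n} (λ _ → true ∷ false ∷ []) S (λ v → ∈-bools (lookup S v))
      where
      ∈-bools : ∀ x → x ∈ true ∷ false ∷ []
      ∈-bools true  = here refl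
      ∈-bools false = there (here refl)
    L⇔ : ∀ S → (S ∈ L) ⇔ InducedCopy R G S
    L⇔ S = mk⇔ (λ S∈ → proj₂ (∈-filter⁻ (inducedCopy? n n) {xs = subsets} S∈)) (∈-filter⁺ (inducedCopy? n n) (∈-subsets S))
    embeddings≤L : length (embeddings b) ≤ length L
    embeddings≤L = ≤-trans (≤-reflexive (sym (length-map image (embeddings b))))
      (Unique-⊆⇒length≤ (Unique-map-∈ image (embeddings-unique b)
          (λ φ∈ ψ∈ → image-injective {G = G} (embeddings-sound b φ∈) (embeddings-sound b ψ∈)))
        (λ S∈ → Equivalence.from (L⇔ _) (is-copy (∈-map⁻ image S∈))))
      where
      is-copy : ∀ {S} → (∃ λ φ → φ ∈ embeddings b × S ≡ image φ) → InducedCopy R G S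
      is-copy (φ , φ∈ , refl) with embeddings-sound b φ∈
      ... | inj , colours = lookup φ , inj , ∈-image φ , colours

  -- The limit of the densities

  instance
    K≢0 : NonZero K
    K≢0 = >-nonZero (m<n⇒0<n∸m (m<m*n k (k ^ m) (*-mono-≤ {2} {k} {1} (s≤s (s≤s z≤n)) (m^n>0 k (1 + l)))))

  -- The upper bound holds for all graphs and the lower bound is witnessed by a blow-up. Hence one
  -- argument covers every family that contains the blow-ups, in particular both limits of the
  -- theorem.
  limit : (Fam : ∀ n → ColGraph T n → Set) → (∀ n G → Blowup R n G → Fam n G) →
          LimitIs (λ n → IsMaxDensity R n (Fam n)) (divℕ (k !) K)
  limit Fam Blowup⊆Fam (mkℚ ℤ.-[1+ _ ] _ _)    (ℚ.*<* ())
  limit Fam Blowup⊆Fam (mkℚ (pos zero) _ _)    (ℚ.*<* (ℤ.+<+ ()))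
  limit Fam Blowup⊆Fam ε@(mkℚ (pos (suc e)) d cop) 0<ε = N , λ n N≤n x max → close n N≤n x max (lower-bound n)
    where
    open ≤-Reasoning
    Y₀ N : ℕ
    -- With `y = n - k` and `X = n + 1 ≤ 2 * y`, the error `D = k * suc k * X ^ m` is at most
    -- `k * suc k * 2 ^ m * y ^ m`. So `y ≥ Y₀` keeps `k ! * suc d * D` below `y ^ k`.
    Y₀ = k ! * suc d * (k * suc k) * 2 ^ m
    N = Y₀ + suc k + k
    close : ∀ n → N ≤ n → ∀ x → IsMaxDensity R n (Fam n) x →
            (∃ λ (G : ColGraph T n) → Blowup R n G × ∃ λ c → ICount R G c × (∀ x → x + k ≤ n → x ^ k ≤ K * c)) →
            ∣ x -ℚ divℕ (k !) K ∣ <ℚ ε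
    close n N≤n x ((G , _ , c , Gc , c/B≡x) , maximal) (G′ , b , c′ , G′c′ , many) =
      density-close e d cop (k !) K B c c′ D upper lower dD≤KB x c/B≡x (maximal G′ (Blowup⊆Fam n G′ b) c′ G′c′)
      where
      B y X D : ℕ
      B = n C k
      y = n ∸ k
      X = suc n
      D = k * suc k * X ^ m
      y+k≡n : y + k ≡ n
      y+k≡n = m∸n+n≡m (≤-trans (m≤n+m k (Y₀ + suc k)) N≤n)
      y≥ : Y₀ + suc k ≤ y
      y≥ = +-cancelʳ-≤ k _ _ (≤-trans N≤n (≤-reflexive (sym y+k≡n)))
      X≡y+[1+k] : X ≡ y + suc k
      X≡y+[1+k] = trans (cong suc (sym y+k≡n)) (sym (+-suc y k))
      y^k≤k!B : y ^ k ≤ k ! * B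
      y^k≤k!B = subst (λ z → y ^ k ≤ k ! * (z C k)) y+k≡n (y^k≤k!*[y+k]Ck y k)
      X^k≤y^k+D : X ^ k ≤ y ^ k + D
      X^k≤y^k+D = ^-growth (suc k) (≤-reflexive X≡y+[1+k]) m
      X≤2y : X ≤ 2 * y
      X≤2y = begin
        suc n           ≡⟨ X≡y+[1+k] ⟩
        y + suc k       ≤⟨ +-monoʳ-≤ y (≤-trans (m≤n+m (suc k) Y₀) y≥) ⟩
        y + y           ≡⟨ cong (y +_) (sym (+-identityʳ y)) ⟩
        2 * y           ∎
      k!dD≤y^k : k ! * (suc d * D) ≤ y ^ k
      k!dD≤y^k = begin
        k ! * (suc d * (k * suc k * X ^ m))           ≤⟨ *-monoʳ-≤ (k !) (*-monoʳ-≤ (suc d) (*-monoʳ-≤ (k * suc k) (^-monoˡ-≤ m X≤2y))) ⟩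
        k ! * (suc d * (k * suc k * (2 * y) ^ m))     ≡⟨ cong (λ z → k ! * (suc d * (k * suc k * z))) (^-distribʳ-* 2 y m) ⟩
        k ! * (suc d * (k * suc k * (2 ^ m * y ^ m))) ≡⟨ regroup (k !) (suc d) (k * suc k) (2 ^ m) (y ^ m) ⟩
        Y₀ * y ^ m                                    ≤⟨ *-monoˡ-≤ (y ^ m) (≤-trans (m≤m+n Y₀ (suc k)) y≥) ⟩
        y * y ^ m                                     ∎
        where
        regroup : ∀ f d k t y → f * (d * (k * (t * y))) ≡ f * d * k * t * y
        regroup = solve-∀
      dD≤KB : suc d * D ≤ K * B
      dD≤KB = *-cancelˡ-≤ (k !) {{k !≢0}} (begin
        k ! * (suc d * D)   ≤⟨ k!dD≤y^k ⟩
        y ^ k               ≤⟨ y^k≤k!B ⟩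
        k ! * B             ≤⟨ *-monoʳ-≤ (k !) (m≤n*m B K) ⟩
        k ! * (K * B)       ∎)
      instance
        B≢0 : NonZero B
        B≢0 = ≢-nonZero (λ B≡0 → contradiction (≤-trans y^k≤k!B (≤-reflexive (trans (cong (k ! *_) B≡0) (*-zeroʳ (k !)))))
                (<⇒≱ (m^n>0 y {{>-nonZero (≤-trans (≤-trans (s≤s z≤n) (m≤n+m (suc k) Y₀)) y≥)}} k)))
      upper : K * c < k ! * B + D
      upper = begin-strict
        K * c              <⟨ upper-bound G c Gc ⟩
        X ^ k              ≤⟨ X^k≤y^k+D ⟩
        y ^ k + D          ≤⟨ +-monoˡ-≤ D y^k≤k!B ⟩
        k ! * B + D        ∎
      lower : k ! * B < K * c′ + D
      lower = begin-strict
        k ! * B            ≤⟨ k!*nCk≤n^k n k ⟩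
        n ^ k              <⟨ ^-monoˡ-< k (n<1+n n) ⟩
        X ^ k              ≤⟨ X^k≤y^k+D ⟩
        y ^ k + D          ≤⟨ +-monoˡ-≤ D (many y (≤-reflexive y+k≡n)) ⟩
        K * c′ + D         ∎

theorem1p2 : (k : ℕ) → 11 ≤ k → (T : Set) → (R : ColGraph T k) → Rainbow R →
    FractalizerWith R (divℕ (k !) (k ^ k ∸ k))
theorem1p2 (suc (suc (suc l))) (s≤s (s≤s (s≤s 8≤l))) T R rainbow =
  limit (λ _ _ → ⊤) (λ _ _ _ → tt) , limit (Blowup R) (λ _ _ b → b)
  where
  limit = RainbowClique.limit l 8≤l T R rainbow
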